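{- Let $k\ge 3$ be an integer with $k\equiv 1$ or $3 \pmod 6$. For every $\delta>0$ there exist $\epsilon>0$ and $n_0$ such that the following holds for all $n\ge n_0$. Suppose that $\mathcal{H}$ is a cancellative $3$-graph on $n$ vertices that satisfies \[ \left(d(\partial\mathcal{H}) - \frac{k-1}{k}\right)^2 + \left(d(\mathcal{H}) - \frac{k-1}{k^2}\right)^2 \le \epsilon . \] Then there is some $\mathcal{S}\in \mathrm{STS}(k)$ such that, after removing at most $\delta n^3$ edges from $\mathcal{H}$, the resulting $3$-graph is $\mathcal{S}$-colorable.
   Context: A $3$-graph is a collection of $3$-element subsets (edges) of a vertex set. A $3$-graph $\mathcal{H}$ is cancellative if it does not contain three distinct edges $A,B,C$ with $A\triangle B\subseteq C$. The shadow of $\mathcal{H}$ is $\partial\mathcal{H}=\{A: |A|=2,\ A\subset B \text{ for some } B\in\mathcal{H}\}$. For a $3$-graph $\mathcal{H}$ on $n$ vertices, $d(\mathcal{H})=|\mathcal{H}|/\binom{n}{3}$ and $d(\partial\mathcal{H})=|\partial\mathcal{H}|/\binom{n}{2}$. A Steiner triple system on $k$ vertices is a $3$-graph on $k$ vertices in which every pair of vertices lies in exactly one edge; $\mathrm{STS}(k)$ denotes the family of all Steiner triple systems on $k$ vertices. For $3$-graphs $\mathcal{H},\mathcal{G}$, $\mathcal{H}$ is $\mathcal{G}$-colorable if there is a map $\phi:V(\mathcal{H})\to V(\mathcal{G})$ with $\phi(E)\in\mathcal{G}$ for every $E\in\mathcal{H}$. -}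

module Defs where

open import Data.Nat using (ℕ; zero; suc; _^_)
import Data.Nat as ℕ
open import Data.Nat.Combinatorics using (_C_)
open import Data.Integer using (+_)
open import Data.Rational using (ℚ; _/_; 0ℚ)
open import Data.Fin using (Fin)
open import Data.Fin.Subset using (Subset; _∈_; _∉_; _⊆_; ∣_∣; outside; inside)
open import Data.Fin.Subset.Properties using (_⊆?_)
open import Data.Vec using (_∷_; [])
open import Data.List using (List; []; _∷_; length; filter; map; _++_)
import Data.List.Membership.Propositional as LM
open import Data.List.Relation.Unary.Unique.Propositional using (Unique)
open import Data.List.Relation.Unary.All using (All)
open import Data.List.Relation.Unary.Any using (Any)
import Data.List.Relation.Unary.Any as Any
open import Data.Product using (Σ; ∃; ∃-syntax; _×_; _,_)
open import Data.Sum using (_⊎_)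
open import Relation.Nullary using (¬_)
open import Relation.Nullary.Decidable using (_×-dec_)
open import Relation.Binary.PropositionalEquality using (_≡_; _≢_)

_∈ₗ_ : ∀ {n} → Subset n → List (Subset n) → Set
A ∈ₗ xs = A LM.∈ xs

record ThreeGraph (n : ℕ) : Set where
  field
    edges  : List (Subset n)
    unique : Unique edges
    size3  : All (λ E → ∣ E ∣ ≡ 3) edges
open ThreeGraph public

∣_∣ₑ : ∀ {n} → ThreeGraph n → ℕ
∣ H ∣ₑ = length (edges H)

allSubsets : (n : ℕ) → List (Subset n)
allSubsets zero    = [] ∷ []
allSubsets (suc n) = map (outside ∷_) (allSubsets n) ++ map (inside ∷_) (allSubsets n)

shadow : ∀ {n} → ThreeGraph n → List (Subset n)
shadow {n} H = filter (λ A → (∣ A ∣ ℕ.≟ 2) ×-dec Any.any? (A ⊆?_) (edges H)) (allSubsets n)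

frac : ℕ → ℕ → ℚ
frac a zero    = 0ℚ
frac a (suc b) = (+ a) / suc b

choose : ℕ → ℕ → ℕ
choose n k = n C k

density : ∀ {n} → ThreeGraph n → ℚ
density {n} H = frac ∣ H ∣ₑ (choose n 3)

shadowDensity : ∀ {n} → ThreeGraph n → ℚ
shadowDensity {n} H = frac (length (shadow H)) (choose n 2)

Cancellative : ∀ {n} → ThreeGraph n → Set
Cancellative {n} H =
  ¬ (Σ (Subset n) λ A → Σ (Subset n) λ B → Σ (Subset n) λ C →
       A ∈ₗ edges H × B ∈ₗ edges H × C ∈ₗ edges H ×
       A ≢ B × B ≢ C × A ≢ C ×
       (∀ (x : Fin n) → ((x ∈ A × x ∉ B) ⊎ (x ∈ B × x ∉ A)) → x ∈ C))

IsSTS : ∀ {k} → ThreeGraph k → Set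
IsSTS {k} S = ∀ (x y : Fin k) → x ≢ y →
  Σ (Subset k) λ E → (E ∈ₗ edges S × x ∈ E × y ∈ E) ×
    (∀ F → F ∈ₗ edges S → x ∈ F → y ∈ F → F ≡ E)

Colorable : ∀ {n m} → ThreeGraph n → ThreeGraph m → Set
Colorable {n} {m} H G = Σ (Fin n → Fin m) λ φ →
  ∀ E → E ∈ₗ edges H → Σ (Subset m) λ F → F ∈ₗ edges G ×
    (∀ y → y ∈ F → Σ (Fin n) λ x → x ∈ E × φ x ≡ y) ×
    (∀ x → x ∈ E → φ x ∈ F)

SubGraph : ∀ {n} → ThreeGraph n → ThreeGraph n → Set
SubGraph H' H = ∀ E → E ∈ₗ edges H' → E ∈ₗ edges H

{-# OPTIONS --safe #-}
module Submission where

-- Let c(u) be the number of vertices not adjacent to u in the shadow and N(vw) the set of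
-- common neighbours of a shadow pair vw. Cancellativity makes N(vw) independent in the shadow,
-- so |N(vw)| ≤ c(u) for u ∈ N(vw), that is Σ_{u ∈ N(vw)} 1/c(u) ≤ 1. Weighting the pairs vw by
-- (c(v) + c(w))/2 and applying AM-GM on every edge gives 6|H| ≤ Σ_u d(u) c(u) with
-- d(u) = n - c(u). Near the extremal densities this forces c(u) ≈ n/k for almost all u,
-- |N(vw)| ≈ n/k for almost all shadow pairs, and N(vw) ≈ (non-neighbours of u) for almost all edges uvw.
--
-- Hence k sets N(vw), chosen greedily, cover almost all vertices; they are independent, so
-- they form a nearly complete k-partition of the shadow. For two vertices u, u′ in the same class,
-- uvw and u′vw are almost always both edges or both non-edges; changing the three coordinates
-- one at a time shows that each triple of classes spans almost all or almost no
-- possible edges. The dense triples of classes form a Steiner triple system, because the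
-- codegree n/k of a pair between two classes has room for exactly one further class.

open import Defs

-- All counts are sums of 0/1 integers over ordered tuples, and "almost all" always means that a sum
-- of errors is small; no exceptional vertex or pair is deleted along the way.
--
-- The obstacle is the greedy cover. The error sums are averages and say nothing about the single
-- pair `vw` picked at a step, and a careless `N(vw)` could cut through a class. What is controlled
-- instead is the number of nonadjacent pairs leaving the uncovered set. While it is small, every
-- `N(vw)` lies almost wholly inside or almost wholly outside that set, and an edge count yields one
-- with nearly `n / k` uncovered vertices. Removing it weakens the control by a fixed factor `q`, so
-- the initial accuracy must be of order `q ^ K`.
--
-- Hence the constants are chosen from the end: the permitted loss `1 / Δ` gives the density
-- threshold `1 / G`, then the uncovered share `1 / β`, the accuracy `1 / P` of the error sums, and
-- last the tolerance on the two densities. The few vertices left uncovered are put into a class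
-- anyway and carried along as an error term.

module StableConfigurations where
  open import Data.Integer hiding (suc)
  open import Data.Integer.Properties
  open import Data.Integer.Tactic.RingSolver
  open import Data.Nat using (ℕ; zero; suc; z≤n; s≤s; _!)
  import Data.Nat as ℕ
  import Data.Nat.Properties as ℕ
  open import Data.Nat.Divisibility using (divides; ∣-trans; m∣m*n; m≤n⇒m!∣n!)
  open import Data.Bool using (if_then_else_)
  open import Data.Fin using (Fin; fromℕ<)
  import Data.Fin as Fin
  open import Data.Fin.Properties using (fromℕ<-injective)
  open import Data.List using (List; _∷_; []; _++_; map; filter; length; cartesianProduct; allFin)
  open import Data.List.Properties using (length-tabulate)
  open import Data.List.Membership.Propositional using (_∈_)
  open import Data.List.Membership.Propositional.Properties using (∈-allFin; ∈-filter⁻)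
  import Data.List.Relation.Unary.All as All
  open import Data.List.Relation.Unary.AllPairs using ([]; _∷_)
  open import Data.List.Relation.Unary.Any using (here; there)
  open import Data.List.Relation.Unary.Unique.Propositional using (Unique)
  open import Data.List.Relation.Unary.Unique.Propositional.Properties using (allFin⁺)
  open import Data.Product using (Σ; ∃; _×_; _,_; proj₁; proj₂)
  open import Data.Sum using (_⊎_; inj₁; inj₂)
  open import Data.Empty using (⊥; ⊥-elim)
  open import Relation.Binary.PropositionalEquality
  open import Relation.Nullary using (Dec; yes; no; does; ¬_)
  open import Relation.Unary using (Decidable)

  -- Integer inequalities by nonnegativity certificates

  le⇒0≤ : ∀ {a b} → a ≤ b → 0ℤ ≤ b - a
  le⇒0≤ = i≤j⇒0≤j-i

  -- The polynomial inequalities below are proved by certificates: `e` is a nonnegative combination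
  -- of products of hypotheses, built with `⊕` and `⊗` so that its shape is read off the
  -- nonnegativity proof, and the ring solver checks that `b` exceeds `a` by exactly `e`.
  cert : ∀ {a b e} → 0ℤ ≤ e → b ≡ a + e → a ≤ b
  cert {a} {b} {e} p q = subst (a ≤_) (sym q) (subst (_≤ a + e) (+-identityʳ a) (+-monoʳ-≤ a p))

  infixl 6 _⊕_
  infixl 7 _⊗_
  _⊕_ : ∀ {a b} → 0ℤ ≤ a → 0ℤ ≤ b → 0ℤ ≤ a + b
  _⊕_ = +-mono-≤

  _⊗_ : ∀ {a b} → 0ℤ ≤ a → 0ℤ ≤ b → 0ℤ ≤ a * b
  _⊗_ {+ a} {+ b} p q = subst (0ℤ ≤_) (pos-* a b) (+≤+ z≤n)

  0≤+ : ∀ {m} → 0ℤ ≤ + m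
  0≤+ = +≤+ z≤n

  cancel : ∀ m {a b} → 0ℤ < m → m * a ≤ m * b → a ≤ b
  cancel m {a} {b} p h = *-cancelˡ-≤-pos a b m {{positive p}} h

  scale-≤ : ∀ b x y → 0ℤ ≤ b → x ≤ y → b * x ≤ b * y
  scale-≤ b x y p h = cert (p ⊗ le⇒0≤ h) (solve (b ∷ x ∷ y ∷ []))

  1≤⇒0≤ : ∀ {a} → 1ℤ ≤ a → 0ℤ ≤ a
  1≤⇒0≤ = ≤-trans 0≤+

  1≤⇒0< : ∀ {a} → 1ℤ ≤ a → 0ℤ < a
  1≤⇒0< = <-≤-trans (+<+ (s≤s z≤n))

  1≤* : ∀ {a b} → 1ℤ ≤ a → 1ℤ ≤ b → 1ℤ ≤ a * b
  1≤* {a} {b} p q = cert (1≤⇒0≤ p ⊗ le⇒0≤ q ⊕ le⇒0≤ p) (solve (a ∷ b ∷ []))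

  sq : ∀ x → 0ℤ ≤ x * x
  sq (+ n) = _⊗_ {+ n} {+ n} 0≤+ 0≤+
  sq (-[1+ n ]) = 0≤+

  abs : ℤ → ℤ
  abs x = + ∣ x ∣

  abs-sq : ∀ x → abs x * abs x ≡ x * x
  abs-sq (+ n) = refl
  abs-sq (-[1+ n ]) = refl

  ≤abs : ∀ x → x ≤ abs x
  ≤abs (+ n) = ≤-refl
  ≤abs (-[1+ n ]) = -≤+

  -≤abs : ∀ x → - x ≤ abs x
  -≤abs x = subst (λ m → - x ≤ + m) (∣-i∣≡∣i∣ x) (≤abs (- x))

  sq-≤ : ∀ {x y} → 0ℤ ≤ y → x * x ≤ y * y → x ≤ y
  sq-≤ {x} {y} p h with x ≤? y
  ... | yes q = q
  ... | no q = ⊥-elim (<⇒≱ y<x (cancel (x + y) 0<x+y (alg h)))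
    where
    y<x = ≰⇒> q
    0<x+y : 0ℤ < x + y
    0<x+y = <-≤-trans (≤-<-trans p y<x) (cert p refl)
    alg : x * x ≤ y * y → (x + y) * x ≤ (x + y) * y
    alg h = cert (le⇒0≤ h) (solve (x ∷ y ∷ []))

  Bit : ℤ → Set
  Bit x = x ≡ 0ℤ ⊎ x ≡ 1ℤ

  bit≥0 : ∀ {x} → Bit x → 0ℤ ≤ x
  bit≥0 (inj₁ refl) = 0≤+
  bit≥0 (inj₂ refl) = 0≤+

  bit≤1 : ∀ {x} → Bit x → x ≤ 1ℤ
  bit≤1 (inj₁ refl) = 0≤+
  bit≤1 (inj₂ refl) = ≤-refl

  bit-co : ∀ {x} → Bit x → Bit (1ℤ - x)
  bit-co (inj₁ refl) = inj₂ refl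
  bit-co (inj₂ refl) = inj₁ refl

  bit-*≤ : ∀ {b x y} → Bit b → 0ℤ ≤ y → x ≤ y → b * x ≤ y
  bit-*≤ {b} {x} {y} (inj₁ refl) p q = subst (_≤ y) (sym (*-zeroˡ x)) p
  bit-*≤ {b} {x} {y} (inj₂ refl) p q = subst (_≤ y) (sym (*-identityˡ x)) q

  -- Finite sums

  module _ {A : Set} where

    ∑ : List A → (A → ℤ) → ℤ
    ∑ [] f = 0ℤ
    ∑ (x ∷ xs) f = f x + ∑ xs f

    ∑-cong : ∀ xs {f g : A → ℤ} → (∀ x → f x ≡ g x) → ∑ xs f ≡ ∑ xs g
    ∑-cong [] h = refl
    ∑-cong (x ∷ xs) h = cong₂ _+_ (h x) (∑-cong xs h)

    ∑-mono∈ : ∀ xs {f g : A → ℤ} → (∀ x → x ∈ xs → f x ≤ g x) → ∑ xs f ≤ ∑ xs g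
    ∑-mono∈ [] h = ≤-refl
    ∑-mono∈ (x ∷ xs) h = +-mono-≤ (h x (here refl)) (∑-mono∈ xs (λ y y∈ → h y (there y∈)))

    ∑-mono : ∀ xs {f g : A → ℤ} → (∀ x → f x ≤ g x) → ∑ xs f ≤ ∑ xs g
    ∑-mono xs h = ∑-mono∈ xs (λ x _ → h x)

    ∑-zero : ∀ xs → ∑ xs (λ _ → 0ℤ) ≡ 0ℤ
    ∑-zero [] = refl
    ∑-zero (x ∷ xs) = trans (+-identityˡ _) (∑-zero xs)

    ∑-≥0 : ∀ xs {f : A → ℤ} → (∀ x → 0ℤ ≤ f x) → 0ℤ ≤ ∑ xs f
    ∑-≥0 xs {f} h = subst (_≤ ∑ xs f) (∑-zero xs) (∑-mono xs h)

    ∑-≤0 : ∀ xs {f : A → ℤ} → (∀ x → f x ≤ 0ℤ) → ∑ xs f ≤ 0ℤ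
    ∑-≤0 xs {f} h = subst (∑ xs f ≤_) (∑-zero xs) (∑-mono xs h)

    ∑-lin1 : ∀ xs a (f : A → ℤ) {h} → (∀ x → h x ≡ a * f x) → ∑ xs h ≡ a * ∑ xs f
    ∑-lin1 [] a f e = sym (*-zeroʳ a)
    ∑-lin1 (x ∷ xs) a f e = trans (cong₂ _+_ (e x) (∑-lin1 xs a f e)) (sym (*-distribˡ-+ a (f x) (∑ xs f)))

    ∑-lin2 : ∀ xs a (f : A → ℤ) b (g : A → ℤ) {h} → (∀ x → h x ≡ a * f x + b * g x) →
             ∑ xs h ≡ a * ∑ xs f + b * ∑ xs g
    ∑-lin2 [] a f b g e = alg a b
      where alg : ∀ a b → 0ℤ ≡ a * 0ℤ + b * 0ℤ
            alg = solve-∀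
    ∑-lin2 (x ∷ xs) a f b g e =
      trans (cong₂ _+_ (e x) (∑-lin2 xs a f b g e)) (alg a (f x) (∑ xs f) b (g x) (∑ xs g))
      where alg : ∀ a p q b r s → (a * p + b * r) + (a * q + b * s) ≡ a * (p + q) + b * (r + s)
            alg = solve-∀

    ∑-lin3 : ∀ xs a (f : A → ℤ) b (g : A → ℤ) c (k : A → ℤ) {h} →
             (∀ x → h x ≡ a * f x + b * g x + c * k x) →
             ∑ xs h ≡ a * ∑ xs f + b * ∑ xs g + c * ∑ xs k
    ∑-lin3 [] a f b g c k e = alg a b c
      where alg : ∀ a b c → 0ℤ ≡ a * 0ℤ + b * 0ℤ + c * 0ℤ
            alg = solve-∀
    ∑-lin3 (x ∷ xs) a f b g c k e =
      trans (cong₂ _+_ (e x) (∑-lin3 xs a f b g c k e)) (alg a (f x) (∑ xs f) b (g x) (∑ xs g) c (k x) (∑ xs k))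
      where alg : ∀ a p q b r s c u v → (a * p + b * r + c * u) + (a * q + b * s + c * v)
                    ≡ a * (p + q) + b * (r + s) + c * (u + v)
            alg = solve-∀

    ∑-le1 : ∀ xs a (f : A → ℤ) {h} → (∀ x → h x ≤ a * f x) → ∑ xs h ≤ a * ∑ xs f
    ∑-le1 xs a f e = subst (_ ≤_) (∑-lin1 xs a f (λ x → refl)) (∑-mono xs e)

    ∑-le2 : ∀ xs a (f : A → ℤ) b (g : A → ℤ) {h} → (∀ x → h x ≤ a * f x + b * g x) →
            ∑ xs h ≤ a * ∑ xs f + b * ∑ xs g
    ∑-le2 xs a f b g e = subst (_ ≤_) (∑-lin2 xs a f b g (λ x → refl)) (∑-mono xs e)

    ∑-≥term : ∀ xs {f : A → ℤ} → (∀ x → 0ℤ ≤ f x) → ∀ {x} → x ∈ xs → f x ≤ ∑ xs f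
    ∑-≥term (y ∷ xs) {f} h {x} (here refl) = cert (∑-≥0 xs h) refl
    ∑-≥term (y ∷ xs) {f} h {x} (there p) =
      ≤-trans (∑-≥term xs h p) (cert (h y) (+-comm (f y) (∑ xs f)))

    ∑-++ : ∀ xs ys (f : A → ℤ) → ∑ (xs ++ ys) f ≡ ∑ xs f + ∑ ys f
    ∑-++ [] ys f = sym (+-identityˡ _)
    ∑-++ (x ∷ xs) ys f = trans (cong (λ z → f x + z) (∑-++ xs ys f)) (sym (+-assoc (f x) _ _))

    ∑-const : ∀ xs c → ∑ xs (λ (_ : A) → c) ≡ c * ∑ xs (λ _ → 1ℤ)
    ∑-const xs c = ∑-lin1 xs c (λ _ → 1ℤ) (λ _ → sym (*-identityʳ c))

    ∑-length : ∀ xs → ∑ xs (λ (_ : A) → 1ℤ) ≡ + length xs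
    ∑-length [] = refl
    ∑-length (x ∷ xs) = cong (λ z → 1ℤ + z) (∑-length xs)

  ∑-+ : ∀ {A : Set} (xs : List A) (f g : A → ℤ) → ∑ xs (λ x → f x + g x) ≡ ∑ xs f + ∑ xs g
  ∑-+ [] f g = refl
  ∑-+ (x ∷ xs) f g = trans (cong (λ z → f x + g x + z) (∑-+ xs f g)) (alg (f x) (g x) (∑ xs f) (∑ xs g))
    where alg : ∀ a b c d → a + b + (c + d) ≡ a + c + (b + d)
          alg = solve-∀

  ∑-swap : ∀ {A B : Set} (xs : List A) (ys : List B) (f : A → B → ℤ) →
           ∑ xs (λ x → ∑ ys (f x)) ≡ ∑ ys (λ y → ∑ xs (λ x → f x y))
  ∑-swap [] ys f = sym (∑-zero ys)
  ∑-swap (x ∷ xs) ys f = trans (cong (λ z → ∑ ys (f x) + z) (∑-swap xs ys f))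
    (sym (∑-+ ys (f x) (λ y → ∑ xs (λ x → f x y))))

  ∑-swap13 : ∀ {A : Set} (xs : List A) (f : A → A → A → ℤ) →
    ∑ xs (λ x → ∑ xs λ y → ∑ xs λ z → f x y z) ≡ ∑ xs (λ x → ∑ xs λ y → ∑ xs λ z → f z y x)
  ∑-swap13 xs f =
    trans (∑-cong xs (λ x → ∑-swap xs xs (f x)))
    (trans (∑-swap xs xs _)
     (∑-cong xs (λ z → ∑-swap xs xs (λ x y → f x y z))))

  -- Arithmetic of the degree and codegree estimates

  factorial-cofactor : ∀ N {x} → 1ℤ ≤ x → x ≤ + N → Σ ℤ λ r → 0ℤ ≤ r × r * x ≡ + (N !)
  factorial-cofactor N {+ suc m} p (+≤+ q) with ∣-trans (m∣m*n (m !)) (m≤n⇒m!∣n! q)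
  ... | divides d e = + d , 0≤+ , trans (sym (pos-* d (suc m))) (cong (λ z → + z) (sym e))
  factorial-cofactor N {+ zero} (+≤+ ()) q

  -- A larger `c` has a smaller reciprocal, so this is the rearrangement inequality:
  -- `(c′ - c) * (r - r′)` is nonnegative. It is `x + 1/x ≥ 2` for `x = c′ / c`, multiplied by `M`.
  reciprocal-amgm-ordered : ∀ {M} c c′ r r′ → 1ℤ ≤ c → 0ℤ ≤ r′ → r * c ≡ M → r′ * c′ ≡ M →
    c ≤ c′ → M + M ≤ c′ * r + c * r′
  reciprocal-amgm-ordered {M} c c′ r r′ pc pr′ e e′ h = subst (_≤ c′ * r + c * r′) (cong₂ _+_ e e′) key
    where
    r′≤r : r′ ≤ r
    r′≤r = cancel c (1≤⇒0< pc) (subst (c * r′ ≤_) (trans (trans e′ (sym e)) (*-comm r c))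
             (cert (le⇒0≤ h ⊗ pr′) (solve (c ∷ c′ ∷ r′ ∷ []))))
    key : r * c + r′ * c′ ≤ c′ * r + c * r′
    key = cert (le⇒0≤ h ⊗ le⇒0≤ r′≤r) (solve (c ∷ c′ ∷ r ∷ r′ ∷ []))

  reciprocal-amgm : ∀ {M} c c′ r r′ → 1ℤ ≤ c → 1ℤ ≤ c′ → 0ℤ ≤ r → 0ℤ ≤ r′ →
    r * c ≡ M → r′ * c′ ≡ M → M + M ≤ c′ * r + c * r′
  reciprocal-amgm {M} c c′ r r′ pc pc′ pr pr′ e e′ with ≤-total c c′
  ... | inj₁ h = reciprocal-amgm-ordered c c′ r r′ pc pr′ e e′ h
  ... | inj₂ h = subst (M + M ≤_) (+-comm (c * r′) (c′ * r))
                   (reciprocal-amgm-ordered c′ c r′ r pc′ pr e′ e h)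

  -- The square of `P * abs x - m` is nonnegative. Summed, this turns bounds on squared errors into
  -- bounds on absolute errors, in place of Cauchy-Schwarz and without square roots.
  abs-amgm : ∀ P m x → + 2 * P * m * abs x ≤ P * P * (x * x) + m * m
  abs-amgm P m x = subst (λ z → + 2 * P * m * abs x ≤ P * P * z + m * m) (abs-sq x) (alg (abs x))
    where
    alg : ∀ y → + 2 * P * m * y ≤ P * P * (y * y) + m * m
    alg y = cert (sq (P * y - m)) (solve (P ∷ m ∷ y ∷ []))

  -- Expanding the squares, `Sq` equals `(k - 2) n` times the shadow deficit `(k - 1) n² - k g`,
  -- plus the edge deficit `(k - 1) n³ - k² t`, minus `k² (DC - t)`. The last term has a favourable
  -- sign, and the hypotheses bound both deficits.
  degree-variance-arith : ∀ k n N g t DC {Cs Q2 Sq} → Cs ≡ n * n - g → Q2 ≡ n * Cs - DC →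
    Sq ≡ k * k * Q2 + (- (+ 2 * k * n)) * Cs + n * n * n →
    0ℤ ≤ n → 0ℤ ≤ N → + 2 ≤ k → 0ℤ ≤ k → t ≤ DC →
    N * ((k - 1ℤ) * (n * n) - k * g) ≤ n * n →
    N * ((k - 1ℤ) * (n * n * n) - k * k * t) ≤ n * n * n →
    N * Sq ≤ (k - 1ℤ) * (n * n * n)
  degree-variance-arith k n N g t DC refl refl refl pn pN k2 pk htd h1 h2 =
    cert (pN ⊗ pk ⊗ pk ⊗ le⇒0≤ htd ⊕ le⇒0≤ k2 ⊗ pn ⊗ le⇒0≤ h1 ⊕ le⇒0≤ h2)
         (solve (k ∷ n ∷ N ∷ g ∷ t ∷ DC ∷ []))

  degree-deviation-arith : ∀ k n L E Sq → 1ℤ ≤ n → 1ℤ ≤ k → + 2 * L * n * E ≤ L * L * Sq + n * n * n →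
    L * L * k * Sq ≤ (k - 1ℤ) * (n * n * n) → L * E ≤ n * n
  degree-deviation-arith k n L E Sq pn pk h1 h2 = cancel (+ 2 * k * n) (1≤⇒0< (1≤* {+ 2 * k} {n} (1≤* {+ 2} {k} (+≤+ (s≤s z≤n)) pk) pn))
    (cert (1≤⇒0≤ pk ⊗ le⇒0≤ h1 ⊕ le⇒0≤ h2 ⊕ 1≤⇒0≤ pn ⊗ 1≤⇒0≤ pn ⊗ 1≤⇒0≤ pn) (solve (k ∷ n ∷ L ∷ E ∷ Sq ∷ [])))

  -- The sum of squared codegrees `A2` has opposite signs in `k² B` and `U` and cancels, leaving
  -- `k² TC - 2 k n t + n² g`. This is small because `k TC` is at most `n t + n² E`, `k g` is at
  -- most `(k - 1) n² + E`, and `k² t` is not much less than `(k - 1) n³`. So `B` and `U`, both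
  -- nonnegative in the application, are small together.
  codegree-variance-arith : ∀ k n L TC A2 t g E {Cs U B} → Cs ≡ n * n - g →
    U ≡ k * k * A2 + (- (+ 2 * k * n)) * t + n * n * g → B ≡ TC - A2 →
    k * TC - n * t ≤ n * n * E → - E ≤ k * Cs - n * n → L * E ≤ n * n →
    0ℤ ≤ n → 1ℤ ≤ L → + 2 ≤ k → 1ℤ ≤ k →
    L * L * k * ((k - 1ℤ) * (n * n * n) - k * k * t) ≤ n * n * n →
    L * (k * k * B + U) ≤ (k + 1ℤ) * (n * n * n * n)
  codegree-variance-arith k n L TC A2 t g E refl refl refl hTC hC hE pn pL k2 pk h2 =
    cancel k (1≤⇒0< pk) (cert
      (pk0 ⊗ pL0 ⊗ pk0 ⊗ le⇒0≤ hTC ⊕ pk0 ⊗ pk0 ⊗ (pn ⊗ pn) ⊗ le⇒0≤ hE ⊕ pn ⊗ le⇒0≤ h2′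
        ⊕ pn ⊗ pn ⊗ pL0 ⊗ le⇒0≤ hC ⊕ pn ⊗ pn ⊗ le⇒0≤ hE ⊕ le⇒0≤ k2 ⊗ (pn ⊗ pn ⊗ pn ⊗ pn))
      (solve (k ∷ n ∷ L ∷ TC ∷ A2 ∷ t ∷ g ∷ E ∷ [])))
    where
    pk0 = 1≤⇒0≤ pk
    pL0 = 1≤⇒0≤ pL
    1≤Lk : 1ℤ ≤ L * k
    1≤Lk = 1≤* pL pk
    h2′ : L * ((k - 1ℤ) * (n * n * n) - k * k * t) ≤ n * n * n
    h2′ = cancel (L * k) (1≤⇒0< 1≤Lk)
      (cert (le⇒0≤ h2 ⊕ le⇒0≤ 1≤Lk ⊗ (pn ⊗ pn ⊗ pn)) (solve (k ∷ n ∷ L ∷ t ∷ [])))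

  extension-arith : ∀ k n P B U → 1ℤ ≤ k → 1ℤ ≤ P → 0ℤ ≤ B → 0ℤ ≤ U →
    P * P * (k + 1ℤ) * (k * k * B + U) ≤ (k + 1ℤ) * (n * n * n * n) → P * B ≤ n * n * n * n
  extension-arith k n P B U pk pP pB pU h = ≤-trans PB≤ ≤n⁴
    where
    1≤Pkk : 1ℤ ≤ P * k * k
    1≤Pkk = 1≤* {P * k} {k} (1≤* pP pk) pk
    PB≤ : P * B ≤ P * P * k * k * B
    PB≤ = cert (le⇒0≤ 1≤Pkk ⊗ (1≤⇒0≤ pP ⊗ pB)) (solve (k ∷ P ∷ B ∷ []))
    ≤n⁴ : P * P * k * k * B ≤ n * n * n * n
    ≤n⁴ = cancel (k + 1ℤ) (1≤⇒0< (≤-trans pk (cert {e = 1ℤ} 0≤+ refl)))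
      (cert (le⇒0≤ h ⊕ 1≤⇒0≤ pP ⊗ 1≤⇒0≤ pP ⊗ (1≤⇒0≤ pk ⊕ 0≤+ {1}) ⊗ pU) (solve (k ∷ n ∷ P ∷ B ∷ U ∷ [])))

  -- `U` is a sum of squares and `D` one of absolute values, so AM-GM costs a square; hence the
  -- factor `P * P` in `L`.
  codegree-deviation-arith : ∀ k n P B U D → 1ℤ ≤ n → 1ℤ ≤ k → 1ℤ ≤ P → 0ℤ ≤ B →
    P * P * (k + 1ℤ) * (k * k * B + U) ≤ (k + 1ℤ) * (n * n * n * n) →
    + 2 * P * n * D ≤ P * P * U + n * n * (n * n) → P * D ≤ n * n * n
  codegree-deviation-arith k n P B U D pn pk pP pB h hD =
    cancel (+ 2 * n) (1≤⇒0< (1≤* {+ 2} {n} (+≤+ (s≤s z≤n)) pn))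
      (cert (le⇒0≤ hD ⊕ le⇒0≤ PPU) (solve (n ∷ P ∷ U ∷ D ∷ [])))
    where
    pP0 = 1≤⇒0≤ pP
    pk0 = 1≤⇒0≤ pk
    PPU : P * P * U ≤ n * n * n * n
    PPU = cancel (k + 1ℤ) (1≤⇒0< (≤-trans pk (cert {e = 1ℤ} 0≤+ refl)))
      (cert (le⇒0≤ h ⊕ pP0 ⊗ pP0 ⊗ (pk0 ⊕ 0≤+ {1}) ⊗ (pk0 ⊗ pk0 ⊗ pB)) (solve (k ∷ n ∷ P ∷ B ∷ U ∷ [])))

  -- A cancellative 3-graph on the vertex set A: τ is the indicator of ordered edges and
  -- γ that of the shadow. Cancellativity enters only through indep: the common
  -- neighbours of a pair are pairwise nonadjacent in the shadow.
  record Config (A : Set) : Set where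
    field
      V        : List A
      complete : ∀ u → u ∈ V
      τ        : A → A → A → ℤ
      γ        : A → A → ℤ
      τ-bit    : ∀ u v w → Bit (τ u v w)
      γ-bit    : ∀ u v → Bit (γ u v)
      τ-swap₁₂ : ∀ u v w → τ u v w ≡ τ v u w
      τ-swap₂₃ : ∀ u v w → τ u v w ≡ τ u w v
      γ-sym    : ∀ u v → γ u v ≡ γ v u
      γ-irrefl : ∀ u → γ u u ≡ 0ℤ
      τ≤γ      : ∀ u v w → τ u v w ≤ γ v w
      indep    : ∀ {u u′ v w} → τ u v w ≡ 1ℤ → τ u′ v w ≡ 1ℤ → γ u u′ ≡ 0ℤ

  -- Degrees, codegrees and the weighted edge inequality

  module Counting {A : Set} (conf : Config A) where
    open Config conf

    S : (A → ℤ) → ℤ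
    S = ∑ V

    γ̄ : A → A → ℤ
    γ̄ u v = 1ℤ - γ u v

    -- c u counts the non-neighbours of u including u itself, and a v w is the codegree.
    n g t : ℤ
    deg c : A → ℤ
    a : A → A → ℤ
    n = S λ _ → 1ℤ
    deg u = S λ v → γ u v
    c u = S λ v → γ̄ u v
    a v w = S λ u → τ u v w
    g = S deg
    t = S λ v → S λ w → a v w

    γ̄-bit : ∀ u v → Bit (γ̄ u v)
    γ̄-bit u v = bit-co (γ-bit u v)

    τ≥0 : ∀ u v w → 0ℤ ≤ τ u v w
    τ≥0 u v w = bit≥0 (τ-bit u v w)

    γ≥0 : ∀ u v → 0ℤ ≤ γ u v
    γ≥0 u v = bit≥0 (γ-bit u v)

    γ̄≥0 : ∀ u v → 0ℤ ≤ γ̄ u v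
    γ̄≥0 u v = bit≥0 (γ̄-bit u v)

    n≥0 : 0ℤ ≤ n
    n≥0 = ∑-≥0 V (λ _ → 0≤+)

    S-const : ∀ x → S (λ _ → x) ≡ x * n
    S-const x = ∑-const V x

    deg+c : ∀ u → deg u + c u ≡ n
    deg+c u = trans (sym (∑-+ V (γ u) (γ̄ u))) (∑-cong V (λ v → alg (γ u v)))
      where alg : ∀ x → x + (1ℤ - x) ≡ 1ℤ
            alg = solve-∀

    c≤n : ∀ u → c u ≤ n
    c≤n u = ∑-mono V (λ v → bit≤1 (γ̄-bit u v))

    1≤c : ∀ u → 1ℤ ≤ c u
    1≤c u = subst (_≤ c u) (cong (λ z → 1ℤ - z) (γ-irrefl u)) (∑-≥term V (γ̄≥0 u) (complete u))

    γ≡0⇒τ≡0 : ∀ u {v w} → γ v w ≡ 0ℤ → τ u v w ≡ 0ℤ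
    γ≡0⇒τ≡0 u {v} {w} e = ≤-antisym (subst (τ u v w ≤_) e (τ≤γ u v w)) (τ≥0 u v w)

    ττ≤γ̄ : ∀ u u′ v w → τ u v w ≡ 1ℤ → τ u′ v w ≤ γ̄ u u′
    ττ≤γ̄ u u′ v w e with τ-bit u′ v w
    ... | inj₁ e′ = subst (_≤ γ̄ u u′) (sym e′) (γ̄≥0 u u′)
    ... | inj₂ e′ = ≤-reflexive (trans e′ (cong (λ z → 1ℤ - z) (sym (indep e e′))))

    a≤c : ∀ u v w → τ u v w ≡ 1ℤ → a v w ≤ c u
    a≤c u v w e = ∑-mono V (λ u′ → ττ≤γ̄ u u′ v w e)

    γa : ∀ v w → γ v w * a v w ≡ a v w
    γa v w with γ-bit v w
    ... | inj₂ e = trans (cong (_* a v w) e) (*-identityˡ (a v w))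
    ... | inj₁ e = trans (trans (cong (_* a v w) e) (*-zeroˡ (a v w)))
                     (sym (trans (∑-cong V (λ u → γ≡0⇒τ≡0 u e)) (∑-zero V)))

    -- Weighting each edge {u,v,w} by 1 / c u turns the independence of
    -- codegree neighbourhoods into the bound Σ_u τ u v w / c u ≤ 1; it is
    -- scaled by n! so that the reciprocals r u = n! / c u are integers.
    private
      M : ℤ
      M = + (length V !)

      cofactor : ∀ u → Σ ℤ λ r → 0ℤ ≤ r × r * c u ≡ M
      cofactor u = factorial-cofactor (length V) (1≤c u) (subst (c u ≤_) (∑-length V) (c≤n u))

      r : A → ℤ
      r u = proj₁ (cofactor u)

      r≥0 : ∀ u → 0ℤ ≤ r u
      r≥0 u = proj₁ (proj₂ (cofactor u))

      rc : ∀ u → r u * c u ≡ M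
      rc u = proj₂ (proj₂ (cofactor u))

      0<M : 0ℤ < M
      0<M = +<+ (ℕ.1≤n! (length V))

      Στr≤0 : ∀ v w → (∀ u → τ u v w ≤ 0ℤ) → S (λ u → τ u v w * r u) ≤ 0ℤ
      Στr≤0 v w h = ∑-≤0 V λ u → ≤-reflexive
        (cong (_* r u) (≤-antisym (h u) (τ≥0 u v w)))

      -- After multiplication by the codegree each term `a v w * r u` is at most `c u * r u = M`, so
      -- the sum is at most `a v w * M`; a positive codegree is then cancelled.
      Στr≤M : ∀ v w → S (λ u → τ u v w * r u) ≤ M
      Στr≤M v w with 0ℤ <? a v w
      ... | no a≯0 = ≤-trans (Στr≤0 v w λ u → ≤-trans (∑-≥term V (λ u → τ≥0 u v w) (complete u)) (≮⇒≥ a≯0)) (<⇒≤ 0<M)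
      ... | yes a>0 = cancel (a v w) a>0 (subst₂ _≤_ (∑-lin1 V (a v w) (λ u → τ u v w * r u) (λ u → refl))
              (trans (∑-lin1 V M (λ u → τ u v w) (λ u → *-comm (τ u v w) M)) (*-comm M (a v w)))
              (∑-mono V step))
        where
        step : ∀ u → a v w * (τ u v w * r u) ≤ τ u v w * M
        step u with τ u v w in e
        ... | x with subst Bit e (τ-bit u v w)
        ... | inj₁ refl = ≤-reflexive (*-zeroʳ (a v w))
        ... | inj₂ refl = subst₂ _≤_ (cong (a v w *_) (sym (*-identityˡ (r u)))) (sym (*-identityˡ M))
                (subst (a v w * r u ≤_) (rc u) (alg (a v w) (c u) (r u) (r≥0 u) (a≤c u v w e)))
          where alg : ∀ x y z → 0ℤ ≤ z → x ≤ y → x * z ≤ z * y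
                alg x y z pz h = cert (pz ⊗ le⇒0≤ h) (solve (x ∷ y ∷ z ∷ []))

      Στr≤γM : ∀ v w → S (λ u → τ u v w * r u) ≤ γ v w * M
      Στr≤γM v w with γ-bit v w
      ... | inj₁ e = subst (S (λ u → τ u v w * r u) ≤_) (sym (cong (_* M) e))
                       (Στr≤0 v w (λ u → ≤-reflexive (γ≡0⇒τ≡0 u e)))
      ... | inj₂ e = subst (S (λ u → τ u v w * r u) ≤_) (sym (trans (cong (_* M) e) (*-identityˡ M))) (Στr≤M v w)

      Ψ : ℤ
      Ψ = S λ v → S λ w → S λ u → c v * (τ u v w * r u)

      Ψ≤ : Ψ ≤ M * S (λ u → deg u * c u)
      Ψ≤ = ∑-le1 V M (λ u → deg u * c u) λ v →
        subst₂ _≤_ (sym (∑-cong V (λ w → ∑-lin1 V (c v) (λ u → τ u v w * r u) (λ u → refl))))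
          (trans (∑-lin1 V (c v * M) (γ v) (λ w → alg (c v) (γ v w) M)) (alg′ (c v) M (deg v)))
          (∑-mono V (λ w → alg″ (c v) _ _ (1≤⇒0≤ (1≤c v)) (Στr≤γM v w)))
        where
        alg : ∀ x y z → x * (y * z) ≡ x * z * y
        alg = solve-∀
        alg′ : ∀ x y z → x * y * z ≡ y * (z * x)
        alg′ = solve-∀
        alg″ : ∀ x y z → 0ℤ ≤ x → y ≤ z → x * y ≤ x * z
        alg″ x y z px h = cert (px ⊗ le⇒0≤ h) (solve (x ∷ y ∷ z ∷ []))

      -- Exchanging `u` and `v` in one copy of `Ψ` puts the ratios `c v / c u` and `c u / c v` on
      -- the same ordered edge, where they add up to at least 2. Over ordered pairs the weight `c v`
      -- alone does the work of the symmetric weight.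
      ≤2Ψ : (M + M) * t ≤ Ψ + Ψ
      ≤2Ψ = subst₂ _≤_ lhs rhs (∑-mono V λ v → ∑-mono V λ w → ∑-mono V λ u → step u v w)
        where
        step : ∀ u v w → (M + M) * τ u v w ≤ c v * (τ u v w * r u) + c u * (τ v u w * r v)
        step u v w = subst (λ z → (M + M) * τ u v w ≤ c v * (τ u v w * r u) + c u * (z * r v)) (τ-swap₁₂ u v w)
          (alg (M + M) (τ u v w) (c v) (r u) (c u) (r v) (τ≥0 u v w)
            (reciprocal-amgm (c u) (c v) (r u) (r v) (1≤c u) (1≤c v) (r≥0 u) (r≥0 v) (rc u) (rc v)))
          where
          alg : ∀ m x cv ru cu rv → 0ℤ ≤ x → m ≤ cv * ru + cu * rv → m * x ≤ cv * (x * ru) + cu * (x * rv)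
          alg m x cv ru cu rv px h = cert (px ⊗ le⇒0≤ h) (solve (m ∷ x ∷ cv ∷ ru ∷ cu ∷ rv ∷ []))
        lhs : S (λ v → S λ w → S λ u → (M + M) * τ u v w) ≡ (M + M) * t
        lhs = ∑-lin1 V (M + M) (λ v → S λ w → a v w) λ v →
          ∑-lin1 V (M + M) (λ w → a v w) λ w → ∑-lin1 V (M + M) (λ u → τ u v w) λ u → refl
        F : A → A → A → ℤ
        F v w u = c v * (τ u v w * r u)
        rhs : S (λ v → S λ w → S λ u → F v w u + F u w v) ≡ Ψ + Ψ
        rhs = trans (∑-cong V λ v → trans (∑-cong V λ w → ∑-+ V (F v w) (λ u → F u w v))
                      (∑-+ V (λ w → S (F v w)) (λ w → S λ u → F u w v)))
              (trans (∑-+ V (λ v → S λ w → S (F v w)) (λ v → S λ w → S λ u → F u w v))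
                (cong (λ z → Ψ + z) (sym (∑-swap13 V F))))

    t≤Σdeg*c : t ≤ S (λ u → deg u * c u)
    t≤Σdeg*c = cancel (M + M) (+-mono-< 0<M 0<M)
      (≤-trans ≤2Ψ (subst (Ψ + Ψ ≤_) (sym (*-distribʳ-+ (S (λ u → deg u * c u)) M M)) (+-mono-≤ Ψ≤ Ψ≤)))

    -- When `uvw` is an edge, `N(vw)` is contained in the non-neighbours of `u`, so exactly
    -- `c u - a v w` of these lie outside `N(vw)`.
    B-inner : ∀ v w u → S (λ u′ → τ u v w * (γ̄ u u′ * (1ℤ - τ u′ v w))) ≡ τ u v w * (c u - a v w)
    B-inner v w u with τ-bit u v w
    ... | inj₁ e = trans (trans (∑-cong V (λ u′ → trans (cong (_* (γ̄ u u′ * (1ℤ - τ u′ v w))) e) (*-zeroˡ (γ̄ u u′ * (1ℤ - τ u′ v w)))))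
                     (∑-zero V)) (sym (trans (cong (_* (c u - a v w)) e) (*-zeroˡ (c u - a v w))))
    ... | inj₂ e = trans (∑-lin2 V 1ℤ (γ̄ u) -1ℤ (λ u′ → τ u′ v w) λ u′ → alg′ u′)
                     (trans (alg (c u) (a v w)) (cong (_* (c u - a v w)) (sym e)))
      where
      alg : ∀ x y → 1ℤ * x + -1ℤ * y ≡ 1ℤ * (x - y)
      alg = solve-∀
      alg′ : ∀ u′ → τ u v w * (γ̄ u u′ * (1ℤ - τ u′ v w)) ≡ 1ℤ * γ̄ u u′ + -1ℤ * τ u′ v w
      alg′ u′ with τ u′ v w | τ-bit u′ v w | ττ≤γ̄ u u′ v w e
      ... | _ | inj₁ refl | _ = trans (cong (_* (γ̄ u u′ * 1ℤ)) e) (alg₀ (γ̄ u u′))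
        where alg₀ : ∀ x → 1ℤ * (x * 1ℤ) ≡ 1ℤ * x + -1ℤ * 0ℤ
              alg₀ = solve-∀
      ... | _ | inj₂ refl | h = trans (cong₂ (λ p q → p * (q * 0ℤ)) e q≡1)
             (sym (cong (λ q → 1ℤ * q + -1ℤ * 1ℤ) q≡1))
        where q≡1 = ≤-antisym (bit≤1 (γ̄-bit u u′)) h

  -- In a blow-up of a Steiner triple system on k points k * c u and k * a v w equal n; E and D
  -- measure the deviation from this. B counts the vertices that are nonadjacent to a
  -- vertex u of an edge {u,v,w} and yet do not complete v and w to an edge.
  module Errors {A : Set} (conf : Config A) (k : ℤ) where
    open Config conf
    open Counting conf

    E D B : ℤ
    aErr : A → A → ℤ
    E = S λ u → abs (k * c u - n)
    aErr v w = abs (k * a v w - n)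
    D = S λ v → S λ w → γ v w * aErr v w
    B = S λ v → S λ w → S λ u → S λ u′ → τ u v w * (γ̄ u u′ * (1ℤ - τ u′ v w))

    E≥0 : 0ℤ ≤ E
    E≥0 = ∑-≥0 V λ u → 0≤+

    D≥0 : 0ℤ ≤ D
    D≥0 = ∑-≥0 V λ v → ∑-≥0 V λ w → γ≥0 v w ⊗ 0≤+

    B≥0 : 0ℤ ≤ B
    B≥0 = ∑-≥0 V λ v → ∑-≥0 V λ w → ∑-≥0 V λ u → ∑-≥0 V λ u′ →
            τ≥0 u v w ⊗ (γ̄≥0 u u′ ⊗ bit≥0 (bit-co (τ-bit u′ v w)))

  -- Near-extremal densities force small error sums

  module Analysis {A : Set} (conf : Config A) (k P L : ℤ) (L≡ : L ≡ P * P * (k + 1ℤ)) (k≥3 : + 3 ≤ k) (P≥1 : 1ℤ ≤ P) where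
    open Config conf
    open Counting conf
    open Errors conf k

    module _ (n≥1 : 1ℤ ≤ n)
             (edge-hyp   : L * L * k * ((k - 1ℤ) * (n * n * n) - k * k * t) ≤ n * n * n)
             (shadow-hyp : L * L * k * ((k - 1ℤ) * (n * n) - k * g) ≤ n * n) where
      private
        k≥2 : + 2 ≤ k
        k≥2 = ≤-trans (+≤+ (s≤s (s≤s z≤n))) k≥3
        k≥1 : 1ℤ ≤ k
        k≥1 = ≤-trans (+≤+ (s≤s z≤n)) k≥3
        k≥0 : 0ℤ ≤ k
        k≥0 = 1≤⇒0≤ k≥1
        L≥1 : 1ℤ ≤ L
        L≥1 = subst (1ℤ ≤_) (sym L≡) (1≤* {P * P} {k + 1ℤ} (1≤* P≥1 P≥1) (≤-trans k≥1 (cert {e = 1ℤ} 0≤+ refl)))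
        L≥0 : 0ℤ ≤ L
        L≥0 = 1≤⇒0≤ L≥1

        Cs Q2 DC Sq A2 TC U : ℤ
        Cs = S c
        Q2 = S λ u → c u * c u
        DC = S λ u → deg u * c u
        Sq = S λ u → (k * c u - n) * (k * c u - n)
        A2 = S λ v → S λ w → a v w * a v w
        TC = S λ v → S λ w → S λ u → τ u v w * c u
        U  = S λ v → S λ w → γ v w * ((k * a v w - n) * (k * a v w - n))

        swap-sides : ∀ {x y z} → x + y ≡ z → y ≡ z - x
        swap-sides {x} {y} refl = alg x y
          where alg : ∀ x y → y ≡ x + y - x
                alg = solve-∀

        Cs≡ : Cs ≡ n * n - g
        Cs≡ = swap-sides {g} {Cs} (trans (sym (∑-+ V deg c)) (trans (∑-cong V deg+c) (S-const n)))

        Q2≡ : Q2 ≡ n * Cs - DC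
        Q2≡ = swap-sides {DC} {Q2} (trans (sym (∑-+ V (λ u → deg u * c u) (λ u → c u * c u)))
          (∑-lin1 V n c λ u → trans (sym (*-distribʳ-+ (c u) (deg u) (c u))) (cong (_* c u) (deg+c u))))

        Sq≡ : Sq ≡ k * k * Q2 + (- (+ 2 * k * n)) * Cs + n * n * n
        Sq≡ = ∑-lin3 V (k * k) (λ u → c u * c u) (- (+ 2 * k * n)) c (n * n) (λ _ → 1ℤ) (λ u → alg k (c u) n)
          where alg : ∀ k x n → (k * x - n) * (k * x - n) ≡ k * k * (x * x) + (- (+ 2 * k * n)) * x + n * n * 1ℤ
                alg = solve-∀

        NSq≤ : L * L * k * Sq ≤ (k - 1ℤ) * (n * n * n)
        NSq≤ = degree-variance-arith k n (L * L * k) g t DC Cs≡ Q2≡ Sq≡ n≥0 (L≥0 ⊗ L≥0 ⊗ k≥0) k≥2 k≥0 t≤Σdeg*c shadow-hyp edge-hyp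

        LE≤ : L * E ≤ n * n
        LE≤ = degree-deviation-arith k n L E Sq n≥1 k≥1 (subst₂ _≤_ (∑-lin1 V (+ 2 * L * n) _ (λ u → refl)) refl
                (∑-le2 V (L * L) (λ u → (k * c u - n) * (k * c u - n)) (n * n) (λ _ → 1ℤ)
                   (λ u → subst (+ 2 * L * n * abs (k * c u - n) ≤_)
                             (cong (λ z → L * L * ((k * c u - n) * (k * c u - n)) + z) (sym (*-identityʳ (n * n))))
                             (abs-amgm L n (k * c u - n))))) NSq≤

        U≡ : U ≡ k * k * A2 + (- (+ 2 * k * n)) * t + n * n * g
        U≡ = ∑-lin3 V (k * k) _ (- (+ 2 * k * n)) _ (n * n) _ λ v →
             ∑-lin3 V (k * k) (λ w → a v w * a v w) (- (+ 2 * k * n)) (a v) (n * n) (γ v) λ w →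
               trans (alg₁ k (γ v w) (a v w) n) (trans (cong (λ z → k * k * (z * a v w) + (- (+ 2 * k * n)) * z + n * n * γ v w) (γa v w)) refl)
          where
          alg₁ : ∀ k y x n → y * ((k * x - n) * (k * x - n)) ≡ k * k * (y * x * x) + (- (+ 2 * k * n)) * (y * x) + n * n * y
          alg₁ = solve-∀

        B≡ : B ≡ TC - A2
        B≡ = trans (∑-lin2 V 1ℤ (λ v → S λ w → S λ u → τ u v w * c u) -1ℤ (λ v → S λ w → a v w * a v w) λ v →
               ∑-lin2 V 1ℤ (λ w → S λ u → τ u v w * c u) -1ℤ (λ w → a v w * a v w) λ w →
               trans (∑-cong V (B-inner v w)) (trans
                 (∑-lin2 V 1ℤ (λ u → τ u v w * c u) (- a v w) (λ u → τ u v w) λ u → alg₁ (τ u v w) (c u) (a v w))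
                 (alg₂ (S λ u → τ u v w * c u) (a v w))))
               (alg₃ TC A2)
          where
          alg₁ : ∀ x y z → x * (y - z) ≡ 1ℤ * (x * y) + (- z) * x
          alg₁ = solve-∀
          alg₂ : ∀ x z → 1ℤ * x + (- z) * z ≡ 1ℤ * x + -1ℤ * (z * z)
          alg₂ = solve-∀
          alg₃ : ∀ x z → 1ℤ * x + -1ℤ * z ≡ x - z
          alg₃ = solve-∀

        U≥0 : 0ℤ ≤ U
        U≥0 = ∑-≥0 V λ v → ∑-≥0 V λ w → γ≥0 v w ⊗ sq (k * a v w - n)

        kTC≤ : k * TC - n * t ≤ n * n * E
        kTC≤ = subst₂ _≤_ lhs rhs (∑-mono V λ v → ∑-mono V λ w → ∑-mono V λ u →
                 bit-*≤ {x = k * c u - n} (τ-bit u v w) 0≤+ (≤abs (k * c u - n)))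
          where
          alg : ∀ k n x y → x * (k * y - n) ≡ k * (x * y) + (- n) * x
          alg = solve-∀
          alg₁ : ∀ k x n y → k * x + (- n) * y ≡ k * x - n * y
          alg₁ = solve-∀
          lhs : S (λ v → S λ w → S λ u → τ u v w * (k * c u - n)) ≡ k * TC - n * t
          lhs = trans (∑-lin2 V k (λ v → S λ w → S λ u → τ u v w * c u) (- n) (λ v → S λ w → a v w) λ v →
                ∑-lin2 V k (λ w → S λ u → τ u v w * c u) (- n) (a v) λ w →
                ∑-lin2 V k (λ u → τ u v w * c u) (- n) (λ u → τ u v w) λ u → alg k n (τ u v w) (c u))
                (alg₁ k TC n t)
          rhs : S (λ v → S λ w → S λ u → abs (k * c u - n)) ≡ n * n * E
          rhs = trans (trans (∑-cong V (λ _ → S-const E)) (S-const (E * n))) (alg₂ E n)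
            where alg₂ : ∀ x y → x * y * y ≡ y * y * x
                  alg₂ = solve-∀

        -E≤ : - E ≤ k * Cs - n * n
        -E≤ = subst₂ _≤_ (trans (∑-lin1 V -1ℤ (λ u → abs (k * c u - n)) λ u → refl) (-1*i≡-i E))
              (trans (∑-lin2 V k c (- n) (λ _ → 1ℤ) λ u → alg k (c u) n) (alg₁ k Cs n n))
              (∑-mono V λ u → alg₂ (abs (k * c u - n)) (k * c u - n) (-≤abs (k * c u - n)))
          where
          alg : ∀ k x n → k * x - n ≡ k * x + (- n) * 1ℤ
          alg = solve-∀
          alg₁ : ∀ k x n y → k * x + (- n) * y ≡ k * x - n * y
          alg₁ = solve-∀
          alg₂ : ∀ x y → - y ≤ x → -1ℤ * x ≤ y
          alg₂ x y h = cert (le⇒0≤ h) (solve (x ∷ y ∷ []))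

        main : L * (k * k * B + U) ≤ (k + 1ℤ) * (n * n * n * n)
        main = codegree-variance-arith k n L TC A2 t g E Cs≡ U≡ B≡ kTC≤ -E≤ LE≤ n≥0 L≥1 k≥2 k≥1 edge-hyp

        main′ : P * P * (k + 1ℤ) * (k * k * B + U) ≤ (k + 1ℤ) * (n * n * n * n)
        main′ = subst (λ z → z * (k * k * B + U) ≤ (k + 1ℤ) * (n * n * n * n)) L≡ main

      PE≤ : P * E ≤ n * n
      PE≤ = ≤-trans (alg P L E (E≥0) P≤L) LE≤
        where
        alg : ∀ p l e → 0ℤ ≤ e → p ≤ l → p * e ≤ l * e
        alg p l e pe h = cert (le⇒0≤ h ⊗ pe) (solve (p ∷ l ∷ e ∷ []))
        P≤L : P ≤ L
        P≤L = subst (P ≤_) (sym L≡) (alg′ P k P≥1 k≥0)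
          where
          alg′ : ∀ P k → 1ℤ ≤ P → 0ℤ ≤ k → P ≤ P * P * (k + 1ℤ)
          alg′ P k h pk = cert (1≤⇒0≤ h ⊗ le⇒0≤ h ⊕ 1≤⇒0≤ h ⊗ 1≤⇒0≤ h ⊗ pk) (solve (P ∷ k ∷ []))

      PB≤ : P * B ≤ n * n * n * n
      PB≤ = extension-arith k n P B U k≥1 P≥1 B≥0 U≥0 main′

      PD≤ : P * D ≤ n * n * n
      PD≤ = codegree-deviation-arith k n P B U D n≥1 k≥1 P≥1 B≥0 main′ (subst₂ _≤_ lhs refl
        (∑-le2 V (P * P) (λ v → S λ w → γ v w * y² v w) (n * n * n) (λ _ → 1ℤ) λ v →
          subst (S (λ w → + 2 * P * n * (γ v w * aErr v w)) ≤_) (alg₃ (P * P * S (λ w → γ v w * y² v w)) n)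
          (∑-le2 V (P * P) (λ w → γ v w * y² v w) (n * n) (λ _ → 1ℤ) λ w → step v w)) ≤′ refl-rhs)
        where
        infixl 5 _≤′_
        _≤′_ : ∀ {x y z} → x ≤ y → y ≡ z → x ≤ z
        p ≤′ refl = p
        y² : A → A → ℤ
        y² v w = (k * a v w - n) * (k * a v w - n)
        lhs : S (λ v → S λ w → + 2 * P * n * (γ v w * aErr v w)) ≡ + 2 * P * n * D
        lhs = ∑-lin1 V (+ 2 * P * n) (λ v → S λ w → γ v w * aErr v w) λ v →
              ∑-lin1 V (+ 2 * P * n) (λ w → γ v w * aErr v w) λ w → refl
        refl-rhs : P * P * U + n * n * n * n ≡ P * P * U + n * n * (n * n)
        refl-rhs = cong (λ z → P * P * U + z) (alg n)
          where alg : ∀ n → n * n * n * n ≡ n * n * (n * n)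
                alg = solve-∀
        alg₃ : ∀ x n → x + n * n * n ≡ x + n * n * n * 1ℤ
        alg₃ = solve-∀
        step : ∀ v w → + 2 * P * n * (γ v w * aErr v w) ≤ P * P * (γ v w * y² v w) + n * n * 1ℤ
        step v w = alg (γ v w) (+ 2 * P * n) (aErr v w) (P * P) (y² v w) (n * n) (bit≥0 (γ-bit v w)) (bit≤1 (γ-bit v w))
                     (n≥0 ⊗ n≥0) (abs-amgm P n (k * a v w - n))
          where
          alg : ∀ x p q r s m → 0ℤ ≤ x → x ≤ 1ℤ → 0ℤ ≤ m → p * q ≤ r * s + m → p * (x * q) ≤ r * (x * s) + m * 1ℤ
          alg x p q r s m px x1 pm h = cert (px ⊗ le⇒0≤ h ⊕ pm ⊗ le⇒0≤ x1) (solve (x ∷ p ∷ q ∷ r ∷ s ∷ m ∷ []))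

  -- A codegree neighbourhood that fits into the uncovered region

  search : ∀ {A : Set} {Q R : A → Set} → (∀ x → Q x ⊎ R x) → (xs : List A) →
    (∃ Q) ⊎ (∀ x → x ∈ xs → R x)
  search f [] = inj₂ λ x ()
  search {R = R} f (x ∷ xs) with f x | search f xs
  ... | inj₁ q | _ = inj₁ (x , q)
  ... | inj₂ _ | inj₁ q = inj₁ q
  ... | inj₂ r | inj₂ rs = inj₂ λ { y (here refl) → r ; y (there y∈) → rs y y∈ }

  -- The lower bound on `W` gives `k² β W ≥ n³`, where `k ≥ 3` leaves room for the errors `E` and
  -- `D`. The factors 4 in the bounds on `P` and `Z` make each of the two terms bounding `n W` at
  -- most `n⁴ / 4` after multiplication by `k² β`, so that `n⁴ ≤ n⁴ / 2`.
  sparse-absurd : ∀ k n β Y Z P r E D X W → + 3 ≤ k → 1ℤ ≤ n → 1ℤ ≤ β → 1ℤ ≤ Y →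
    + 4 * (k * k) * β * Y ≤ P → + 4 * (k * k * k) * β * Y ≤ Z → 0ℤ ≤ E → 0ℤ ≤ D → 0ℤ ≤ X →
    P * E ≤ n * n → P * D ≤ n * n * n → Z * X ≤ n * n → n ≤ β * r →
    n * ((k - 1ℤ) * n * r - E) - k * D ≤ k * k * W → n * W ≤ Y * (n * D) + Y * (k * (n * n * X)) → ⊥
  sparse-absurd k n β Y Z P r E D X W k≥3 n≥1 β≥1 Y≥1 hP hZ E≥0 D≥0 X≥0 hE hD hX hr hW nW = <⇒≱ (1≤⇒0< 1≤n⁴) n⁴≤0
    where
    k≥1 = ≤-trans (+≤+ (s≤s z≤n)) k≥3
    k≥0 = 1≤⇒0≤ k≥1
    n≥0 = 1≤⇒0≤ n≥1
    β≥0 = 1≤⇒0≤ β≥1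
    Y≥0 = 1≤⇒0≤ Y≥1
    1≤n⁴ : 1ℤ ≤ + 2 * (n * n * (n * n))
    1≤n⁴ = 1≤* {+ 2} {n * n * (n * n)} (+≤+ (s≤s z≤n)) (1≤* {n * n} {n * n} (1≤* n≥1 n≥1) (1≤* n≥1 n≥1))
    4kkβY≥1 : 1ℤ ≤ + 4 * (k * k) * β * Y
    4kkβY≥1 = 1≤* {+ 4 * (k * k) * β} {Y} (1≤* {+ 4 * (k * k)} {β} (1≤* {+ 4} {k * k} (+≤+ (s≤s z≤n)) (1≤* k≥1 k≥1)) β≥1) Y≥1
    P≥1 : 1ℤ ≤ P
    P≥1 = ≤-trans 4kkβY≥1 hP
    P≥β[k+1] : β * (k + 1ℤ) ≤ P
    P≥β[k+1] = ≤-trans step₁ (≤-trans step₂ hP)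
      where
      step₁ : β * (k + 1ℤ) ≤ + 4 * (k * k) * β
      step₁ = cert (β≥0 ⊗ (0≤+ {4} ⊗ k≥0 ⊗ le⇒0≤ k≥1 ⊕ 0≤+ {3} ⊗ le⇒0≤ k≥1 ⊕ 0≤+ {2})) (solve (β ∷ k ∷ []))
      step₂ : + 4 * (k * k) * β ≤ + 4 * (k * k) * β * Y
      step₂ = cert (0≤+ {4} ⊗ (k≥0 ⊗ k≥0) ⊗ β≥0 ⊗ le⇒0≤ Y≥1) (solve (β ∷ k ∷ Y ∷ []))
    k²βW≥ : n * n * n ≤ k * k * β * W
    k²βW≥ = cancel P (1≤⇒0< P≥1)
      (cert ((1≤⇒0≤ P≥1 ⊗ β≥0) ⊗ le⇒0≤ hW ⊕ (1≤⇒0≤ P≥1 ⊗ le⇒0≤ k≥1 ⊗ n≥0 ⊗ n≥0) ⊗ le⇒0≤ hr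
          ⊕ β≥0 ⊗ n≥0 ⊗ le⇒0≤ hE ⊕ k≥0 ⊗ β≥0 ⊗ le⇒0≤ hD
          ⊕ (n≥0 ⊗ n≥0 ⊗ n≥0) ⊗ le⇒0≤ P≥β[k+1]
          ⊕ (1≤⇒0≤ P≥1 ⊗ (n≥0 ⊗ n≥0 ⊗ n≥0)) ⊗ le⇒0≤ k≥3)
        (solve (k ∷ n ∷ β ∷ P ∷ r ∷ E ∷ D ∷ W ∷ [])))
    n⁴≤0 : + 2 * (n * n * (n * n)) ≤ 0ℤ
    n⁴≤0 = cert (0≤+ {4} ⊗ n≥0 ⊗ le⇒0≤ k²βW≥ ⊕ 0≤+ {4} ⊗ (k≥0 ⊗ k≥0) ⊗ β≥0 ⊗ le⇒0≤ nW
                 ⊕ n≥0 ⊗ D≥0 ⊗ le⇒0≤ hP ⊕ (n≥0 ⊗ n≥0) ⊗ X≥0 ⊗ le⇒0≤ hZ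
                 ⊕ n≥0 ⊗ le⇒0≤ hD ⊕ (n≥0 ⊗ n≥0) ⊗ le⇒0≤ hX)
        (solve (k ∷ n ∷ β ∷ Y ∷ Z ∷ P ∷ D ∷ X ∷ W ∷ []))

  module Greedy {A : Set} (conf : Config A) (k : ℤ) (k≥3 : + 3 ≤ k) (n≥1 : 1ℤ ≤ Counting.n conf) where
    open Config conf
    open Counting conf
    open Errors conf k

    k≥1 : 1ℤ ≤ k
    k≥1 = ≤-trans (+≤+ (s≤s z≤n)) k≥3

    k≥0 : 0ℤ ≤ k
    k≥0 = 1≤⇒0≤ k≥1

    size : (A → ℤ) → ℤ
    size ρ = S ρ

    -- Nonadjacent pairs leaving the region. It would vanish if the region were a union of parts of
    -- a complete multipartite shadow.
    boundary : (A → ℤ) → ℤ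
    boundary ρ = S λ u → S λ z → γ̄ u z * (ρ u * (1ℤ - ρ z))

    private
      aErr≥0 : ∀ v w → 0ℤ ≤ aErr v w
      aErr≥0 v w = 0≤+

    module Region (ρ : A → ℤ) (ρ-bit : ∀ u → Bit (ρ u)) where
      r X W : ℤ
      s : A → A → ℤ
      r = size ρ
      X = boundary ρ
      s v w = S λ u → ρ u * τ u v w
      W = S λ v → S λ w → s v w

      ρ≥0 : ∀ u → 0ℤ ≤ ρ u
      ρ≥0 u = bit≥0 (ρ-bit u)

      ρ̄≥0 : ∀ u → 0ℤ ≤ 1ℤ - ρ u
      ρ̄≥0 u = bit≥0 (bit-co (ρ-bit u))

      X≥0 : 0ℤ ≤ X
      X≥0 = ∑-≥0 V λ u → ∑-≥0 V λ z → γ̄≥0 u z ⊗ (ρ≥0 u ⊗ ρ̄≥0 z)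

      s≥0 : ∀ v w → 0ℤ ≤ s v w
      s≥0 v w = ∑-≥0 V λ u → ρ≥0 u ⊗ τ≥0 u v w

      s≤a : ∀ v w → s v w ≤ a v w
      s≤a v w = ∑-mono V λ u → bit-*≤ (ρ-bit u) (τ≥0 u v w) ≤-refl

      s≤γn : ∀ v w → s v w ≤ γ v w * n
      s≤γn v w = ∑-le1 V (γ v w) (λ _ → 1ℤ) λ u →
        subst (ρ u * τ u v w ≤_) (sym (*-identityʳ (γ v w))) (bit-*≤ (ρ-bit u) (γ≥0 v w) (τ≤γ u v w))

      private
        out : A → A → ℤ
        out v w = S λ z → τ z v w * (1ℤ - ρ z)

        s+out : ∀ v w → s v w + out v w ≡ a v w
        s+out v w = trans (sym (∑-+ V (λ u → ρ u * τ u v w) (λ z → τ z v w * (1ℤ - ρ z))))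
          (∑-cong V λ u → alg (ρ u) (τ u v w))
          where alg : ∀ x y → x * y + y * (1ℤ - x) ≡ y
                alg = solve-∀

        -- A vertex of `N(vw)` inside the region and one outside are nonadjacent by independence, so
        -- the boundary counts the pair. A small boundary thus makes one of the two parts of `N(vw)`
        -- small.
        s*out≤X : ∀ v w → s v w * out v w ≤ X
        s*out≤X v w = subst (_≤ X) eq (∑-mono V λ u → ∑-mono V λ z → point u z)
          where
          point : ∀ u z → τ u v w * ρ u * (τ z v w * (1ℤ - ρ z)) ≤ γ̄ u z * (ρ u * (1ℤ - ρ z))
          point u z with τ-bit u v w
          ... | inj₁ e = subst (_≤ γ̄ u z * (ρ u * (1ℤ - ρ z))) (sym (trans (cong (λ x → x * ρ u * (τ z v w * (1ℤ - ρ z))) e) (alg (ρ u) (τ z v w * (1ℤ - ρ z)))))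
                  (γ̄≥0 u z ⊗ (ρ≥0 u ⊗ ρ̄≥0 z))
            where alg : ∀ x y → 0ℤ * x * y ≡ 0ℤ
                  alg = solve-∀
          ... | inj₂ e = subst (_≤ γ̄ u z * (ρ u * (1ℤ - ρ z))) (sym (cong (λ x → x * ρ u * (τ z v w * (1ℤ - ρ z))) e))
                  (alg (ρ u) (τ z v w) (γ̄ u z) (1ℤ - ρ z) (ρ≥0 u) (ρ̄≥0 z) (ττ≤γ̄ u z v w e))
            where alg : ∀ p x y q → 0ℤ ≤ p → 0ℤ ≤ q → x ≤ y → 1ℤ * p * (x * q) ≤ y * (p * q)
                  alg p x y q pp pq h = cert (pp ⊗ pq ⊗ le⇒0≤ h) (solve (p ∷ x ∷ y ∷ q ∷ []))
          eq : S (λ u → S λ z → τ u v w * ρ u * (τ z v w * (1ℤ - ρ z))) ≡ s v w * out v w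
          eq = trans (∑-lin1 V (out v w) (λ u → ρ u * τ u v w) λ u →
                 trans (∑-lin1 V (τ u v w * ρ u) (λ z → τ z v w * (1ℤ - ρ z)) λ z → refl) (alg (τ u v w) (ρ u) (out v w)))
                 (*-comm (out v w) (s v w))
            where alg : ∀ x y z → x * y * z ≡ z * (y * x)
                  alg = solve-∀

        W≡ : W ≡ S λ v → S λ w → ρ v * a v w
        W≡ = trans (∑-swap13 V (λ v w u → ρ u * τ u v w))
          (∑-cong V λ v → ∑-cong V λ w → trans (∑-cong V λ u → cong (ρ v *_) (τ-swap₁₂ v u w))
            (∑-lin1 V (ρ v) (λ u → τ u v w) λ u → refl))

        ρdeg : ℤ
        ρdeg = S λ v → ρ v * deg v

        kW≥ : n * ρdeg - D ≤ k * W
        kW≥ = subst₂ _≤_ lhs (sym (trans (cong (k *_) W≡) (sym (∑-lin1 V k (λ v → S λ w → ρ v * a v w) λ v → refl))))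
                (∑-mono V λ v → subst₂ _≤_ refl (∑-lin1 V k (λ w → ρ v * a v w) λ w → refl)
                   (∑-mono V λ w → point v w))
          where
          point : ∀ v w → n * (ρ v * γ v w) + -1ℤ * (γ v w * aErr v w) ≤ k * (ρ v * a v w)
          point v w = subst (λ z → n * (ρ v * γ v w) + -1ℤ * (γ v w * aErr v w) ≤ k * (ρ v * z)) (γa v w)
            (alg (ρ v) (γ v w) (aErr v w) (a v w) k n (ρ≥0 v) (ρ̄≥0 v) (γ≥0 v w) (aErr≥0 v w) (-≤abs (k * a v w - n)))
            where
            alg : ∀ p y x b k n → 0ℤ ≤ p → 0ℤ ≤ 1ℤ - p → 0ℤ ≤ y → 0ℤ ≤ x → - (k * b - n) ≤ x →
              n * (p * y) + -1ℤ * (y * x) ≤ k * (p * (y * b))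
            alg p y x b k n pp pp̄ py px h = cert (pp ⊗ py ⊗ le⇒0≤ h ⊕ pp̄ ⊗ py ⊗ px) (solve (p ∷ y ∷ x ∷ b ∷ k ∷ n ∷ []))
          lhs : S (λ v → S λ w → n * (ρ v * γ v w) + -1ℤ * (γ v w * aErr v w)) ≡ n * ρdeg - D
          lhs = trans (∑-lin2 V n (λ v → ρ v * deg v) -1ℤ (λ v → S λ w → γ v w * aErr v w) λ v →
                  trans (∑-lin2 V n (λ w → ρ v * γ v w) -1ℤ (λ w → γ v w * aErr v w) λ w → refl)
                    (cong (λ z → n * z + -1ℤ * S (λ w → γ v w * aErr v w)) (∑-lin1 V (ρ v) (γ v) λ w → refl)))
                  (cong (λ z → n * ρdeg + z) (-1*i≡-i D))

        kρdeg≥ : (k - 1ℤ) * n * r - E ≤ k * ρdeg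
        kρdeg≥ = subst₂ _≤_ (trans (∑-lin2 V ((k - 1ℤ) * n) ρ -1ℤ (λ v → abs (k * c v - n)) λ v → refl)
                   (cong (λ z → (k - 1ℤ) * n * r + z) (-1*i≡-i E)))
                 (∑-lin1 V k (λ v → ρ v * deg v) λ v → refl)
                 (∑-mono V λ v → alg (ρ v) (abs (k * c v - n)) (deg v) (c v) k n (deg+c v) (ρ≥0 v) (ρ̄≥0 v) 0≤+ (≤abs (k * c v - n)))
          where
          alg : ∀ p x d c k n → d + c ≡ n → 0ℤ ≤ p → 0ℤ ≤ 1ℤ - p → 0ℤ ≤ x → k * c - n ≤ x →
            (k - 1ℤ) * n * p + -1ℤ * x ≤ k * (p * d)
          alg p x d c k .(d + c) refl pp pp̄ px h = cert (pp ⊗ le⇒0≤ h ⊕ pp̄ ⊗ px) (solve (p ∷ x ∷ d ∷ c ∷ k ∷ []))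

        k²W≥ : n * ((k - 1ℤ) * n * r - E) - k * D ≤ k * k * W
        k²W≥ = alg k n ρdeg D W ((k - 1ℤ) * n * r - E) n≥0 k≥0 kW≥ kρdeg≥
          where
          alg : ∀ k n p d w x → 0ℤ ≤ n → 0ℤ ≤ k → n * p - d ≤ k * w → x ≤ k * p → n * x - k * d ≤ k * k * w
          alg k n p d w x pn pk h₁ h₂ = cert (pk ⊗ le⇒0≤ h₁ ⊕ pn ⊗ le⇒0≤ h₂) (solve (k ∷ n ∷ p ∷ d ∷ w ∷ x ∷ []))

        module _ (Y : ℤ) (Y≥0 : 0ℤ ≤ Y) (fail : ∀ v w → n ≤ Y * (n - k * s v w)) where

          -- Multiplied by `s`, the assumption `fail` bounds `n s` by `Y s (n - k s)`. With
          -- `s = a - out`, the part `s (n - k a)` is at most `n` times the codegree error of a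
          -- shadow pair, and `k s out` is at most `k X`.
          nW≤ : n * W ≤ Y * (n * D) + Y * (k * (n * n * X))
          nW≤ = subst₂ _≤_ lhs rhs (∑-mono V λ v → ∑-mono V λ w → point v w)
            where
            point : ∀ v w → n * s v w ≤ Y * (n * (γ v w * aErr v w)) + Y * (k * X)
            point v w = alg Y n k (s v w) (a v w) (out v w) X (γ v w) (aErr v w) Y≥0 k≥0 (s≥0 v w) 0≤+ (s+out v w) (s*out≤X v w)
                          (s≤γn v w) (-≤abs (k * a v w - n)) (fail v w)
              where
              alg : ∀ Y n k s a o X y x → 0ℤ ≤ Y → 0ℤ ≤ k → 0ℤ ≤ s → 0ℤ ≤ x → s + o ≡ a → s * o ≤ X → s ≤ y * n → - (k * a - n) ≤ x →
                n ≤ Y * (n - k * s) → n * s ≤ Y * (n * (y * x)) + Y * (k * X)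
              alg Y n k s .(s + o) o X y x pY pk ps px refl h₁ h₂ h₃ h₄ =
                cert (ps ⊗ le⇒0≤ h₄ ⊕ pY ⊗ ps ⊗ le⇒0≤ h₃ ⊕ pY ⊗ pk ⊗ le⇒0≤ h₁ ⊕ pY ⊗ px ⊗ le⇒0≤ h₂)
                     (solve (Y ∷ n ∷ k ∷ s ∷ o ∷ X ∷ y ∷ x ∷ []))
            lhs : S (λ v → S λ w → n * s v w) ≡ n * W
            lhs = ∑-lin1 V n (λ v → S λ w → s v w) λ v → ∑-lin1 V n (s v) λ w → refl
            rhs : S (λ v → S λ w → Y * (n * (γ v w * aErr v w)) + Y * (k * X)) ≡ Y * (n * D) + Y * (k * (n * n * X))
            rhs = trans (∑-lin2 V (Y * n) (λ v → S λ w → γ v w * aErr v w) (Y * k * X * n) (λ _ → 1ℤ) λ v →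
                    trans (∑-lin2 V (Y * n) (λ w → γ v w * aErr v w) (Y * k * X) (λ _ → 1ℤ) λ w → alg (Y) n (γ v w * aErr v w) k X)
                          (alg₁ (Y * n) (S λ w → γ v w * aErr v w) (Y * k * X) n))
                    (alg₂ Y n D k X)
              where
              alg : ∀ Y n z k X → Y * (n * z) + Y * (k * X) ≡ Y * n * z + Y * k * X * 1ℤ
              alg = solve-∀
              alg₁ : ∀ x y z n → x * y + z * n ≡ x * y + z * n * 1ℤ
              alg₁ = solve-∀
              alg₂ : ∀ Y n D k X → Y * n * D + Y * k * X * n * n ≡ Y * (n * D) + Y * (k * (n * n * X))
              alg₂ = solve-∀

      -- Otherwise every codegree neighbourhood meets the region in fewer than
      -- (1 - 1/Y) n / k vertices, which is too few for the edges meeting it.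
      dense-codegree : ∀ β Y Z P → 1ℤ ≤ β → 1ℤ ≤ Y → + 4 * (k * k) * β * Y ≤ P → + 4 * (k * k * k) * β * Y ≤ Z →
        P * E ≤ n * n → P * D ≤ n * n * n → Z * X ≤ n * n → n ≤ β * r →
        ∃ λ v → ∃ λ w → Y * (n - k * s v w) ≤ n
      dense-codegree β Y Z P β≥1 Y≥1 hP hZ hE hD hX hr with
        search {Q = λ v → ∃ λ w → Y * (n - k * s v w) ≤ n} {R = λ v → ∀ w → n ≤ Y * (n - k * s v w)} inner V
        where
        inner : ∀ v → (∃ λ w → Y * (n - k * s v w) ≤ n) ⊎ (∀ w → n ≤ Y * (n - k * s v w))
        inner v with search {Q = λ w → Y * (n - k * s v w) ≤ n} {R = λ w → n ≤ Y * (n - k * s v w)} (λ w → ≤-total _ _) V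
        ... | inj₁ q = inj₁ q
        ... | inj₂ h = inj₂ λ w → h w (complete w)
      ... | inj₁ q = q
      ... | inj₂ h = ⊥-elim (sparse-absurd k n β Y Z P r E D X W k≥3 n≥1 β≥1 Y≥1 hP hZ (E≥0) D≥0 X≥0 hE hD hX hr k²W≥
                       (nW≤ Y (1≤⇒0≤ Y≥1) (λ v w → h v (complete v) w)))

  -- Greedy colouring by codegree neighbourhoods

  boundary-arith : ∀ k n β Z P q X X′ T E → 1ℤ ≤ k → 0ℤ ≤ n → 1ℤ ≤ β → 1ℤ ≤ Z → + 4 ≤ q → 0ℤ ≤ X → 0ℤ ≤ E →
    X′ ≤ X + T → k * (+ 4 * β * Z) * T ≤ (+ 4 * β * Z) * E + n * n →
    (q * Z) * X ≤ n * n → P * E ≤ n * n → q * Z ≤ P → Z * X′ ≤ n * n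
  boundary-arith k n β Z P q X X′ T E k≥1 n≥0 β≥1 Z≥1 q≥4 X≥0 E≥0 hX′ hT hX hE hP =
    cancel (+ 4 * k * (+ 4 * β * Z)) (1≤⇒0< (1≤* {+ 4 * k} {+ 4 * β * Z} (1≤* {+ 4} {k} 1≤4 k≥1) Y≥1))
      (cert (0≤+ {4} ⊗ k≥0 ⊗ Y≥0 ⊗ Z≥0 ⊗ le⇒0≤ hX′ ⊕ 0≤+ {4} ⊗ Z≥0 ⊗ le⇒0≤ hT
             ⊕ 0≤+ {2} ⊗ k≥0 ⊗ Y≥0 ⊗ le⇒0≤ 2ZX ⊕ Y≥0 ⊗ le⇒0≤ 4ZE
             ⊕ n≥0 ⊗ n≥0 ⊗ Z≥0 ⊗ (0≤+ {4} ⊗ (β≥0 ⊗ le⇒0≤ k≥1 ⊕ (k≥0 ⊗ le⇒0≤ β≥1 ⊕ le⇒0≤ k≥1))))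
            (solve (k ∷ n ∷ β ∷ Z ∷ X ∷ X′ ∷ T ∷ E ∷ [])))
    where
    1≤4 : 1ℤ ≤ + 4
    1≤4 = +≤+ (s≤s z≤n)
    k≥0 = 1≤⇒0≤ k≥1
    β≥0 = 1≤⇒0≤ β≥1
    Z≥0 = 1≤⇒0≤ Z≥1
    Y≥1 : 1ℤ ≤ + 4 * β * Z
    Y≥1 = 1≤* {+ 4 * β} {Z} (1≤* {+ 4} {β} 1≤4 β≥1) Z≥1
    Y≥0 = 1≤⇒0≤ Y≥1
    2ZX : + 2 * Z * X ≤ n * n
    2ZX = cert (le⇒0≤ hX ⊕ (le⇒0≤ q≥4 ⊕ 0≤+ {2}) ⊗ Z≥0 ⊗ X≥0) (solve (q ∷ Z ∷ X ∷ n ∷ []))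
    4ZE : + 4 * Z * E ≤ n * n
    4ZE = cert (le⇒0≤ hE ⊕ le⇒0≤ hP ⊗ E≥0 ⊕ le⇒0≤ q≥4 ⊗ Z≥0 ⊗ E≥0) (solve (q ∷ Z ∷ E ∷ P ∷ n ∷ []))

  -- The invariant says that after `m` steps at most `(k - m) n / k + m n / (β k)` vertices remain.
  -- As `β ≤ Y`, removing `n / k` up to a share `1 / Y` preserves it. At `m = k` it reads `β r ≤ n`.
  size-arith : ∀ k n β Y m r s → 1ℤ ≤ Y → β ≤ Y → 0ℤ ≤ β → 0ℤ ≤ n → Y * (n - k * s) ≤ n →
    β * (k * r + m * n - k * n) ≤ m * n → β * (k * (r - s) + (1ℤ + m) * n - k * n) ≤ (1ℤ + m) * n
  size-arith k n β Y m r s Y≥1 β≤Y β≥0 n≥0 hs hr = cancel Y (1≤⇒0< Y≥1)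
    (cert (1≤⇒0≤ Y≥1 ⊗ le⇒0≤ hr ⊕ β≥0 ⊗ le⇒0≤ hs ⊕ le⇒0≤ β≤Y ⊗ n≥0) (solve (k ∷ n ∷ β ∷ Y ∷ m ∷ r ∷ s ∷ [])))

  -- A labelling sends a vertex to 0 while it is uncoloured and to suc i once it has colour i.
  uncoloured : ℕ → ℤ
  uncoloured zero = 1ℤ
  uncoloured (suc _) = 0ℤ

  uncoloured-bit : ∀ x → Bit (uncoloured x)
  uncoloured-bit zero = inj₂ refl
  uncoloured-bit (suc _) = inj₁ refl

  -- A vertex keeps its first colour, so the new class is the set indicated by `b` without the
  -- vertices already coloured.
  relabel : ℕ → ℤ → ℕ → ℕ
  relabel (suc i) b m = suc i
  relabel zero (+ zero) m = zero
  relabel zero _ m = suc m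

  uncoloured-relabel : ∀ x {b} m → Bit b → uncoloured (relabel x b m) ≡ uncoloured x * (1ℤ - b)
  uncoloured-relabel (suc x) m q = refl
  uncoloured-relabel zero m (inj₁ refl) = refl
  uncoloured-relabel zero m (inj₂ refl) = refl

  relabel-suc : ∀ x {b} m {i} → Bit b → relabel x b m ≡ suc i → x ≡ suc i ⊎ (b ≡ 1ℤ × i ≡ m)
  relabel-suc (suc x) m q e = inj₁ e
  relabel-suc zero m (inj₁ refl) ()
  relabel-suc zero m (inj₂ refl) refl = inj₂ (refl , refl)

  relabel-≤ : ∀ {x} b m → x ℕ.≤ m → relabel x b m ℕ.≤ suc m
  relabel-≤ {suc x} b m h = ℕ.m≤n⇒m≤1+n h
  relabel-≤ {zero} (+ zero) m h = z≤n
  relabel-≤ {zero} (+ suc _) m h = ℕ.≤-refl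
  relabel-≤ {zero} (-[1+ _ ]) m h = ℕ.≤-refl

  module Colouring {A : Set} (conf : Config A) (K : ℕ) (k : ℤ) (k≡K : k ≡ + K) (k≥3 : + 3 ≤ k) (n≥1 : 1ℤ ≤ Counting.n conf) where
    open Config conf
    open Counting conf
    open Errors conf k
    open Greedy conf k k≥3 n≥1

    Proper : ℕ → (A → ℕ) → Set
    Proper m ψ = (∀ u → ψ u ℕ.≤ m) × (∀ u u′ i → ψ u ≡ suc i → ψ u′ ≡ suc i → γ u u′ ≡ 0ℤ)

    rest : (A → ℕ) → A → ℤ
    rest ψ u = uncoloured (ψ u)

    -- The old colours are below `m`, so colour `m` meets no old class, and any two vertices that
    -- receive it lie in `N(vw)`, which is independent.
    proper-relabel : ∀ {m ψ} v w → Proper m ψ → Proper (suc m) (λ u → relabel (ψ u) (τ u v w) m)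
    proper-relabel {m} {ψ} v w (bound , proper) = (λ u → relabel-≤ (τ u v w) m (bound u)) , proper′
      where
      fresh : ∀ {u i} → ψ u ≡ suc i → i ≡ m → ⊥
      fresh {u} e refl = ℕ.1+n≰n (subst (ℕ._≤ m) e (bound u))
      proper′ : ∀ u u′ i → relabel (ψ u) (τ u v w) m ≡ suc i → relabel (ψ u′) (τ u′ v w) m ≡ suc i → γ u u′ ≡ 0ℤ
      proper′ u u′ i e e′ with relabel-suc (ψ u) m (τ-bit u v w) e | relabel-suc (ψ u′) m (τ-bit u′ v w) e′
      ... | inj₁ p | inj₁ p′ = proper u u′ i p p′
      ... | inj₁ p | inj₂ (_ , i≡m) = ⊥-elim (fresh p i≡m)
      ... | inj₂ (_ , i≡m) | inj₁ p′ = ⊥-elim (fresh p′ i≡m)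
      ... | inj₂ (p , _) | inj₂ (p′ , _) = indep p p′

    module _ (ρ : A → ℤ) (ρ-bit : ∀ u → Bit (ρ u)) (v w : A) where
      open Region ρ ρ-bit

      remove : A → ℤ
      remove u = ρ u * (1ℤ - τ u v w)

      spill : ℤ
      spill = S λ z → τ z v w * (c z - a v w)

      size-remove : size remove ≡ r - s v w
      size-remove = trans (∑-lin2 V 1ℤ ρ -1ℤ (λ u → ρ u * τ u v w) λ u → alg (ρ u) (τ u v w)) (alg₁ r (s v w))
        where
        alg : ∀ x y → x * (1ℤ - y) ≡ 1ℤ * x + -1ℤ * (x * y)
        alg = solve-∀
        alg₁ : ∀ x y → 1ℤ * x + -1ℤ * y ≡ x - y
        alg₁ = solve-∀

      -- A pair that is counted only after the removal has its outer end in `N(vw)` and its inner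
      -- end outside `N(vw)`. By `B-inner` there are at most `spill` such nonadjacent pairs.
      boundary-remove : boundary remove ≤ X + spill
      boundary-remove = subst (boundary remove ≤_) eq (∑-mono V λ u → ∑-mono V λ z → point u z)
        where
        point : ∀ u z → γ̄ u z * (remove u * (1ℤ - remove z)) ≤ γ̄ u z * (ρ u * (1ℤ - ρ z)) + τ z v w * (γ̄ z u * (1ℤ - τ u v w))
        point u z = subst (λ y → γ̄ u z * (remove u * (1ℤ - remove z)) ≤ γ̄ u z * (ρ u * (1ℤ - ρ z)) + τ z v w * (y * (1ℤ - τ u v w)))
            (cong (λ y → 1ℤ - y) (γ-sym u z))
            (alg (γ̄ u z) (ρ u) (ρ z) (τ u v w) (τ z v w) (γ̄≥0 u z) (ρ≥0 u) (ρ̄≥0 u) (ρ≥0 z) (ρ̄≥0 z) (τ≥0 u v w) (bit≥0 (bit-co (τ-bit u v w))) (τ≥0 z v w))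
          where
          alg : ∀ y p q x x′ → 0ℤ ≤ y → 0ℤ ≤ p → 0ℤ ≤ 1ℤ - p → 0ℤ ≤ q → 0ℤ ≤ 1ℤ - q → 0ℤ ≤ x → 0ℤ ≤ 1ℤ - x → 0ℤ ≤ x′ →
            y * (p * (1ℤ - x) * (1ℤ - q * (1ℤ - x′))) ≤ y * (p * (1ℤ - q)) + x′ * (y * (1ℤ - x))
          alg y p q x x′ py pp pp̄ pq pq̄ px px̄ px′ =
            cert (py ⊗ pp ⊗ pq̄ ⊗ px ⊕ py ⊗ px̄ ⊗ px′ ⊗ (pp̄ ⊗ pq ⊕ pq̄)) (solve (y ∷ p ∷ q ∷ x ∷ x′ ∷ []))
        eq : S (λ u → S λ z → γ̄ u z * (ρ u * (1ℤ - ρ z)) + τ z v w * (γ̄ z u * (1ℤ - τ u v w))) ≡ X + spill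
        eq = trans (∑-cong V λ u → ∑-+ V (λ z → γ̄ u z * (ρ u * (1ℤ - ρ z))) (λ z → τ z v w * (γ̄ z u * (1ℤ - τ u v w))))
          (trans (∑-+ V (λ u → S λ z → γ̄ u z * (ρ u * (1ℤ - ρ z))) (λ u → S λ z → τ z v w * (γ̄ z u * (1ℤ - τ u v w))))
            (cong (λ z → X + z) (trans (∑-swap V V (λ u z → τ z v w * (γ̄ z u * (1ℤ - τ u v w))))
              (∑-cong V λ z → B-inner v w z))))

      -- Smallness of `B` on average does not help for one pair. But the codegree here is at least
      -- `s v w`, which is almost `n / k`, and comparing each `c z` with `n / k` costs at most `E`
      -- in total.
      spill≤ : ∀ Y → 0ℤ ≤ Y → Y * (n - k * s v w) ≤ n → k * Y * spill ≤ Y * E + n * n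
      spill≤ Y Y≥0 h = subst₂ _≤_ (∑-lin1 V (k * Y) (λ z → τ z v w * (c z - a v w)) λ z → refl) refl
        (∑-le2 V Y (λ z → abs (k * c z - n)) n (λ _ → 1ℤ) λ z →
          subst (_≤ Y * abs (k * c z - n) + n * 1ℤ) (alg₁ (τ z v w) (k * Y) (c z - a v w))
            (bit-*≤ {x = k * Y * (c z - a v w)} (τ-bit z v w) (Y≥0 ⊗ 0≤+ ⊕ n≥0 ⊗ 0≤+ {1})
              (alg k Y (c z) (a v w) (s v w) n (abs (k * c z - n)) Y≥0 k≥0 (s≤a v w) h (≤abs (k * c z - n)))))
        where
        alg₁ : ∀ x y z → x * (y * z) ≡ y * (x * z)
        alg₁ = solve-∀
        alg : ∀ k Y c a s n x → 0ℤ ≤ Y → 0ℤ ≤ k → s ≤ a → Y * (n - k * s) ≤ n → k * c - n ≤ x →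
          k * Y * (c - a) ≤ Y * x + n * 1ℤ
        alg k Y c a s n x pY pk h₁ h₂ h₃ = cert (pY ⊗ le⇒0≤ h₃ ⊕ le⇒0≤ h₂ ⊕ pY ⊗ pk ⊗ le⇒0≤ h₁)
          (solve (k ∷ Y ∷ c ∷ a ∷ s ∷ n ∷ x ∷ []))

    module Iteration (β P : ℤ) (β≥1 : 1ℤ ≤ β) (PE≤ : P * E ≤ n * n) (PD≤ : P * D ≤ n * n * n) where
      -- The factor by which one step may weaken the boundary bound, from `n² / (q Z)` to `n² / Z`.
      -- With `Y = 4 β Z` the requirement `4 k³ β Y ≤ q Z` of `dense-codegree` becomes an equality
      -- for this value.
      q : ℤ
      q = + 16 * (k * k * k) * (β * β)

      private
        1≤+ : ∀ {m} → 1ℤ ≤ + suc m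
        1≤+ = +≤+ (s≤s z≤n)

      q≥4 : + 4 ≤ q
      q≥4 = alg k β (1≤* {k * k * k} {β * β} (1≤* {k * k} {k} (1≤* k≥1 k≥1) k≥1) (1≤* β≥1 β≥1))
        where
        alg : ∀ k β → 1ℤ ≤ k * k * k * (β * β) → + 4 ≤ + 16 * (k * k * k) * (β * β)
        alg k β h = cert (0≤+ {16} ⊗ le⇒0≤ h ⊕ 0≤+ {12}) (solve (k ∷ β ∷ []))

      ^≥1 : ∀ j → 1ℤ ≤ q ^ j
      ^≥1 zero = ≤-refl
      ^≥1 (suc j) = 1≤* (≤-trans (1≤+ {3}) q≥4) (^≥1 j)

      Inv : ℕ → ℤ → (A → ℕ) → Set
      Inv m Z ψ = Z * boundary (rest ψ) ≤ n * n × β * (k * size (rest ψ) + + m * n - k * n) ≤ + m * n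

      Goal : Set
      Goal = Σ (A → ℕ) λ ψ → Proper K ψ × β * size (rest ψ) ≤ n

      iterate : ∀ j m ψ → m ℕ.+ j ≡ K → q ^ j ≤ P → Proper m ψ → Inv m (q ^ j) ψ → Goal
      iterate zero m ψ eq hP proper (_ , hr) with trans (sym (ℕ.+-identityʳ m)) eq
      ... | refl = ψ , proper , cancel k (1≤⇒0< k≥1) (alg k n β (size (rest ψ)) (subst (λ z → β * (k * size (rest ψ) + z * n - k * n) ≤ z * n) (sym k≡K) hr))
        where
        alg : ∀ k n β r → β * (k * r + k * n - k * n) ≤ k * n → k * (β * r) ≤ k * n
        alg k n β r h = cert (le⇒0≤ h) (solve (k ∷ n ∷ β ∷ r ∷ []))
      iterate (suc j) m ψ eq hP proper (hX , hr) with ≤-total (β * size (rest ψ)) n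
      -- Few enough vertices are left; the later colours stay empty.
      ... | inj₁ small = ψ , ((λ u → ℕ.≤-trans (proj₁ proper u) m≤K) , proj₂ proper) , small
        where m≤K : m ℕ.≤ K
              m≤K = subst (m ℕ.≤_) eq (ℕ.m≤m+n m (suc j))
      ... | inj₂ large = iterate j (suc m) ψ′ (trans (sym (ℕ.+-suc m j)) eq) hP′ (proper-relabel v w proper) (hX′ , hr′)
        where
        Z Y : ℤ
        Z = q ^ j
        -- The chosen set may fall short of `n / k` by a share `1 / Y`; the factor `Z` keeps the
        -- resulting spill below the next boundary bound.
        Y = + 4 * β * Z
        Y≥1 : 1ℤ ≤ Y
        Y≥1 = 1≤* {+ 4 * β} {Z} (1≤* {+ 4} {β} 1≤+ β≥1) (^≥1 j)
        ρ : A → ℤ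
        ρ = rest ψ
        ρ-bit : ∀ u → Bit (ρ u)
        ρ-bit u = uncoloured-bit (ψ u)
        open Region ρ ρ-bit
        hP′ : Z ≤ P
        hP′ = ≤-trans (alg q Z q≥4 (1≤⇒0≤ (^≥1 j))) hP
          where
          alg : ∀ q Z → + 4 ≤ q → 0ℤ ≤ Z → Z ≤ q * Z
          alg q Z h pz = cert (pz ⊗ (le⇒0≤ h ⊕ 0≤+ {3})) (solve (q ∷ Z ∷ []))
        pick : ∃ λ v → ∃ λ w → Y * (n - k * s v w) ≤ n
        pick = dense-codegree β Y (q * Z) P β≥1 Y≥1 (≤-trans (alg k β Z k≥1 (1≤⇒0≤ β≥1) (1≤⇒0≤ (^≥1 j))) hP)
                 (≤-reflexive (alg₁ k β Z)) PE≤ PD≤ hX large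
          where
          alg : ∀ k β Z → 1ℤ ≤ k → 0ℤ ≤ β → 0ℤ ≤ Z → + 4 * (k * k) * β * (+ 4 * β * Z) ≤ + 16 * (k * k * k) * (β * β) * Z
          alg k β Z k1 pβ pz = cert (0≤+ {16} ⊗ (1≤⇒0≤ k1 ⊗ 1≤⇒0≤ k1) ⊗ (pβ ⊗ pβ) ⊗ pz ⊗ le⇒0≤ k1) (solve (k ∷ β ∷ Z ∷ []))
          alg₁ : ∀ k β Z → + 4 * (k * k * k) * β * (+ 4 * β * Z) ≡ + 16 * (k * k * k) * (β * β) * Z
          alg₁ = solve-∀
        v w : A
        v = proj₁ pick
        w = proj₁ (proj₂ pick)
        hs : Y * (n - k * s v w) ≤ n
        hs = proj₂ (proj₂ pick)
        ψ′ : A → ℕ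
        ψ′ u = relabel (ψ u) (τ u v w) m
        rest′ : ∀ u → rest ψ′ u ≡ remove ρ ρ-bit v w u
        rest′ u = uncoloured-relabel (ψ u) m (τ-bit u v w)
        boundary′ : boundary (rest ψ′) ≡ boundary (remove ρ ρ-bit v w)
        boundary′ = ∑-cong V λ u → ∑-cong V λ z → cong₂ (λ x y → γ̄ u z * (x * (1ℤ - y))) (rest′ u) (rest′ z)
        hX′ : Z * boundary (rest ψ′) ≤ n * n
        hX′ = subst (λ z → Z * z ≤ n * n) (sym boundary′)
          (boundary-arith k n β Z P q X _ (spill ρ ρ-bit v w) E k≥1 n≥0 β≥1 (^≥1 j) q≥4 X≥0 E≥0
            (boundary-remove ρ ρ-bit v w) (spill≤ ρ ρ-bit v w Y (1≤⇒0≤ Y≥1) hs) hX PE≤ hP)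
        β≤Y : β ≤ Y
        β≤Y = alg β Z (1≤⇒0≤ β≥1) (^≥1 j)
          where
          alg : ∀ β Z → 0ℤ ≤ β → 1ℤ ≤ Z → β ≤ + 4 * β * Z
          alg β Z pβ z1 = cert (pβ ⊗ (0≤+ {4} ⊗ le⇒0≤ z1 ⊕ 0≤+ {3})) (solve (β ∷ Z ∷ []))
        hr′ : β * (k * size (rest ψ′) + + suc m * n - k * n) ≤ + suc m * n
        hr′ = subst (λ z → β * (k * z + + suc m * n - k * n) ≤ + suc m * n)
                (sym (trans (∑-cong V rest′) (size-remove ρ ρ-bit v w)))
                (size-arith k n β Y (+ m) r (s v w) Y≥1 β≤Y (1≤⇒0≤ β≥1) n≥0 hs hr)

      colouring : q ^ K ≤ P → Goal
      colouring hP = iterate K 0 (λ _ → 0) refl hP ((λ _ → z≤n) , λ _ _ _ ()) (hX , hr)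
        where
        hX : (q ^ K) * boundary (λ _ → 1ℤ) ≤ n * n
        hX = subst (_≤ n * n) (sym (trans (cong ((q ^ K) *_) boundary≡0) (*-zeroʳ (q ^ K)))) (n≥0 ⊗ n≥0)
          where
          boundary≡0 : boundary (λ _ → 1ℤ) ≡ 0ℤ
          boundary≡0 = trans (∑-cong V λ u → trans (∑-cong V λ z → *-zeroʳ (γ̄ u z)) (∑-zero V)) (∑-zero V)
        hr : β * (k * n + 0ℤ * n - k * n) ≤ 0ℤ * n
        hr = ≤-reflexive (alg k n β)
          where
          alg : ∀ k n β → β * (k * n + 0ℤ * n - k * n) ≡ 0ℤ * n
          alg = solve-∀

  -- Indicators, and nearly constant 0/1 functions on boxes

  𝟙 : ∀ {p} {P : Set p} → Dec P → ℤ
  𝟙 d = if does d then 1ℤ else 0ℤ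

  𝟙-bit : ∀ {p} {P : Set p} (d : Dec P) → Bit (𝟙 d)
  𝟙-bit (yes _) = inj₂ refl
  𝟙-bit (no _) = inj₁ refl

  𝟙-yes : ∀ {p} {P : Set p} (d : Dec P) → P → 𝟙 d ≡ 1ℤ
  𝟙-yes (yes _) x = refl
  𝟙-yes (no ¬x) x = ⊥-elim (¬x x)

  𝟙-no : ∀ {p} {P : Set p} (d : Dec P) → ¬ P → 𝟙 d ≡ 0ℤ
  𝟙-no (yes x) ¬x = ⊥-elim (¬x x)
  𝟙-no (no _) ¬x = refl

  𝟙-true : ∀ {p} {P : Set p} (d : Dec P) → 𝟙 d ≡ 1ℤ → P
  𝟙-true (yes x) e = x
  𝟙-true (no _) ()

  module _ {A : Set} where

    ∑-map : ∀ {B : Set} (h : A → B) xs (f : B → ℤ) → ∑ (map h xs) f ≡ ∑ xs (λ x → f (h x))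
    ∑-map h [] f = refl
    ∑-map h (x ∷ xs) f = cong (λ z → f (h x) + z) (∑-map h xs f)

    ∑-filter : ∀ {P : A → Set} (P? : Decidable P) xs (f : A → ℤ) →
      ∑ (filter P? xs) f ≡ ∑ xs (λ x → 𝟙 (P? x) * f x)
    ∑-filter P? [] f = refl
    ∑-filter P? (x ∷ xs) f with P? x
    ... | yes _ = cong₂ _+_ (sym (*-identityˡ (f x))) (∑-filter P? xs f)
    ... | no _ = trans (∑-filter P? xs f) (sym (trans (cong (λ z → z + ∑ xs (λ x → 𝟙 (P? x) * f x)) (*-zeroˡ (f x))) (+-identityˡ _)))

    ∑-filter-≤ : ∀ {P : A → Set} (P? : Decidable P) xs {f : A → ℤ} → (∀ x → 0ℤ ≤ f x) →
      ∑ (filter P? xs) f ≤ ∑ xs f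
    ∑-filter-≤ P? xs {f} h = subst (_≤ ∑ xs f) (sym (∑-filter P? xs f))
      (∑-mono xs λ x → bit-*≤ (𝟙-bit (P? x)) (h x) ≤-refl)

    ∑-unique-≤1 : ∀ {xs} {f : A → ℤ} → Unique xs → (∀ x → Bit (f x)) →
      (∀ {x y} → x ∈ xs → y ∈ xs → f x ≡ 1ℤ → f y ≡ 1ℤ → x ≡ y) → ∑ xs f ≤ 1ℤ
    ∑-unique-≤1 {[]} _ _ _ = 0≤+
    ∑-unique-≤1 {x ∷ xs} {f} (x∉ ∷ u) b h with b x
    ... | inj₁ e = subst (λ z → z + ∑ xs f ≤ 1ℤ) (sym e)
          (subst (_≤ 1ℤ) (sym (+-identityˡ _)) (∑-unique-≤1 u b λ p q → h (there p) (there q)))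
    ... | inj₂ e = subst (f x + ∑ xs f ≤_) (+-identityʳ 1ℤ) (+-mono-≤ (≤-reflexive e)
          (subst (∑ xs f ≤_) (∑-zero xs) (∑-mono∈ xs λ y y∈ → zero-at y y∈ (b y))))
      where
      zero-at : ∀ y → y ∈ xs → Bit (f y) → f y ≤ 0ℤ
      zero-at y y∈ (inj₁ e′) = ≤-reflexive e′
      zero-at y y∈ (inj₂ e′) = ⊥-elim (All.lookup x∉ y∈ (h (here refl) (there y∈) e e′))

    ∑-≥two : ∀ xs {f : A → ℤ} → (∀ x → 0ℤ ≤ f x) → ∀ {x y} → x ∈ xs → y ∈ xs → x ≢ y → f x + f y ≤ ∑ xs f
    ∑-≥two (z ∷ xs) h (here refl) (here refl) x≢y = ⊥-elim (x≢y refl)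
    ∑-≥two (z ∷ xs) {f} h (here refl) (there q) x≢y = +-monoʳ-≤ (f z) (∑-≥term xs h q)
    ∑-≥two (z ∷ xs) {f} h {x} (there p) (here refl) x≢y =
      subst (_≤ f z + ∑ xs f) (+-comm (f z) (f x)) (+-monoʳ-≤ (f z) (∑-≥term xs h p))
    ∑-≥two (z ∷ xs) {f} h (there p) (there q) x≢y =
      ≤-trans (∑-≥two xs h p q x≢y) (cert (h z) (+-comm (f z) (∑ xs f)))

  ∑-cartesianProduct : ∀ {A B : Set} (xs : List A) (ys : List B) (f : A × B → ℤ) →
    ∑ (cartesianProduct xs ys) f ≡ ∑ xs (λ x → ∑ ys (λ y → f (x , y)))
  ∑-cartesianProduct [] ys f = refl
  ∑-cartesianProduct (x ∷ xs) ys f =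
    trans (∑-++ (map (λ y → (x , y)) ys) (cartesianProduct xs ys) f) (cong₂ _+_ (∑-map (λ y → (x , y)) ys f) (∑-cartesianProduct xs ys f))

  ∑-Fin-𝟙 : ∀ {k} (x : Fin k) → ∑ (allFin k) (λ i → 𝟙 (x Fin.≟ i)) ≡ 1ℤ
  ∑-Fin-𝟙 {k} x = ≤-antisym
    (∑-unique-≤1 (allFin⁺ k) (λ i → 𝟙-bit (x Fin.≟ i)) λ {i} {j} _ _ p q → trans (sym (𝟙-true (x Fin.≟ i) p)) (𝟙-true (x Fin.≟ j) q))
    (subst (_≤ ∑ (allFin k) (λ i → 𝟙 (x Fin.≟ i))) (𝟙-yes (x Fin.≟ x) refl)
      (∑-≥term (allFin k) (λ i → bit≥0 (𝟙-bit (x Fin.≟ i))) (∈-allFin x)))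

  ∑-Fin-pick : ∀ {k} (x : Fin k) (f : Fin k → ℤ) → ∑ (allFin k) (λ i → 𝟙 (x Fin.≟ i) * f i) ≡ f x
  ∑-Fin-pick {k} x f = trans (∑-lin1 (allFin k) (f x) (λ i → 𝟙 (x Fin.≟ i)) same)
    (trans (cong (f x *_) (∑-Fin-𝟙 x)) (*-identityʳ (f x)))
    where
    same : ∀ i → 𝟙 (x Fin.≟ i) * f i ≡ f x * 𝟙 (x Fin.≟ i)
    same i with x Fin.≟ i
    ... | yes refl = *-comm 1ℤ (f x)
    ... | no _ = trans (*-zeroˡ (f i)) (sym (*-zeroʳ (f x)))

  -- Equals t (m - t) where t is the sum of f and m the length of the list, so a small
  -- deviation makes a 0/1-valued f almost constant.
  deviation : ∀ {A : Set} → List A → (A → ℤ) → ℤ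
  deviation xs f = ∑ xs λ x → ∑ xs λ x′ → f x * (1ℤ - f x′)

  count : ∀ {A : Set} → List A → ℤ
  count xs = ∑ xs (λ _ → 1ℤ)

  count≥0 : ∀ {A : Set} (xs : List A) → 0ℤ ≤ count xs
  count≥0 xs = ∑-≥0 xs λ _ → 0≤+

  deviation-value : ∀ {A : Set} (xs : List A) (f : A → ℤ) → deviation xs f ≡ ∑ xs f * (count xs - ∑ xs f)
  deviation-value xs f = trans
    (∑-lin1 xs (count xs - ∑ xs f) f λ x →
      trans (∑-lin2 xs (f x) (λ _ → 1ℤ) (- f x) f λ x′ → alg (f x) (f x′)) (alg₁ (f x) (count xs) (∑ xs f)))
    (*-comm (count xs - ∑ xs f) (∑ xs f))
    where
    alg : ∀ x y → x * (1ℤ - y) ≡ x * 1ℤ + (- x) * y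
    alg = solve-∀
    alg₁ : ∀ x m t → x * m + (- x) * t ≡ (m - t) * x
    alg₁ = solve-∀

  -- If `x` is 1 and `z` is 0, the drop from 1 to 0 occurs either between `x` and `y` or between `y`
  -- and `z`.
  bit-triangle : ∀ {x y z} → Bit x → Bit y → Bit z → x * (1ℤ - z) ≤ x * (1ℤ - y) + y * (1ℤ - z)
  bit-triangle (inj₁ refl) (inj₁ refl) (inj₁ refl) = 0≤+
  bit-triangle (inj₁ refl) (inj₁ refl) (inj₂ refl) = 0≤+
  bit-triangle (inj₁ refl) (inj₂ refl) (inj₁ refl) = 0≤+
  bit-triangle (inj₁ refl) (inj₂ refl) (inj₂ refl) = 0≤+
  bit-triangle (inj₂ refl) (inj₁ refl) (inj₁ refl) = ≤-refl
  bit-triangle (inj₂ refl) (inj₁ refl) (inj₂ refl) = 0≤+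
  bit-triangle (inj₂ refl) (inj₂ refl) (inj₁ refl) = ≤-refl
  bit-triangle (inj₂ refl) (inj₂ refl) (inj₂ refl) = ≤-refl

  -- Go from `(x, y)` to `(x′, y′)` through `(x, y′)`. The first leg leaves `x′` free and the second
  -- leaves `y` free, whence the factors `count xs` and `count ys`.
  deviation-product : ∀ {A B : Set} (xs : List A) (ys : List B) (F : A → B → ℤ) → (∀ x y → Bit (F x y)) →
    deviation (cartesianProduct xs ys) (λ p → F (proj₁ p) (proj₂ p)) ≤
    count xs * ∑ xs (λ x → deviation ys (F x)) + count ys * ∑ ys (λ y → deviation xs (λ x → F x y))
  deviation-product {A} {B} xs ys F bit = subst₂ _≤_ (sym lhs) rhs
    (∑-mono xs λ x → ∑-mono ys λ y → ∑-mono xs λ x′ → ∑-mono ys λ y′ →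
      bit-triangle (bit x y) (bit x y′) (bit x′ y′))
    where
    lhs : deviation (cartesianProduct xs ys) (λ p → F (proj₁ p) (proj₂ p)) ≡
          ∑ xs λ x → ∑ ys λ y → ∑ xs λ x′ → ∑ ys λ y′ → F x y * (1ℤ - F x′ y′)
    lhs = trans (∑-cartesianProduct xs ys _) (∑-cong xs λ x → ∑-cong ys λ y → ∑-cartesianProduct xs ys _)
    split : ∀ x y → (∑ xs λ x′ → ∑ ys λ y′ → F x y * (1ℤ - F x y′) + F x y′ * (1ℤ - F x′ y′)) ≡
            count xs * (∑ ys λ y′ → F x y * (1ℤ - F x y′)) + 1ℤ * (∑ xs λ x′ → ∑ ys λ y′ → F x y′ * (1ℤ - F x′ y′))
    split x y = trans (∑-cong xs λ x′ → ∑-+ ys (λ y′ → F x y * (1ℤ - F x y′)) (λ y′ → F x y′ * (1ℤ - F x′ y′)))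
      (trans (∑-+ xs (λ _ → ∑ ys λ y′ → F x y * (1ℤ - F x y′)) (λ x′ → ∑ ys λ y′ → F x y′ * (1ℤ - F x′ y′)))
        (cong₂ _+_ (trans (∑-const xs (∑ ys λ y′ → F x y * (1ℤ - F x y′))) (*-comm _ (count xs))) (sym (*-identityˡ _))))
    split′ : ∀ x → (∑ ys λ y → ∑ xs λ x′ → ∑ ys λ y′ → F x y * (1ℤ - F x y′) + F x y′ * (1ℤ - F x′ y′)) ≡
            count xs * deviation ys (F x) + count ys * (∑ xs λ x′ → ∑ ys λ y′ → F x y′ * (1ℤ - F x′ y′))
    split′ x = trans (∑-cong ys (split x))
      (trans (∑-lin2 ys (count xs) (λ y → ∑ ys λ y′ → F x y * (1ℤ - F x y′)) 1ℤ (λ _ → ∑ xs λ x′ → ∑ ys λ y′ → F x y′ * (1ℤ - F x′ y′)) λ y → refl)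
        (cong (λ z → count xs * deviation ys (F x) + z)
          (trans (*-identityˡ _) (trans (∑-const ys _) (*-comm _ (count ys))))))
    rhs : (∑ xs λ x → ∑ ys λ y → ∑ xs λ x′ → ∑ ys λ y′ → F x y * (1ℤ - F x y′) + F x y′ * (1ℤ - F x′ y′)) ≡
          count xs * ∑ xs (λ x → deviation ys (F x)) + count ys * ∑ ys (λ y → deviation xs (λ x → F x y))
    rhs = trans (∑-lin2 xs (count xs) (λ x → deviation ys (F x)) (count ys) (λ x → ∑ xs λ x′ → ∑ ys λ y′ → F x y′ * (1ℤ - F x′ y′)) split′)
      (cong (λ z → count xs * ∑ xs (λ x → deviation ys (F x)) + count ys * z)
        (trans (∑-cong xs λ x → ∑-swap xs ys (λ x′ y′ → F x y′ * (1ℤ - F x′ y′)))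
          (∑-swap xs ys (λ x y′ → ∑ xs λ x′ → F x y′ * (1ℤ - F x′ y′)))))

  -- `deviation-product` is applied twice. The left side is the deviation of `f` over the whole box
  -- by `deviation-value`, so near constancy along the three directions drives `t` towards 0 or the
  -- volume.
  deviation-box : ∀ {A B C : Set} (xs : List A) (ys : List B) (zs : List C) (f : A → B → C → ℤ) →
    (∀ x y z → Bit (f x y z)) → ∀ t → t ≡ (∑ xs λ x → ∑ ys λ y → ∑ zs λ z → f x y z) →
    t * (count xs * count ys * count zs - t) ≤
    count xs * count ys * (∑ xs λ x → ∑ ys λ y → deviation zs (f x y))
    + count xs * count zs * (∑ xs λ x → ∑ zs λ z → deviation ys (λ y → f x y z))
    + count ys * count zs * (∑ ys λ y → ∑ zs λ z → deviation xs (λ x → f x y z))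
  deviation-box {A} {B} {C} xs ys zs f bit t refl = subst (_≤ total) value (≤-trans step
      (alg (count xs) (count ys) (count zs) dx e g h (count≥0 xs) dx≤))
    where
    e g h total : ℤ
    e = ∑ xs λ x → ∑ ys λ y → deviation zs (f x y)
    g = ∑ xs λ x → ∑ zs λ z → deviation ys (λ y → f x y z)
    h = ∑ ys λ y → ∑ zs λ z → deviation xs (λ x → f x y z)
    total = count xs * count ys * e + count xs * count zs * g + count ys * count zs * h
    yz = cartesianProduct ys zs
    F : A → B × C → ℤ
    F x p = f x (proj₁ p) (proj₂ p)
    count-yz : count yz ≡ count ys * count zs
    count-yz = trans (∑-cartesianProduct ys zs (λ _ → 1ℤ)) (trans (∑-const ys (count zs)) (*-comm (count zs) (count ys)))
    alg : ∀ x y z d e g h → 0ℤ ≤ x → d ≤ y * e + z * g → x * d + y * z * h ≤ x * y * e + x * z * g + y * z * h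
    alg x y z d e g h px hd = cert (px ⊗ le⇒0≤ hd) (solve (x ∷ y ∷ z ∷ d ∷ e ∷ g ∷ h ∷ []))
    value : deviation (cartesianProduct xs yz) (λ p → F (proj₁ p) (proj₂ p)) ≡
      (∑ xs λ x → ∑ ys λ y → ∑ zs λ z → f x y z) * (count xs * count ys * count zs - (∑ xs λ x → ∑ ys λ y → ∑ zs λ z → f x y z))
    value = trans (deviation-value (cartesianProduct xs yz) (λ p → F (proj₁ p) (proj₂ p)))
      (cong₂ (λ s m → s * (m - s))
        (trans (∑-cartesianProduct xs yz _) (∑-cong xs λ x → ∑-cartesianProduct ys zs _))
        (trans (∑-cartesianProduct xs yz (λ _ → 1ℤ)) (trans (∑-const xs (count yz)) (trans (cong (_* count xs) count-yz) (alg₁ (count xs) (count ys) (count zs))))))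
      where
      alg₁ : ∀ x y z → y * z * x ≡ x * y * z
      alg₁ = solve-∀
    dx : ℤ
    dx = ∑ xs λ x → deviation yz (F x)
    dx≤ : dx ≤ count ys * e + count zs * g
    dx≤ = subst (dx ≤_)
      (∑-lin2 xs (count ys) (λ x → ∑ ys λ y → deviation zs (f x y)) (count zs) (λ x → ∑ zs λ z → deviation ys (λ y → f x y z)) λ x → refl)
      (∑-mono xs λ x → deviation-product ys zs (f x) (bit x))
    step : deviation (cartesianProduct xs yz) (λ p → F (proj₁ p) (proj₂ p)) ≤ count xs * dx + count ys * count zs * h
    step = subst₂ (λ m s → deviation (cartesianProduct xs yz) (λ p → F (proj₁ p) (proj₂ p)) ≤ count xs * dx + m * s)
      count-yz (∑-cartesianProduct ys zs λ p → deviation xs λ x → F x p)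
      (deviation-product xs yz F λ x p → bit x (proj₁ p) (proj₂ p))

  ∑-cong∈ : ∀ {A : Set} (xs : List A) {f g : A → ℤ} → (∀ x → x ∈ xs → f x ≡ g x) → ∑ xs f ≡ ∑ xs g
  ∑-cong∈ xs h = ≤-antisym (∑-mono∈ xs λ x p → ≤-reflexive (h x p)) (∑-mono∈ xs λ x p → ≤-reflexive (sym (h x p)))

  -- Colour classes and the edge counts of boxes

  spread-arith : ∀ k n G P E I → 1ℤ ≤ k → 0ℤ ≤ E → + 3 * (k * k) * (G * G) ≤ P → P * E ≤ n * n →
    + 3 * (k * k) * (G * G) * I ≤ + 2 * (n * n) → G * G * (k * E + k * k * I) ≤ n * n
  spread-arith k n G P E I k≥1 E≥0 hP hE hI = cancel (+ 3 * (k * k)) (1≤⇒0< (1≤* {+ 3} {k * k} (+≤+ (s≤s z≤n)) (1≤* k≥1 k≥1)))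
    (cert (1≤⇒0≤ k≥1 ⊗ le⇒0≤ hE ⊕ 1≤⇒0≤ k≥1 ⊗ E≥0 ⊗ le⇒0≤ hP ⊕ 1≤⇒0≤ k≥1 ⊗ 1≤⇒0≤ k≥1 ⊗ le⇒0≤ hI
          ⊕ 1≤⇒0≤ k≥1 ⊗ le⇒0≤ k≥1 ⊗ sq n)
      (solve (k ∷ n ∷ G ∷ P ∷ E ∷ I ∷ [])))

  box-arith : ∀ k n G P B I x → + 3 ≤ k → 0ℤ ≤ n → 0ℤ ≤ B → + 3 * (k * k) * (G * G) ≤ P → P * B ≤ n * n * n * n →
    + 3 * (k * k) * (G * G) * I ≤ + 2 * (n * n) → x ≤ + 3 * (n * n) * (B + n * n * I) → G * G * x ≤ n * n * n * (n * n * n)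
  box-arith k n G P B I x k≥3 n≥0 B≥0 hP hB hI hx = cancel (+ 3 * (k * k)) (1≤⇒0< (1≤* {+ 3} {k * k} (+≤+ (s≤s z≤n)) (1≤* k≥1 k≥1)))
    (cert (0≤+ {3} ⊗ (k≥0 ⊗ k≥0) ⊗ sq G ⊗ le⇒0≤ hx
          ⊕ 0≤+ {3} ⊗ (n≥0 ⊗ n≥0) ⊗ (le⇒0≤ hB ⊕ le⇒0≤ hP ⊗ B≥0 ⊕ n≥0 ⊗ n≥0 ⊗ le⇒0≤ hI)
          ⊕ (n≥0 ⊗ n≥0 ⊗ n≥0) ⊗ (n≥0 ⊗ n≥0 ⊗ n≥0) ⊗ (0≤+ {3} ⊗ (le⇒0≤ k≥3 ⊗ (le⇒0≤ k≥3 ⊕ 0≤+ {6}) ⊕ 0≤+ {6})))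
      (solve (k ∷ n ∷ G ∷ P ∷ B ∷ I ∷ x ∷ [])))
    where
    k≥1 = ≤-trans (+≤+ (s≤s z≤n)) k≥3
    k≥0 = 1≤⇒0≤ k≥1

  -- `φ` also places the uncoloured vertices, and `ρ` marks them. An adjacent pair inside a class
  -- must contain a marked vertex, and `I` bounds the number of such ordered pairs.
  module Classes {A : Set} (conf : Config A) (K : ℕ) (k : ℤ) (k≡K : k ≡ + K) (k≥3 : + 3 ≤ k) (n≥1 : 1ℤ ≤ Counting.n conf)
    (φ : A → Fin K) (ρ : A → ℤ) (ρ≥0 : ∀ u → 0ℤ ≤ ρ u)
    (φ-proper : ∀ u u′ → φ u ≡ φ u′ → Config.γ conf u u′ ≤ ρ u + ρ u′) where
    open Config conf
    open Counting conf
    open Errors conf k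

    colours : List (Fin K)
    colours = allFin K

    C : Fin K → List A
    C i = filter (λ u → φ u Fin.≟ i) V

    ν : Fin K → ℤ
    ν i = count (C i)

    cnt : Fin K → Fin K → Fin K → ℤ
    cnt i j l = ∑ (C i) λ u → ∑ (C j) λ v → ∑ (C l) λ w → τ w u v

    r I Q : ℤ
    r = S ρ
    I = + 2 * (n * r)
    Q = B + n * n * I

    ν≥0 : ∀ i → 0ℤ ≤ ν i
    ν≥0 i = count≥0 (C i)

    k≥1 : 1ℤ ≤ k
    k≥1 = ≤-trans (+≤+ (s≤s z≤n)) k≥3

    k≥0 : 0ℤ ≤ k
    k≥0 = 1≤⇒0≤ k≥1

    r≥0 : 0ℤ ≤ r
    r≥0 = ∑-≥0 V ρ≥0

    I≥0 : 0ℤ ≤ I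
    I≥0 = 0≤+ {2} ⊗ (n≥0 ⊗ r≥0)

    C-colour : ∀ {i u} → u ∈ C i → φ u ≡ i
    C-colour {i} p = proj₂ (∈-filter⁻ (λ u → φ u Fin.≟ i) {xs = V} p)

    C-≤ : ∀ i {f : A → ℤ} → (∀ u → 0ℤ ≤ f u) → ∑ (C i) f ≤ S f
    C-≤ i = ∑-filter-≤ (λ u → φ u Fin.≟ i) V

    ν≤n : ∀ i → ν i ≤ n
    ν≤n i = C-≤ i λ _ → 0≤+

    S-classes : ∀ f → S f ≡ ∑ colours λ i → ∑ (C i) f
    S-classes f = sym (trans (∑-cong colours λ i → ∑-filter (λ u → φ u Fin.≟ i) V f)
      (trans (∑-swap colours V (λ i u → 𝟙 (φ u Fin.≟ i) * f u)) (∑-cong V λ u → ∑-Fin-pick (φ u) (λ _ → f u))))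

    ν-𝟙 : ∀ i → ν i ≡ S λ u → 𝟙 (φ u Fin.≟ i)
    ν-𝟙 i = trans (∑-filter (λ u → φ u Fin.≟ i) V (λ _ → 1ℤ)) (∑-cong V λ u → *-identityʳ (𝟙 (φ u Fin.≟ i)))

    Σρρ : (S λ u → S λ u′ → ρ u + ρ u′) ≡ I
    Σρρ = trans (∑-cong V λ u → trans (∑-+ V (λ _ → ρ u) ρ) (cong (_+ r) (S-const (ρ u))))
      (trans (∑-+ V (λ u → ρ u * n) (λ _ → r)) (trans (cong₂ _+_ (∑-lin1 V n ρ λ u → *-comm (ρ u) n) (S-const r)) (alg n r)))
      where alg : ∀ n r → n * r + r * n ≡ + 2 * (n * r)
            alg = solve-∀

    within-class : ∀ i → (∑ (C i) λ u → ∑ (C i) λ u′ → γ u u′) ≤ I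
    within-class i = ≤-trans
      (∑-mono∈ (C i) λ u p → ∑-mono∈ (C i) λ u′ p′ → φ-proper u u′ (trans (C-colour p) (sym (C-colour p′))))
      (≤-trans (∑-mono (C i) λ u → C-≤ i λ u′ → ρ≥0 u ⊕ ρ≥0 u′)
        (≤-trans (C-≤ i λ u → ∑-≥0 V λ u′ → ρ≥0 u ⊕ ρ≥0 u′) (≤-reflexive Σρρ)))

    same : A → A → ℤ
    same u u′ = 𝟙 (φ u′ Fin.≟ φ u)

    inside cross : ℤ
    inside = S λ u → S λ u′ → γ u u′ * same u u′
    cross = S λ u → S λ u′ → γ̄ u u′ * (1ℤ - same u u′)

    inside≤I : inside ≤ I
    inside≤I = subst (inside ≤_) Σρρ (∑-mono V λ u → ∑-mono V λ u′ → point u u′)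
      where
      point : ∀ u u′ → γ u u′ * same u u′ ≤ ρ u + ρ u′
      point u u′ with φ u′ Fin.≟ φ u
      ... | yes e = subst (_≤ ρ u + ρ u′) (sym (*-identityʳ (γ u u′))) (φ-proper u u′ (sym e))
      ... | no _ = subst (_≤ ρ u + ρ u′) (sym (*-zeroʳ (γ u u′))) (ρ≥0 u ⊕ ρ≥0 u′)

    cross≥0 : 0ℤ ≤ cross
    cross≥0 = ∑-≥0 V λ u → ∑-≥0 V λ u′ → γ̄≥0 u u′ ⊗ bit≥0 (bit-co (𝟙-bit (φ u′ Fin.≟ φ u)))

    Σν : ∑ colours ν ≡ n
    Σν = sym (S-classes (λ _ → 1ℤ))

    Σν² : ∑ colours (λ i → ν i * ν i) ≡ S λ u → S λ u′ → same u u′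
    Σν² = sym (trans (S-classes (λ u → S λ u′ → same u u′)) (∑-cong colours λ i →
      trans (∑-cong∈ (C i) λ u p → trans (cong (λ j → S λ u′ → 𝟙 (φ u′ Fin.≟ j)) (C-colour p)) (sym (ν-𝟙 i)))
        (∑-const (C i) (ν i))))

    spread : ℤ
    spread = ∑ colours λ i → (k * ν i - n) * (k * ν i - n)

    count-colours : ∑ colours (λ _ → 1ℤ) ≡ k
    count-colours = trans (trans (∑-length colours) (cong (λ m → + m) (length-tabulate (λ i → i)))) (sym k≡K)

    -- Count nonadjacent pairs. There are `n² / k + spread / k²` pairs within classes, `n² / k`
    -- being the minimum for `k` classes. So unequal class sizes and nonadjacent pairs across
    -- classes share one budget: the excess of `S c` over `n² / k`, enlarged by the adjacent pairs
    -- inside classes.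
    spread-identity : k * k * cross + spread ≡ k * (k * S c - n * n) + k * k * inside
    spread-identity = alg k n cross spread (S c) inside (S λ u → S λ u′ → same u u′) cross≡ spread≡
      where
      cross≡ : cross ≡ S c - (S λ u → S λ u′ → same u u′) + inside
      cross≡ = trans (∑-lin3 V 1ℤ c -1ℤ (λ u → S λ u′ → same u u′) 1ℤ (λ u → S λ u′ → γ u u′ * same u u′) λ u →
        ∑-lin3 V 1ℤ (γ̄ u) -1ℤ (same u) 1ℤ (λ u′ → γ u u′ * same u u′) λ u′ → alg₁ (γ u u′) (same u u′))
        (alg₂ (S c) (S λ u → S λ u′ → same u u′) inside)
        where
        alg₁ : ∀ y s → (1ℤ - y) * (1ℤ - s) ≡ 1ℤ * (1ℤ - y) + -1ℤ * s + 1ℤ * (y * s)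
        alg₁ = solve-∀
        alg₂ : ∀ x y z → 1ℤ * x + -1ℤ * y + 1ℤ * z ≡ x - y + z
        alg₂ = solve-∀
      spread≡ : spread ≡ k * k * (S λ u → S λ u′ → same u u′) + (- (+ 2 * k * n)) * n + n * n * k
      spread≡ = trans (∑-lin3 colours (k * k) (λ i → ν i * ν i) (- (+ 2 * k * n)) ν (n * n) (λ _ → 1ℤ) λ i → alg₁ k (ν i) n)
        (cong₂ _+_ (cong₂ (λ x y → k * k * x + (- (+ 2 * k * n)) * y) Σν² Σν) (cong (n * n *_) count-colours))
        where
        alg₁ : ∀ k x n → (k * x - n) * (k * x - n) ≡ k * k * (x * x) + (- (+ 2 * k * n)) * x + n * n * 1ℤ
        alg₁ = solve-∀
      alg : ∀ k n x s c i e → x ≡ c - e + i → s ≡ k * k * e + (- (+ 2 * k * n)) * n + n * n * k →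
        k * k * x + s ≡ k * (k * c - n * n) + k * k * i
      alg k n x s c i e refl refl = solve (k ∷ n ∷ c ∷ i ∷ e ∷ [])

    kΣc≤ : k * S c - n * n ≤ E
    kΣc≤ = subst (_≤ E) (trans (∑-lin2 V k c (- n) (λ _ → 1ℤ) λ u → alg k (c u) n) (alg₁ k (S c) n n))
             (∑-mono V λ u → ≤abs (k * c u - n))
      where
      alg : ∀ k x n → k * x - n ≡ k * x + (- n) * 1ℤ
      alg = solve-∀
      alg₁ : ∀ k x n y → k * x + (- n) * y ≡ k * x - n * y
      alg₁ = solve-∀

    spread-total : k * k * cross + spread ≤ k * E + k * k * I
    spread-total = subst (_≤ k * E + k * k * I) (sym spread-identity)
      (alg k (k * S c - n * n) E inside I k≥0 kΣc≤ inside≤I)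
      where
      alg : ∀ k x e i j → 0ℤ ≤ k → x ≤ e → i ≤ j → k * x + k * k * i ≤ k * e + k * k * j
      alg k x e i j pk h h′ = cert (pk ⊗ le⇒0≤ h ⊕ pk ⊗ pk ⊗ le⇒0≤ h′) (solve (k ∷ x ∷ e ∷ i ∷ j ∷ []))

    spread≥0 : 0ℤ ≤ spread
    spread≥0 = ∑-≥0 colours λ i → sq (k * ν i - n)

    -- For nonadjacent `z` and `z′` a change of `τ` from 1 to 0 is a term of `B`. At most `I` pairs
    -- of the class are adjacent; they are charged once for each `x` and `y`, which gives the `n² I`
    -- in `Q`.
    codegree-deviation : ∀ i j l → (∑ (C i) λ x → ∑ (C j) λ y → deviation (C l) (λ z → τ z x y)) ≤ Q
    codegree-deviation i j l = ≤-trans (∑-mono (C i) λ x → ∑-mono (C j) λ y → dev≤ x y)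
      (≤-trans (∑-mono (C i) λ x → C-≤ j (bound≥0 x))
        (≤-trans (C-≤ i λ x → ∑-≥0 V (bound≥0 x)) (≤-reflexive total)))
      where
      q : A → A → ℤ
      q x y = S λ z → S λ z′ → τ z x y * (γ̄ z z′ * (1ℤ - τ z′ x y))
      q-term≥0 : ∀ x y z z′ → 0ℤ ≤ τ z x y * (γ̄ z z′ * (1ℤ - τ z′ x y))
      q-term≥0 x y z z′ = τ≥0 z x y ⊗ (γ̄≥0 z z′ ⊗ bit≥0 (bit-co (τ-bit z′ x y)))
      bound≥0 : ∀ x y → 0ℤ ≤ q x y + I
      bound≥0 x y = (∑-≥0 V λ z → ∑-≥0 V λ z′ → q-term≥0 x y z z′) ⊕ I≥0
      total : (S λ x → S λ y → q x y + I) ≡ Q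
      total = trans (∑-cong V λ x → trans (∑-+ V (q x) (λ _ → I)) (cong (λ w → S (q x) + w) (S-const I)))
        (trans (∑-+ V (λ x → S (q x)) (λ _ → I * n)) (cong (λ w → B + w) (trans (S-const (I * n)) (alg I n))))
        where alg : ∀ x y → x * y * y ≡ y * y * x
              alg = solve-∀
      dev≤ : ∀ x y → deviation (C l) (λ z → τ z x y) ≤ q x y + I
      dev≤ x y = ≤-trans (∑-mono (C l) λ z → ∑-mono (C l) λ z′ →
            alg (τ z x y) (τ z′ x y) (γ z z′) (τ≥0 z x y) (bit≥0 (bit-co (τ-bit z x y))) (τ≥0 z′ x y) (bit≥0 (bit-co (τ-bit z′ x y))) (γ≥0 z z′))
        (subst (_≤ q x y + I)
          (sym (trans (∑-cong (C l) λ z → ∑-+ (C l) (λ z′ → τ z x y * (γ̄ z z′ * (1ℤ - τ z′ x y))) (γ z))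
            (∑-+ (C l) (λ z → ∑ (C l) λ z′ → τ z x y * (γ̄ z z′ * (1ℤ - τ z′ x y))) (λ z → ∑ (C l) (γ z)))))
          (+-mono-≤ (≤-trans (∑-mono (C l) λ z → C-≤ l (q-term≥0 x y z)) (C-≤ l λ z → ∑-≥0 V (q-term≥0 x y z))) (within-class l)))
        where
        alg : ∀ t t′ y → 0ℤ ≤ t → 0ℤ ≤ 1ℤ - t → 0ℤ ≤ t′ → 0ℤ ≤ 1ℤ - t′ → 0ℤ ≤ y →
          t * (1ℤ - t′) ≤ t * ((1ℤ - y) * (1ℤ - t′)) + y
        alg t t′ y p p̄ p′ p̄′ py = cert (py ⊗ (p̄ ⊗ p̄′ ⊕ p′)) (solve (t ∷ t′ ∷ y ∷ []))

    Q≥0 : 0ℤ ≤ Q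
    Q≥0 = B≥0 ⊕ (n≥0 ⊗ n≥0) ⊗ I≥0

    vol : Fin K → Fin K → Fin K → ℤ
    vol i j l = ν i * ν j * ν l

    τ-rotate : ∀ u v w → τ w u v ≡ τ u v w
    τ-rotate u v w = trans (τ-swap₁₂ w u v) (τ-swap₂₃ u w v)

    τ-swap₁₃ : ∀ u v w → τ w u v ≡ τ v u w
    τ-swap₁₃ u v w = trans (τ-swap₂₃ w u v) (trans (τ-swap₁₂ w v u) (τ-swap₂₃ v w u))

    -- By the symmetry of `τ` the same bound `codegree-deviation` serves in all three directions of
    -- the box.
    box : ∀ i j l → cnt i j l * (vol i j l - cnt i j l) ≤ + 3 * (n * n) * Q
    box i j l = ≤-trans (deviation-box (C i) (C j) (C l) (λ u v w → τ w u v) (λ u v w → τ-bit w u v) (cnt i j l) refl)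
      (alg (ν i) (ν j) (ν l) n _ _ _ Q (ν≥0 i) (ν≥0 j) (ν≥0 l) n≥0 (ν≤n i) (ν≤n j) (ν≤n l) Q≥0
        (codegree-deviation i j l)
        (subst (_≤ Q) (∑-cong (C i) λ x → ∑-cong (C l) λ z → ∑-cong (C j) λ y → ∑-cong (C j) λ y′ →
           cong₂ (λ p q → p * (1ℤ - q)) (sym (τ-swap₁₃ x y z)) (sym (τ-swap₁₃ x y′ z)))
           (codegree-deviation i l j))
        (subst (_≤ Q) (∑-cong (C j) λ y → ∑-cong (C l) λ z → ∑-cong (C i) λ x → ∑-cong (C i) λ x′ →
           cong₂ (λ p q → p * (1ℤ - q)) (sym (τ-rotate x y z)) (sym (τ-rotate x′ y z)))
           (codegree-deviation j l i)))
      where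
      mul : ∀ {x y n} → 0ℤ ≤ x → 0ℤ ≤ n → y ≤ n → x ≤ n → x * y ≤ n * n
      mul {x} {y} {n} px pn hy hx = cert (px ⊗ le⇒0≤ hy ⊕ pn ⊗ le⇒0≤ hx) (solve (x ∷ y ∷ n ∷ []))
      alg₁ : ∀ m n d q → 0ℤ ≤ m → 0ℤ ≤ q → d ≤ q → m ≤ n → m * d ≤ n * q
      alg₁ m n d q pm pq h h′ = cert (pm ⊗ le⇒0≤ h ⊕ pq ⊗ le⇒0≤ h′) (solve (m ∷ n ∷ d ∷ q ∷ []))
      alg₂ : ∀ n q → n * n * q + n * n * q + n * n * q ≡ + 3 * (n * n) * q
      alg₂ = solve-∀
      alg : ∀ x y z n d e g q → 0ℤ ≤ x → 0ℤ ≤ y → 0ℤ ≤ z → 0ℤ ≤ n → x ≤ n → y ≤ n → z ≤ n → 0ℤ ≤ q → d ≤ q → e ≤ q → g ≤ q →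
        x * y * d + x * z * e + y * z * g ≤ + 3 * (n * n) * q
      alg x y z n d e g q px py pz pn hx hy hz pq hd he hg = subst (x * y * d + x * z * e + y * z * g ≤_) (alg₂ n q)
        (+-mono-≤ (+-mono-≤ (alg₁ (x * y) (n * n) d q (px ⊗ py) pq hd (mul px pn hy hx))
          (alg₁ (x * z) (n * n) e q (px ⊗ pz) pq he (mul px pn hz hx)))
          (alg₁ (y * z) (n * n) g q (py ⊗ pz) pq hg (mul py pn hz hy)))

  -- Dense triples of classes form a Steiner triple system

  cross-arith : ∀ k n G M X s → 1ℤ ≤ k → 1ℤ ≤ G → 0ℤ ≤ X → 0ℤ ≤ s → k * k * X + s ≤ M → G * G * M ≤ n * n → G * X ≤ n * n
  cross-arith k n G M X s k≥1 G≥1 X≥0 s≥0 h hM = cert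
    (le⇒0≤ hM ⊕ sq G ⊗ le⇒0≤ h ⊕ sq G ⊗ s≥0 ⊕ 1≤⇒0≤ G≥1 ⊗ X≥0 ⊗ le⇒0≤ (1≤* {G} {k * k} G≥1 (1≤* k≥1 k≥1)))
    (solve (k ∷ n ∷ G ∷ M ∷ X ∷ s ∷ []))

  size-lower-arith : ∀ k n G M X s x → 0ℤ ≤ n → 0ℤ ≤ X → (k * x - n) * (k * x - n) ≤ s → k * k * X + s ≤ M → G * G * M ≤ n * n →
    G * (n - k * x) ≤ n
  size-lower-arith k n G M X s x n≥0 X≥0 hs h hM = sq-≤ n≥0 (alg k n G M X s x X≥0 hs h hM)
    where
    alg : ∀ k n G M X s x → 0ℤ ≤ X → (k * x - n) * (k * x - n) ≤ s → k * k * X + s ≤ M → G * G * M ≤ n * n →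
      G * (n - k * x) * (G * (n - k * x)) ≤ n * n
    alg k n G M X s x X≥0 hs h hM = cert (le⇒0≤ hM ⊕ sq G ⊗ (le⇒0≤ h ⊕ sq k ⊗ X≥0 ⊕ le⇒0≤ hs)) (solve (k ∷ n ∷ G ∷ M ∷ X ∷ s ∷ x ∷ []))

  half-arith : ∀ k n G x → + 2 ≤ G → 0ℤ ≤ n → G * (n - k * x) ≤ n → n ≤ + 2 * (k * x)
  half-arith k n G x G≥2 n≥0 h = cancel G (1≤⇒0< (≤-trans (+≤+ (s≤s z≤n)) G≥2))
    (cert (0≤+ {2} ⊗ le⇒0≤ h ⊕ le⇒0≤ G≥2 ⊗ n≥0) (solve (k ∷ n ∷ G ∷ x ∷ [])))

  pair-arith : ∀ k n x y → 0ℤ ≤ n → 0ℤ ≤ k → 0ℤ ≤ y → n ≤ + 2 * (k * x) → n ≤ + 2 * (k * y) → n * n ≤ + 4 * (k * k) * (x * y)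
  pair-arith k n x y n≥0 k≥0 y≥0 hx hy = cert (le⇒0≤ hx ⊗ (0≤+ {2} ⊗ (k≥0 ⊗ y≥0)) ⊕ n≥0 ⊗ le⇒0≤ hy) (solve (k ∷ n ∷ x ∷ y ∷ []))

  -- If every triple over a pair of classes were sparse, the total over the pair would be at most
  -- `k n³ / G`, that is at most `n³ / (16 k³)`. The codegrees demand about `x y n / k`, and
  -- `x y n / k` is at least `n³ / (4 k³)`.
  existence-arith : ∀ k n G x y Σc → 1ℤ ≤ k → 1ℤ ≤ n → 0ℤ ≤ G → + 16 * (k * k * k * k) ≤ G →
    G * (n * (x * y) - k * Σc) ≤ + 2 * (n * n * n) → G * Σc ≤ n * n * n * k → n * n ≤ + 4 * (k * k) * (x * y) → ⊥
  existence-arith k n G x y Σc k≥1 n≥1 G≥0 hG h₁ h₂ h₃ = <⇒≱ (1≤⇒0< (1≤* {n * n} {n} (1≤* n≥1 n≥1) n≥1))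
    (cert (0≤+ {4} ⊗ (k≥0 ⊗ k≥0) ⊗ (le⇒0≤ h₁ ⊕ k≥0 ⊗ le⇒0≤ h₂) ⊕ G≥0 ⊗ n≥0 ⊗ le⇒0≤ h₃ ⊕ le⇒0≤ hG ⊗ (n≥0 ⊗ n≥0 ⊗ n≥0)
           ⊕ (n≥0 ⊗ n≥0 ⊗ n≥0) ⊗ (le⇒0≤ (1≤* k≥1 k≥1) ⊗ (0≤+ {12} ⊗ (k≥0 ⊗ k≥0) ⊕ 0≤+ {4}) ⊕ 0≤+ {3}))
      (solve (k ∷ n ∷ G ∷ x ∷ y ∷ Σc ∷ [])))
    where
    k≥0 = 1≤⇒0≤ k≥1
    n≥0 = 1≤⇒0≤ n≥1

  -- Two nearly full triples over one pair would account for about `x y (z + z′)`, hence at least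
  -- about `2 x y n / k`, which is twice what the codegrees allow.
  uniqueness-arith : ∀ k n G x y z z′ c c′ Σc → 1ℤ ≤ k → 1ℤ ≤ n → + 2 ≤ G → + 16 * (k * k * k * k) ≤ G → 0ℤ ≤ x * y →
    G * (x * y * z - c) ≤ n * n * n → G * (x * y * z′ - c′) ≤ n * n * n → c + c′ ≤ Σc →
    G * (k * Σc - n * (x * y)) ≤ n * n * n → G * (n - k * z) ≤ n → G * (n - k * z′) ≤ n →
    n * n ≤ + 4 * (k * k) * (x * y) → ⊥
  uniqueness-arith k n G x y z z′ c c′ Σc k≥1 n≥1 G≥2 hG xy≥0 h₁ h₂ h₃ h₄ h₅ h₆ h₇ = <⇒≱ (1≤⇒0< (1≤* {n * n} {n} (1≤* n≥1 n≥1) n≥1))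
    (cert (0≤+ {4} ⊗ (k≥0 ⊗ k≥0) ⊗ (k≥0 ⊗ le⇒0≤ h₁ ⊕ k≥0 ⊗ le⇒0≤ h₂ ⊕ G≥0 ⊗ k≥0 ⊗ le⇒0≤ h₃ ⊕ le⇒0≤ h₄
              ⊕ xy≥0 ⊗ le⇒0≤ h₅ ⊕ xy≥0 ⊗ le⇒0≤ h₆)
           ⊕ le⇒0≤ G≥2 ⊗ n≥0 ⊗ le⇒0≤ h₇ ⊕ le⇒0≤ hG ⊗ (n≥0 ⊗ n≥0 ⊗ n≥0)
           ⊕ (n≥0 ⊗ n≥0 ⊗ n≥0) ⊗ (0≤+ {8} ⊗ (k≥0 ⊗ k≥0 ⊗ k≥0) ⊗ le⇒0≤ k≥1 ⊕ 0≤+ {4} ⊗ (k≥0 ⊗ k≥0) ⊗ le⇒0≤ kk≥1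
              ⊕ 0≤+ {4} ⊗ le⇒0≤ (1≤* kk≥1 kk≥1) ⊕ 0≤+ {1}))
      (solve (k ∷ n ∷ G ∷ x ∷ y ∷ z ∷ z′ ∷ c ∷ c′ ∷ Σc ∷ [])))
    where
    k≥0 = 1≤⇒0≤ k≥1
    n≥0 = 1≤⇒0≤ n≥1
    G≥0 = ≤-trans 0≤+ G≥2
    kk≥1 : 1ℤ ≤ k * k
    kk≥1 = 1≤* k≥1 k≥1

  diagonal-arith : ∀ k n G I c → 1ℤ ≤ k → 1ℤ ≤ n → 1ℤ ≤ G → + 3 * (k * k) * (G * G) * I ≤ + 2 * (n * n) →
    c ≤ n * I → n * n * n ≤ G * c → ⊥
  diagonal-arith k n G I c k≥1 n≥1 G≥1 h₁ h₂ h₃ = <⇒≱ (1≤⇒0< (1≤* {n * n} {n} (1≤* n≥1 n≥1) n≥1))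
    (cert (n≥0 ⊗ le⇒0≤ h₁ ⊕ 0≤+ {3} ⊗ (k≥0 ⊗ k≥0) ⊗ (G≥0 ⊗ G≥0) ⊗ le⇒0≤ h₂ ⊕ 0≤+ {3} ⊗ (k≥0 ⊗ k≥0) ⊗ G≥0 ⊗ le⇒0≤ h₃
           ⊕ 0≤+ {3} ⊗ le⇒0≤ (1≤* {k * k} {G} (1≤* k≥1 k≥1) G≥1) ⊗ (n≥0 ⊗ n≥0 ⊗ n≥0))
      (solve (k ∷ n ∷ G ∷ I ∷ c ∷ [])))
    where
    k≥0 = 1≤⇒0≤ k≥1
    n≥0 = 1≤⇒0≤ n≥1
    G≥0 = 1≤⇒0≤ G≥1

  module Triples {A : Set} (conf : Config A) (K : ℕ) (k : ℤ) (k≡K : k ≡ + K) (k≥3 : + 3 ≤ k) (n≥1 : 1ℤ ≤ Counting.n conf)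
    (φ : A → Fin K) (ρ : A → ℤ) (ρ≥0 : ∀ u → 0ℤ ≤ ρ u)
    (φ-proper : ∀ u u′ → φ u ≡ φ u′ → Config.γ conf u u′ ≤ ρ u + ρ u′) where
    open Config conf
    open Counting conf
    open Classes conf K k k≡K k≥3 n≥1 φ ρ ρ≥0 φ-proper
    open Errors conf k

    cnt-sum : ∀ i j → ∑ colours (cnt i j) ≡ ∑ (C i) λ u → ∑ (C j) λ v → a u v
    cnt-sum i j = trans (∑-swap colours (C i) (λ l u → ∑ (C j) λ v → ∑ (C l) λ w → τ w u v))
      (∑-cong (C i) λ u → trans (∑-swap colours (C j) (λ l v → ∑ (C l) λ w → τ w u v))
        (∑-cong (C j) λ v → sym (S-classes (λ w → τ w u v))))

    cnt≥0 : ∀ i j l → 0ℤ ≤ cnt i j l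
    cnt≥0 i j l = ∑-≥0 (C i) λ u → ∑-≥0 (C j) λ v → ∑-≥0 (C l) λ w → τ≥0 w u v

    count² : ∀ i j x → (∑ (C i) λ u → ∑ (C j) λ v → x) ≡ x * (ν i * ν j)
    count² i j x = trans (∑-cong (C i) λ u → ∑-const (C j) x) (trans (∑-const (C i) (x * ν j)) (alg x (ν j) (ν i)))
      where alg : ∀ x y z → x * y * z ≡ x * (z * y)
            alg = solve-∀

    cnt≤vol : ∀ i j l → cnt i j l ≤ vol i j l
    cnt≤vol i j l = ≤-trans (∑-mono (C i) λ u → ∑-mono (C j) λ v → ∑-mono (C l) λ w → bit≤1 (τ-bit w u v))
      (≤-reflexive (trans (count² i j (ν l)) (*-comm (ν l) (ν i * ν j))))

    cnt-swap₁₂ : ∀ i j l → cnt i j l ≡ cnt j i l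
    cnt-swap₁₂ i j l = trans (∑-swap (C i) (C j) (λ u v → ∑ (C l) λ w → τ w u v))
      (∑-cong (C j) λ v → ∑-cong (C i) λ u → ∑-cong (C l) λ w → τ-swap₂₃ w u v)

    cnt-swap₂₃ : ∀ i j l → cnt i j l ≡ cnt i l j
    cnt-swap₂₃ i j l = ∑-cong (C i) λ u → trans (∑-swap (C j) (C l) (λ v w → τ w u v))
      (∑-cong (C l) λ w → ∑-cong (C j) λ v → τ-swap₁₃ u v w)

    errors≤D : ∀ i j → (∑ (C i) λ u → ∑ (C j) λ v → γ u v * aErr u v) ≤ D
    errors≤D i j = ≤-trans (∑-mono (C i) λ u → C-≤ j λ v → γ≥0 u v ⊗ 0≤+) (C-≤ i λ u → ∑-≥0 V λ v → γ≥0 u v ⊗ 0≤+)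

    nonadjacent≤cross : ∀ {i j} → i ≢ j → (∑ (C i) λ u → ∑ (C j) λ v → γ̄ u v) ≤ cross
    nonadjacent≤cross {i} {j} i≢j = ≤-trans (∑-mono∈ (C i) λ u p → ∑-mono∈ (C j) λ v p′ → point u v p p′)
      (≤-trans (∑-mono (C i) λ u → C-≤ j (term≥0 u)) (C-≤ i λ u → ∑-≥0 V (term≥0 u)))
      where
      term≥0 : ∀ u v → 0ℤ ≤ γ̄ u v * (1ℤ - same u v)
      term≥0 u v = γ̄≥0 u v ⊗ bit≥0 (bit-co (𝟙-bit (φ v Fin.≟ φ u)))
      point : ∀ u v → u ∈ C i → v ∈ C j → γ̄ u v ≤ γ̄ u v * (1ℤ - same u v)
      point u v p p′ = ≤-reflexive (sym (trans (cong (λ z → γ̄ u v * (1ℤ - z))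
        (𝟙-no (φ v Fin.≟ φ u) λ e → i≢j (trans (sym (C-colour p)) (trans (sym e) (C-colour p′))))) (*-identityʳ (γ̄ u v))))

    -- An adjacent pair has codegree `n / k` up to its error in `D`, and a nonadjacent pair of
    -- vertices from different classes is counted by `cross`.
    pair-lower : ∀ {i j} → i ≢ j → n * (ν i * ν j) - k * ∑ colours (cnt i j) ≤ D + n * cross
    pair-lower {i} {j} i≢j = subst (λ z → n * (ν i * ν j) - k * z ≤ D + n * cross) (sym (cnt-sum i j))
      (alg n k (ν i * ν j) (∑ (C i) λ u → ∑ (C j) λ v → a u v) (∑ (C i) λ u → ∑ (C j) λ v → γ u v * aErr u v)
        (∑ (C i) λ u → ∑ (C j) λ v → γ̄ u v) D cross n≥0 (errors≤D i j) (nonadjacent≤cross i≢j)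
        (subst₂ _≤_ (trans (count² i j n) refl)
          (∑-lin3 (C i) k (λ u → ∑ (C j) (a u)) 1ℤ (λ u → ∑ (C j) λ v → γ u v * aErr u v) n (λ u → ∑ (C j) (γ̄ u)) λ u →
            ∑-lin3 (C j) k (a u) 1ℤ (λ v → γ u v * aErr u v) n (γ̄ u) λ v → refl)
          (∑-mono (C i) λ u → ∑-mono (C j) λ v → point u v)))
      where
      alg : ∀ n k p s e x D X → 0ℤ ≤ n → e ≤ D → x ≤ X → n * p ≤ k * s + 1ℤ * e + n * x → n * p - k * s ≤ D + n * X
      alg n k p s e x D X pn h₁ h₂ h₃ = cert (le⇒0≤ h₁ ⊕ pn ⊗ le⇒0≤ h₂ ⊕ le⇒0≤ h₃) (solve (n ∷ k ∷ p ∷ s ∷ e ∷ x ∷ D ∷ X ∷ []))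
      point : ∀ u v → n ≤ k * a u v + 1ℤ * (γ u v * aErr u v) + n * γ̄ u v
      point u v = subst (λ z → n ≤ k * z + 1ℤ * (γ u v * aErr u v) + n * γ̄ u v) (γa u v)
        (alg₁ n k (γ u v) (a u v) (aErr u v) (γ≥0 u v) (-≤abs (k * a u v - n)))
        where
        alg₁ : ∀ n k y a x → 0ℤ ≤ y → - (k * a - n) ≤ x → n ≤ k * (y * a) + 1ℤ * (y * x) + n * (1ℤ - y)
        alg₁ n k y a x py h = cert (py ⊗ le⇒0≤ h) (solve (n ∷ k ∷ y ∷ a ∷ x ∷ []))

    pair-upper : ∀ i j → k * ∑ colours (cnt i j) - n * (ν i * ν j) ≤ D
    pair-upper i j = subst (λ z → k * z - n * (ν i * ν j) ≤ D) (sym (cnt-sum i j))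
      (alg n k (ν i * ν j) (∑ (C i) λ u → ∑ (C j) λ v → a u v) (∑ (C i) λ u → ∑ (C j) λ v → γ u v * aErr u v) D (errors≤D i j)
        (subst₂ _≤_
          (∑-lin1 (C i) k (λ u → ∑ (C j) (a u)) λ u → ∑-lin1 (C j) k (a u) λ v → refl)
          (trans (∑-cong (C i) λ u → ∑-+ (C j) (λ _ → n) (λ v → γ u v * aErr u v))
            (trans (∑-+ (C i) (λ _ → ∑ (C j) λ _ → n) (λ u → ∑ (C j) λ v → γ u v * aErr u v))
              (cong (_+ (∑ (C i) λ u → ∑ (C j) λ v → γ u v * aErr u v)) (count² i j n))))
          (∑-mono (C i) λ u → ∑-mono (C j) λ v → point u v)))
      where
      alg : ∀ n k p s e D → e ≤ D → k * s ≤ n * p + e → k * s - n * p ≤ D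
      alg n k p s e D h₁ h₂ = cert (le⇒0≤ h₁ ⊕ le⇒0≤ h₂) (solve (n ∷ k ∷ p ∷ s ∷ e ∷ D ∷ []))
      point : ∀ u v → k * a u v ≤ n + γ u v * aErr u v
      point u v = subst (λ z → k * z ≤ n + γ u v * aErr u v) (γa u v)
        (alg₁ n k (γ u v) (a u v) (aErr u v) (γ≥0 u v) (γ̄≥0 u v) n≥0 (≤abs (k * a u v - n)))
        where
        alg₁ : ∀ n k y a x → 0ℤ ≤ y → 0ℤ ≤ 1ℤ - y → 0ℤ ≤ n → k * a - n ≤ x → k * (y * a) ≤ n + y * x
        alg₁ n k y a x py pȳ pn h = cert (py ⊗ le⇒0≤ h ⊕ pȳ ⊗ pn) (solve (n ∷ k ∷ y ∷ a ∷ x ∷ []))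

    -- An edge with two vertices in one class contains an adjacent pair inside that class, and each
    -- of these at most `I` pairs has at most `n` third vertices.
    diagonal : ∀ i l → cnt i i l ≤ n * I
    diagonal i l = ≤-trans (∑-mono (C i) λ u → ∑-mono (C i) λ v → ≤-trans (C-≤ l λ w → τ≥0 w u v) (∑-le1 V (γ u v) (λ _ → 1ℤ) λ w →
          subst (τ w u v ≤_) (sym (*-identityʳ (γ u v))) (τ≤γ w u v)))
      (≤-trans (≤-reflexive (∑-lin1 (C i) n (λ u → ∑ (C i) (γ u)) λ u → ∑-lin1 (C i) n (γ u) λ v → *-comm (γ u v) n))
        (alg n (∑ (C i) λ u → ∑ (C i) (γ u)) I n≥0 (within-class i)))
      where
      alg : ∀ n x y → 0ℤ ≤ n → x ≤ y → n * x ≤ n * y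
      alg n x y pn h = cert (pn ⊗ le⇒0≤ h) (solve (n ∷ x ∷ y ∷ []))

    S³-classes : ∀ (h : A → A → A → ℤ) → (S λ u → S λ v → S λ w → h u v w) ≡
      ∑ colours λ i → ∑ colours λ j → ∑ colours λ l → ∑ (C i) λ u → ∑ (C j) λ v → ∑ (C l) λ w → h u v w
    S³-classes h = trans (S-classes λ u → S λ v → S λ w → h u v w) (∑-cong colours λ i →
      trans (∑-cong (C i) λ u → S-classes λ v → S λ w → h u v w)
      (trans (∑-swap (C i) colours λ u j → ∑ (C j) λ v → S λ w → h u v w) (∑-cong colours λ j →
        trans (∑-cong (C i) λ u → trans (∑-cong (C j) λ v → S-classes (h u v)) (∑-swap (C j) colours λ v l → ∑ (C l) (h u v)))
          (∑-swap (C i) colours λ u l → ∑ (C j) λ v → ∑ (C l) (h u v)))))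

    module Threshold (G P : ℤ) (G-large : + 16 * (k * k * k * k) ≤ G) (P-large : + 3 * (k * k) * (G * G) ≤ P)
      (PE≤ : P * E ≤ n * n) (PB≤ : P * B ≤ n * n * n * n) (PD≤ : P * D ≤ n * n * n)
      (rest-small : + 3 * (k * k) * (G * G) * r ≤ n) where

      private
        n³ : ℤ
        n³ = n * n * n

        n³≥1 : 1ℤ ≤ n³
        n³≥1 = 1≤* {n * n} {n} (1≤* n≥1 n≥1) n≥1

        G≥16 : + 16 ≤ G
        G≥16 = ≤-trans (alg k (1≤* {k * k * k} {k} (1≤* {k * k} {k} (1≤* k≥1 k≥1) k≥1) k≥1)) G-large
          where
          alg : ∀ k → 1ℤ ≤ k * k * k * k → + 16 ≤ + 16 * (k * k * k * k)
          alg k h = cert (0≤+ {16} ⊗ le⇒0≤ h) (solve (k ∷ []))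

        G≥2 : + 2 ≤ G
        G≥2 = ≤-trans (+≤+ (s≤s (s≤s z≤n))) G≥16

        G≥1 : 1ℤ ≤ G
        G≥1 = ≤-trans (+≤+ (s≤s z≤n)) G≥16

        G≥0 : 0ℤ ≤ G
        G≥0 = 1≤⇒0≤ G≥1

        I-small : + 3 * (k * k) * (G * G) * I ≤ + 2 * (n * n)
        I-small = alg (+ 3 * (k * k) * (G * G)) n r n≥0 rest-small
          where
          alg : ∀ b n r → 0ℤ ≤ n → b * r ≤ n → b * (+ 2 * (n * r)) ≤ + 2 * (n * n)
          alg b n r pn h = cert (0≤+ {2} ⊗ pn ⊗ le⇒0≤ h) (solve (b ∷ n ∷ r ∷ []))

        GD≤ : G * D ≤ n³
        GD≤ = alg k G P D (n³) k≥1 G≥1 D≥0 P-large PD≤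
          where
          alg : ∀ k G P D m → 1ℤ ≤ k → 1ℤ ≤ G → 0ℤ ≤ D → + 3 * (k * k) * (G * G) ≤ P → P * D ≤ m → G * D ≤ m
          alg k G P D m k1 g1 pd hP h = cert (le⇒0≤ h ⊕ le⇒0≤ hP ⊗ pd ⊕ 1≤⇒0≤ g1 ⊗ pd ⊗ le⇒0≤ (1≤* {+ 3 * (k * k)} {G} (1≤* {+ 3} {k * k} (+≤+ (s≤s z≤n)) (1≤* k1 k1)) g1))
            (solve (k ∷ G ∷ P ∷ D ∷ m ∷ []))

        spread-small : G * G * (k * E + k * k * I) ≤ n * n
        spread-small = spread-arith k n G P E I k≥1 E≥0 P-large PE≤ I-small

        cross-small : G * cross ≤ n * n
        cross-small = cross-arith k n G (k * E + k * k * I) cross spread k≥1 G≥1 cross≥0 spread≥0 spread-total spread-small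

      class-size : ∀ i → G * (n - k * ν i) ≤ n
      class-size i = size-lower-arith k n G (k * E + k * k * I) cross spread (ν i) n≥0 cross≥0
        (∑-≥term colours (λ i → sq (k * ν i - n)) (∈-allFin i)) spread-total spread-small

      private
        νν-large : ∀ i j → n * n ≤ + 4 * (k * k) * (ν i * ν j)
        νν-large i j = pair-arith k n (ν i) (ν j) n≥0 k≥0 (ν≥0 j) (half-arith k n G (ν i) G≥2 n≥0 (class-size i))
          (half-arith k n G (ν j) G≥2 n≥0 (class-size j))

      -- The threshold `n³ / G` is the square root of the bound `n⁶ / G²` on `cnt * (vol - cnt)`:
      -- once the count exceeds it, at most `n³ / G` of the possible edges are missing.
      Big : Fin K → Fin K → Fin K → Set
      Big i j l = n³ < G * cnt i j l

      Big? : ∀ i j l → Dec (Big i j l)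
      Big? i j l = n³ <? G * cnt i j l

      Big-swap₁₂ : ∀ {i j l} → Big i j l → Big j i l
      Big-swap₁₂ {i} {j} {l} = subst (λ z → n³ < G * z) (cnt-swap₁₂ i j l)

      Big-swap₂₃ : ∀ {i j l} → Big i j l → Big i l j
      Big-swap₂₃ {i} {j} {l} = subst (λ z → n³ < G * z) (cnt-swap₂₃ i j l)

      Big-irrefl : ∀ {i l} → ¬ Big i i l
      Big-irrefl {i} {l} h = diagonal-arith k n G I (cnt i i l) k≥1 n≥1 G≥1 I-small (diagonal i l) (<⇒≤ h)

      Big-full : ∀ {i j l} → Big i j l → G * (vol i j l - cnt i j l) ≤ n³
      Big-full {i} {j} {l} h = cancel n³ (1≤⇒0< n³≥1) (alg n³ G (cnt i j l) (vol i j l) G≥0 (cnt≤vol i j l) (<⇒≤ h)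
        (box-arith k n G P B I _ k≥3 n≥0 B≥0 P-large PB≤ I-small (box i j l)))
        where
        alg : ∀ m G c v → 0ℤ ≤ G → c ≤ v → m ≤ G * c → G * G * (c * (v - c)) ≤ m * m → m * (G * (v - c)) ≤ m * m
        alg m G c v pG h₁ h₂ h₃ = cert (le⇒0≤ h₃ ⊕ le⇒0≤ h₂ ⊗ (pG ⊗ le⇒0≤ h₁)) (solve (m ∷ G ∷ c ∷ v ∷ []))

      Big-exists : ∀ {i j} → i ≢ j → ∃ λ l → Big i j l
      Big-exists {i} {j} i≢j with search {Q = Big i j} {R = λ l → G * cnt i j l ≤ n³} (λ l → decide l (Big? i j l)) colours
        where
        decide : ∀ l → Dec (Big i j l) → Big i j l ⊎ G * cnt i j l ≤ n³
        decide l (yes h) = inj₁ h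
        decide l (no h) = inj₂ (≮⇒≥ h)
      ... | inj₁ q = q
      ... | inj₂ h = ⊥-elim (existence-arith k n G (ν i) (ν j) (∑ colours (cnt i j)) k≥1 n≥1 G≥0 G-large
        (alg G n _ D cross G≥0 n≥0 (pair-lower i≢j) GD≤ cross-small)
        (subst₂ _≤_ (∑-lin1 colours G (cnt i j) λ l → refl)
          (trans (∑-const colours n³) (cong (n³ *_) count-colours))
          (∑-mono∈ colours h))
        (νν-large i j))
        where
        alg : ∀ G n x D X → 0ℤ ≤ G → 0ℤ ≤ n → x ≤ D + n * X → G * D ≤ n * n * n → G * X ≤ n * n → G * x ≤ + 2 * (n * n * n)
        alg G n x D X pG pn h₁ h₂ h₃ = cert (pG ⊗ le⇒0≤ h₁ ⊕ le⇒0≤ h₂ ⊕ pn ⊗ le⇒0≤ h₃) (solve (G ∷ n ∷ x ∷ D ∷ X ∷ []))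

      Big-unique : ∀ {i j l l′} → Big i j l → Big i j l′ → l ≡ l′
      Big-unique {i} {j} {l} {l′} h h′ with l Fin.≟ l′
      ... | yes e = e
      ... | no l≢l′ = ⊥-elim (uniqueness-arith k n G (ν i) (ν j) (ν l) (ν l′) (cnt i j l) (cnt i j l′) (∑ colours (cnt i j))
        k≥1 n≥1 G≥2 G-large (ν≥0 i ⊗ ν≥0 j) (Big-full h) (Big-full h′)
        (∑-≥two colours (cnt≥0 i j) (∈-allFin l) (∈-allFin l′) l≢l′)
        (alg G _ D n³ G≥0 (pair-upper i j) GD≤) (class-size l) (class-size l′) (νν-large i j))
        where
        alg : ∀ G x D m → 0ℤ ≤ G → x ≤ D → G * D ≤ m → G * x ≤ m
        alg G x D m pG h₁ h₂ = cert (pG ⊗ le⇒0≤ h₁ ⊕ le⇒0≤ h₂) (solve (G ∷ x ∷ D ∷ m ∷ []))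

      small : A → A → A → ℤ
      small u v w = 1ℤ - 𝟙 (Big? (φ u) (φ v) (φ w))

      -- There are `k³` ordered triples of classes, and each one that is not `Big` contributes at
      -- most `n³ / G`.
      bad-triples : G * (S λ u → S λ v → S λ w → τ u v w * small u v w) ≤ n³ * k * k * k
      bad-triples = subst₂ _≤_ lhs rhs (∑-mono colours λ i → ∑-mono colours λ j → ∑-mono colours λ l → part i j l)
        where
        h : A → A → A → ℤ
        h u v w = τ u v w * small u v w
        part-sum : Fin K → Fin K → Fin K → ℤ
        part-sum i j l = ∑ (C i) λ u → ∑ (C j) λ v → ∑ (C l) λ w → h u v w
        part≡ : ∀ i j l → part-sum i j l ≡ (1ℤ - 𝟙 (Big? i j l)) * cnt i j l
        part≡ i j l = trans (∑-cong∈ (C i) λ u p → ∑-cong∈ (C j) λ v p′ → ∑-cong∈ (C l) λ w p″ →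
            trans (cong (τ u v w *_) (trans (cong₂ (λ x y → 1ℤ - 𝟙 (Big? x y (φ w))) (C-colour p) (C-colour p′)) (cong (λ x → 1ℤ - 𝟙 (Big? i j x)) (C-colour p″))))
              (trans (*-comm (τ u v w) b) (cong (b *_) (sym (τ-rotate u v w)))))
          (∑-lin1 (C i) b (λ u → ∑ (C j) λ v → ∑ (C l) λ w → τ w u v) λ u → ∑-lin1 (C j) b (λ v → ∑ (C l) λ w → τ w u v) λ v →
            ∑-lin1 (C l) b (λ w → τ w u v) λ w → refl)
          where
          b : ℤ
          b = 1ℤ - 𝟙 (Big? i j l)
        part : ∀ i j l → G * part-sum i j l ≤ n³
        part i j l = subst (λ z → G * z ≤ n³) (sym (part≡ i j l)) (decide (Big? i j l))
          where
          decide : (d : Dec (Big i j l)) → G * ((1ℤ - 𝟙 d) * cnt i j l) ≤ n³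
          decide (yes _) = subst (_≤ n³) (sym (alg G (cnt i j l))) (1≤⇒0≤ n³≥1)
            where alg : ∀ x y → x * (0ℤ * y) ≡ 0ℤ
                  alg = solve-∀
          decide (no ¬h) = subst (λ z → G * z ≤ n³) (sym (*-identityˡ (cnt i j l))) (≮⇒≥ ¬h)
        lhs : (∑ colours λ i → ∑ colours λ j → ∑ colours λ l → G * part-sum i j l) ≡ G * (S λ u → S λ v → S λ w → h u v w)
        lhs = trans (∑-lin1 colours G (λ i → ∑ colours λ j → ∑ colours λ l → part-sum i j l) λ i →
            ∑-lin1 colours G (λ j → ∑ colours λ l → part-sum i j l) λ j → ∑-lin1 colours G (part-sum i j) λ l → refl)
          (cong (G *_) (sym (S³-classes h)))
        rhs : (∑ colours λ i → ∑ colours λ j → ∑ colours λ l → n³) ≡ n³ * k * k * k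
        rhs = trans (∑-cong colours λ i → trans (∑-cong colours λ j → col n³) (col (n³ * k))) (col (n³ * k * k))
          where col : ∀ x → ∑ colours (λ _ → x) ≡ x * k
                col x = trans (∑-const colours x) (cong (x *_) count-colours)

  -- Big i j l says that {i,j,l} is a block of a Steiner triple system on Fin K, and
  -- fits that φ sends all but at most n³ / Δ ordered edges to a block.
  record Pattern {A : Set} (conf : Config A) (K : ℕ) (Δ : ℤ) : Set₁ where
    open Config conf
    open Counting conf
    field
      φ          : A → Fin K
      Big        : Fin K → Fin K → Fin K → Set
      Big?       : ∀ i j l → Dec (Big i j l)
      Big-swap₁₂ : ∀ {i j l} → Big i j l → Big j i l
      Big-swap₂₃ : ∀ {i j l} → Big i j l → Big i l j
      Big-irrefl : ∀ {i l} → ¬ Big i i l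
      Big-exists : ∀ {i j} → i ≢ j → ∃ λ l → Big i j l
      Big-unique : ∀ {i j l l′} → Big i j l → Big i j l′ → l ≡ l′
      fits       : Δ * (S λ u → S λ v → S λ w → τ u v w * (1ℤ - 𝟙 (Big? (φ u) (φ v) (φ w)))) ≤ n * n * n

  -- Assembly of the stability statement and choice of constants

  colour : ∀ {K} x → 1 ℕ.≤ K → x ℕ.≤ K → Fin K
  -- Uncoloured vertices join class 0; their share is small enough to be an error term.
  colour zero K≥1 _ = fromℕ< K≥1
  colour (suc i) K≥1 h = fromℕ< h

  1≤+ : ∀ {m} → 1ℤ ≤ + suc m
  1≤+ = +≤+ (s≤s z≤n)

  ^≥1 : ∀ {q} j → 1ℤ ≤ q → 1ℤ ≤ q ^ j
  ^≥1 zero h = ≤-refl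
  ^≥1 (suc j) h = 1≤* h (^≥1 j h)

  colour-proper : ∀ {A : Set} {K} (K≥1 : 1 ℕ.≤ K) (ψ : A → ℕ) (bound : ∀ u → ψ u ℕ.≤ K) (γ : A → A → ℤ) → (∀ u v → Bit (γ u v)) →
    (∀ u u′ i → ψ u ≡ suc i → ψ u′ ≡ suc i → γ u u′ ≡ 0ℤ) →
    ∀ u u′ → colour (ψ u) K≥1 (bound u) ≡ colour (ψ u′) K≥1 (bound u′) → γ u u′ ≤ uncoloured (ψ u) + uncoloured (ψ u′)
  colour-proper K≥1 ψ bound γ γ-bit proper u u′ e with ψ u in p | ψ u′ in p′ | bound u | bound u′
  ... | zero | x′ | _ | _ = ≤-trans (bit≤1 (γ-bit u u′)) (cert (bit≥0 (uncoloured-bit x′)) refl)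
  ... | suc i | zero | _ | _ = bit≤1 (γ-bit u u′)
  ... | suc i | suc i′ | h | h′ with fromℕ<-injective i i′ h h′ e
  ... | refl = ≤-reflexive (proper u u′ i p p′)

  stability-with : ∀ {A : Set} (conf : Config A) (K : ℕ) (k : ℤ) → k ≡ + K → + 3 ≤ k → (G β P Δ : ℤ) →
    β ≡ + 3 * (k * k) * (G * G) → 1ℤ ≤ Δ → 1ℤ ≤ P →
    + 16 * (k * k * k * k) ≤ G → + 16 * (k * k * k * k) * Δ ≤ G → 1ℤ ≤ β → β ≤ P → (+ 16 * (k * k * k) * (β * β)) ^ K ≤ P →
    (let open Counting conf) → (L : ℤ) → L ≡ P * P * (k + 1ℤ) → 1ℤ ≤ n →
    L * L * k * ((k - 1ℤ) * (n * n * n) - k * k * t) ≤ n * n * n →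
    L * L * k * ((k - 1ℤ) * (n * n) - k * g) ≤ n * n →
    Pattern conf K Δ
  stability-with {A} conf K k k≡K k≥3 G β P Δ β≡ Δ≥1 P≥1 G-large G-large′ β≥1 P-large P-large′ L L≡ n≥1 edge-hyp shadow-hyp = record
    { φ = φ ; Big = Big ; Big? = Big? ; Big-swap₁₂ = Big-swap₁₂ ; Big-swap₂₃ = Big-swap₂₃
    ; Big-irrefl = Big-irrefl ; Big-exists = Big-exists ; Big-unique = Big-unique
    ; fits = fits-arith k n Δ G _ k≥1 n≥0 bad≥0 Δ≥1 G-large′ bad-triples }
    where
    open Config conf
    open Counting conf
    k≥1 : 1ℤ ≤ k
    k≥1 = ≤-trans 1≤+ k≥3
    open Errors conf k
    open Analysis conf k P L L≡ k≥3 P≥1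
    K≥1 : 1 ℕ.≤ K
    K≥1 = drop‿+≤+ (subst (1ℤ ≤_) k≡K k≥1)
    pe : P * E ≤ n * n
    pe = PE≤ n≥1 edge-hyp shadow-hyp
    pd : P * D ≤ n * n * n
    pd = PD≤ n≥1 edge-hyp shadow-hyp
    module It = Colouring.Iteration conf K k k≡K k≥3 n≥1 β P β≥1 pe pd
    goal : It.Goal
    goal = It.colouring P-large′
    ψ : A → ℕ
    ψ = proj₁ goal
    bound : ∀ u → ψ u ℕ.≤ K
    bound = proj₁ (proj₁ (proj₂ goal))
    φ : A → Fin K
    φ u = colour (ψ u) K≥1 (bound u)
    ρ : A → ℤ
    ρ u = uncoloured (ψ u)
    ρ≥0 : ∀ u → 0ℤ ≤ ρ u
    ρ≥0 u = bit≥0 (uncoloured-bit (ψ u))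
    φ-proper : ∀ u u′ → φ u ≡ φ u′ → γ u u′ ≤ ρ u + ρ u′
    φ-proper = colour-proper K≥1 ψ bound γ γ-bit (proj₂ (proj₁ (proj₂ goal)))
    open Triples conf K k k≡K k≥3 n≥1 φ ρ ρ≥0 φ-proper
    open Threshold G P G-large (subst (_≤ P) β≡ P-large) pe (PB≤ n≥1 edge-hyp shadow-hyp) pd
      (subst (λ z → z * S ρ ≤ n) β≡ (proj₂ (proj₂ goal)))
    bad≥0 : 0ℤ ≤ (S λ u → S λ v → S λ w → τ u v w * small u v w)
    bad≥0 = ∑-≥0 V λ u → ∑-≥0 V λ v → ∑-≥0 V λ w → τ≥0 u v w ⊗ bit≥0 (bit-co (𝟙-bit (Big? (φ u) (φ v) (φ w))))
    fits-arith : ∀ k n Δ G b → 1ℤ ≤ k → 0ℤ ≤ n → 0ℤ ≤ b → 1ℤ ≤ Δ → + 16 * (k * k * k * k) * Δ ≤ G →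
      G * b ≤ n * n * n * k * k * k → Δ * b ≤ n * n * n
    fits-arith k n Δ G b k≥1 n≥0 b≥0 Δ≥1 hG h = cancel (k * k * k) (1≤⇒0< (1≤* {k * k} {k} (1≤* k≥1 k≥1) k≥1))
      (cert (le⇒0≤ h ⊕ le⇒0≤ hG ⊗ b≥0 ⊕ (k≥0 ⊗ k≥0 ⊗ k≥0) ⊗ 1≤⇒0≤ Δ≥1 ⊗ b≥0 ⊗ (0≤+ {16} ⊗ le⇒0≤ k≥1 ⊕ 0≤+ {15}))
        (solve (k ∷ n ∷ Δ ∷ G ∷ b ∷ [])))
      where k≥0 = 1≤⇒0≤ k≥1


  Constants : (k : ℤ) (K : ℕ) (Δ : ℤ) → Set
  Constants k K Δ = Σ ℤ λ G → Σ ℤ λ β → Σ ℤ λ P → 1ℤ ≤ P × β ≡ + 3 * (k * k) * (G * G) ×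
    + 16 * (k * k * k * k) ≤ G × + 16 * (k * k * k * k) * Δ ≤ G × 1ℤ ≤ β × β ≤ P × (+ 16 * (k * k * k) * (β * β)) ^ K ≤ P

  -- `G = 16 k⁴ Δ` meets both lower bounds on `G`; `β = 3 k² G²` makes the uncoloured vertices
  -- negligible against the threshold `1 / G`; and `P = q ^ K` with `q = 16 k³ β²` pays for `K`
  -- greedy steps.
  constants : ∀ k K Δ → 1ℤ ≤ k → 1 ℕ.≤ K → 1ℤ ≤ Δ → Constants k K Δ
  constants k K Δ k≥1 K≥1 Δ≥1 =
    with-G (+ 16 * (k * k * k * k) * Δ) (1≤* 16k⁴≥1 Δ≥1) (grow (+ 16 * (k * k * k * k)) Δ (1≤⇒0≤ 16k⁴≥1) Δ≥1) ≤-refl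
    where
    grow : ∀ x y → 0ℤ ≤ x → 1ℤ ≤ y → x ≤ x * y
    grow x y px h = cert (px ⊗ le⇒0≤ h) (solve (x ∷ y ∷ []))
    kkk≥1 : 1ℤ ≤ k * k * k
    kkk≥1 = 1≤* {k * k} {k} (1≤* k≥1 k≥1) k≥1
    16k⁴≥1 : 1ℤ ≤ + 16 * (k * k * k * k)
    16k⁴≥1 = 1≤* {+ 16} {k * k * k * k} 1≤+ (1≤* {k * k * k} {k} kkk≥1 k≥1)
    ≤^ : ∀ q j → 1ℤ ≤ q → 1 ℕ.≤ j → q ≤ q ^ j
    ≤^ q (suc j) q≥1 _ = grow q (q ^ j) (1≤⇒0≤ q≥1) (^≥1 j q≥1)
    β≤q : ∀ x y → 1ℤ ≤ x → 1ℤ ≤ y → y ≤ x * (y * y)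
    β≤q x y hx hy = cert (1≤⇒0≤ hy ⊗ le⇒0≤ (1≤* hx hy)) (solve (x ∷ y ∷ []))
    with-q : ∀ G β q → β ≡ + 3 * (k * k) * (G * G) → q ≡ + 16 * (k * k * k) * (β * β) → 1ℤ ≤ β → β ≤ q →
      + 16 * (k * k * k * k) ≤ G → + 16 * (k * k * k * k) * Δ ≤ G → Constants k K Δ
    with-q G β q β≡ q≡ β≥1 hq h h′ = G , β , q ^ K , ^≥1 K (≤-trans β≥1 hq) , β≡ , h , h′ , β≥1 ,
      ≤-trans hq (≤^ q K (≤-trans β≥1 hq) K≥1) , ≤-reflexive (cong (_^ K) (sym q≡))
    with-G : ∀ G → 1ℤ ≤ G → + 16 * (k * k * k * k) ≤ G → + 16 * (k * k * k * k) * Δ ≤ G → Constants k K Δ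
    with-G G G≥1 h h′ = with-q G _ _ refl refl β≥1
        (β≤q (+ 16 * (k * k * k)) (+ 3 * (k * k) * (G * G)) (1≤* {+ 16} {k * k * k} 1≤+ kkk≥1) β≥1) h h′
      where
      β≥1 : 1ℤ ≤ + 3 * (k * k) * (G * G)
      β≥1 = 1≤* {+ 3 * (k * k)} {G * G} (1≤* {+ 3} {k * k} 1≤+ (1≤* k≥1 k≥1)) (1≤* G≥1 G≥1)

  Stability : ℕ → ℤ → ℕ → Set₁
  Stability K Δ N = ∀ {A : Set} (conf : Config A) → (let open Counting conf) → 1ℤ ≤ n →
    + N * ((+ K - 1ℤ) * (n * n * n) - + K * + K * t) ≤ n * n * n →
    + N * ((+ K - 1ℤ) * (n * n) - + K * g) ≤ n * n →
    Pattern conf K Δ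

  stability : ∀ K → 3 ℕ.≤ K → ∀ Δ → 1ℤ ≤ Δ → Σ ℕ λ N → 1 ℕ.≤ N × Stability K Δ N
  stability K K≥3 Δ Δ≥1 = with-k (+ K) refl (+≤+ K≥3) (constants (+ K) K Δ (+≤+ K≥1) K≥1 Δ≥1)
    where
    K≥1 : 1 ℕ.≤ K
    K≥1 = ℕ.≤-trans (s≤s z≤n) K≥3
    as-ℕ : ∀ x → 1ℤ ≤ x → Σ ℕ λ m → 1 ℕ.≤ m × x ≡ + m
    as-ℕ (+ m) (+≤+ h) = m , h , refl
    with-k : ∀ k → k ≡ + K → + 3 ≤ k → Constants k K Δ → Σ ℕ λ N → 1 ℕ.≤ N × Stability K Δ N
    with-k k k≡ k≥3 (G , β , P , P≥1 , β≡ , h₁ , h₂ , β≥1 , h₃ , h₄) = with-L (P * P * (k + 1ℤ)) refl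
        (1≤* {P * P} {k + 1ℤ} (1≤* P≥1 P≥1) (≤-trans k≥1 (cert {e = 1ℤ} 0≤+ refl)))
      where
      k≥1 : 1ℤ ≤ k
      k≥1 = ≤-trans 1≤+ k≥3
      with-L : ∀ L → L ≡ P * P * (k + 1ℤ) → 1ℤ ≤ L → Σ ℕ λ N → 1 ℕ.≤ N × Stability K Δ N
      -- `N = L² k`: the square is spent in passing from squared to absolute degree errors, and `k`
      -- absorbs the coefficient `k - 1` in the bound on the squares.
      with-L L L≡ L≥1 with as-ℕ (L * L * k) (1≤* {L * L} {k} (1≤* L≥1 L≥1) k≥1)
      ... | N , N≥1 , N≡ = N , N≥1 , λ conf n≥1 edge-hyp shadow-hyp → let open Counting conf in
        stability-with conf K k k≡ k≥3 G β P Δ β≡ Δ≥1 P≥1 h₁ h₂ β≥1 h₃ h₄ L L≡ n≥1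
          (subst₂ (λ x y → x * ((y - 1ℤ) * (n * n * n) - y * y * t) ≤ n * n * n) (sym N≡) (sym k≡) edge-hyp)
          (subst₂ (λ x y → x * ((y - 1ℤ) * (n * n) - y * g) ≤ n * n) (sym N≡) (sym k≡) shadow-hyp)

module Hypergraphs where
  open StableConfigurations
  open import Data.Integer hiding (suc; ∣_∣)
  open import Data.Integer.Properties
  open import Data.Integer.Tactic.RingSolver
  open import Data.Nat using (ℕ; zero; suc; z≤n; s≤s)
  import Data.Nat as ℕ
  import Data.Nat.Properties as ℕ
  open import Data.Bool using (true; false)
  open import Data.Fin using (Fin; zero; suc)
  import Data.Fin as Fin
  import Data.Fin.Properties as Fin
  open import Data.Fin.Subset using (Subset; _∈_; _∉_; _⊆_; ∣_∣; inside; outside; ⁅_⁆) renaming (_-_ to _∖_)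
  open import Data.Fin.Subset.Properties
    using (_∈?_; _⊆?_; x∈p⇒∣p-x∣<∣p∣; x∈p∧x≢y⇒x∈p-y; ∣⁅x⁆∣≡1; x∈⁅y⁆⇒x≡y; x∈⁅x⁆; ⊆-antisym)
  open import Data.Vec using (Vec; _∷_; []; here; there)
  open import Data.List using (List; _∷_; []; map; filter; length; allFin)
  open import Data.List.Properties using (length-map; length-tabulate)
  import Data.List.Membership.Propositional as List
  open import Data.List.Membership.Propositional.Properties
    using (∈-map⁺; ∈-map⁻; ∈-++⁺ˡ; ∈-++⁺ʳ; ∈-filter⁺; ∈-filter⁻; ∈-allFin)
  open import Data.List.Relation.Unary.All as All using (All; []; _∷_)
  open import Data.List.Relation.Unary.All.Properties using () renaming (filter⁺ to all-filter⁺)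
  open import Data.List.Relation.Unary.Any as Any using (Any)
  open import Data.List.Relation.Unary.AllPairs using ([]; _∷_)
  open import Data.List.Relation.Unary.Unique.Propositional using (Unique)
  open import Data.List.Relation.Unary.Unique.Propositional.Properties as Unique using ()
  open import Data.Product using (Σ; ∃; _×_; _,_; proj₁; proj₂)
  open import Data.Sum using (_⊎_; inj₁; inj₂)
  open import Data.Empty using (⊥; ⊥-elim)
  open import Relation.Nullary using (Dec; yes; no; ¬_; _×-dec_)
  open import Relation.Binary.PropositionalEquality
  open import Relation.Unary using (Decidable)

  -- Subsets of Fin n

  elements : ∀ {n} → Subset n → List (Fin n)
  elements [] = []
  elements (true ∷ p) = zero ∷ map suc (elements p)
  elements (false ∷ p) = map suc (elements p)

  length-elements : ∀ {n} (p : Subset n) → length (elements p) ≡ ∣ p ∣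
  length-elements [] = refl
  length-elements (true ∷ p) = cong suc (trans (length-map suc (elements p)) (length-elements p))
  length-elements (false ∷ p) = trans (length-map suc (elements p)) (length-elements p)

  elements-∈ : ∀ {n} (p : Subset n) {x} → x List.∈ elements p → x ∈ p
  elements-∈ (true ∷ p) (Any.here refl) = here
  elements-∈ (true ∷ p) (Any.there q) with ∈-map⁻ suc q
  ... | y , y∈ , refl = there (elements-∈ p y∈)
  elements-∈ (false ∷ p) q with ∈-map⁻ suc q
  ... | y , y∈ , refl = there (elements-∈ p y∈)

  elements-unique : ∀ {n} (p : Subset n) → Unique (elements p)
  elements-unique [] = []
  elements-unique (true ∷ p) = All.tabulate (λ q e → zero-∉ (subst (List._∈ map suc (elements p)) (sym e) q))
      ∷ Unique.map⁺ Fin.suc-injective (elements-unique p)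
    where
    zero-∉ : zero List.∈ map suc (elements p) → ⊥
    zero-∉ q with ∈-map⁻ suc q
    ... | _ , _ , ()
  elements-unique (false ∷ p) = Unique.map⁺ Fin.suc-injective (elements-unique p)

  -- Pigeonhole: deleting the head of the list from `p` lowers its size, while the other entries
  -- stay in `p` because they differ from the head.
  unique-length≤∣∣ : ∀ {n} (p : Subset n) {ys} → Unique ys → All (_∈ p) ys → length ys ℕ.≤ ∣ p ∣
  unique-length≤∣∣ p [] [] = z≤n
  unique-length≤∣∣ p (y∉ ∷ u) (y∈ ∷ ys∈) = ℕ.≤-trans
    (s≤s (unique-length≤∣∣ (p ∖ _) u (All.zipWith (λ { (x∈ , y≢x) → x∈p∧x≢y⇒x∈p-y x∈ (≢-sym y≢x) }) (ys∈ , y∉))))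
    (x∈p⇒∣p-x∣<∣p∣ y∈)

  insert : ∀ {n} → Fin n → Subset n → Subset n
  insert zero (_ ∷ p) = inside ∷ p
  insert (suc x) (s ∷ p) = s ∷ insert x p

  ∈-insert : ∀ {n} (x : Fin n) p → x ∈ insert x p
  ∈-insert zero (_ ∷ p) = here
  ∈-insert (suc x) (_ ∷ p) = there (∈-insert x p)

  ⊆-insert : ∀ {n} (x : Fin n) p {y} → y ∈ p → y ∈ insert x p
  ⊆-insert zero (_ ∷ p) here = here
  ⊆-insert zero (_ ∷ p) (there q) = there q
  ⊆-insert (suc x) (_ ∷ p) here = here
  ⊆-insert (suc x) (_ ∷ p) (there q) = there (⊆-insert x p q)

  ∈-insert⁻ : ∀ {n} (x : Fin n) p {y} → y ∈ insert x p → y ≡ x ⊎ y ∈ p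
  ∈-insert⁻ zero (_ ∷ p) here = inj₁ refl
  ∈-insert⁻ zero (_ ∷ p) (there q) = inj₂ (there q)
  ∈-insert⁻ (suc x) (_ ∷ p) here = inj₂ here
  ∈-insert⁻ (suc x) (_ ∷ p) (there q) with ∈-insert⁻ x p q
  ... | inj₁ refl = inj₁ refl
  ... | inj₂ q′ = inj₂ (there q′)

  ∣insert∣ : ∀ {n} (x : Fin n) p → x ∉ p → ∣ insert x p ∣ ≡ suc ∣ p ∣
  ∣insert∣ zero (true ∷ p) x∉ = ⊥-elim (x∉ here)
  ∣insert∣ zero (false ∷ p) x∉ = refl
  ∣insert∣ (suc x) (true ∷ p) x∉ = cong suc (∣insert∣ x p λ q → x∉ (there q))
  ∣insert∣ (suc x) (false ∷ p) x∉ = ∣insert∣ x p λ q → x∉ (there q)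

  allSubsets-complete : ∀ {n} (p : Subset n) → p List.∈ allSubsets n
  allSubsets-complete [] = Any.here refl
  allSubsets-complete {suc n} (true ∷ p) = ∈-++⁺ʳ (map (outside ∷_) (allSubsets n)) (∈-map⁺ (inside ∷_) (allSubsets-complete p))
  allSubsets-complete (false ∷ p) = ∈-++⁺ˡ (∈-map⁺ (outside ∷_) (allSubsets-complete p))

  allSubsets-unique : ∀ n → Unique (allSubsets n)
  allSubsets-unique zero = [] ∷ []
  allSubsets-unique (suc n) = Unique.++⁺ (Unique.map⁺ ∷-injective (allSubsets-unique n)) (Unique.map⁺ ∷-injective (allSubsets-unique n)) disjoint
    where
    ∷-injective : ∀ {s} {p q : Subset n} → s Vec.∷ p ≡ s ∷ q → p ≡ q
    ∷-injective refl = refl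
    disjoint : ∀ {p} → p List.∈ map (outside ∷_) (allSubsets n) × p List.∈ map (inside ∷_) (allSubsets n) → ⊥
    disjoint (q , q′) with ∈-map⁻ (outside ∷_) q | ∈-map⁻ (inside ∷_) q′
    ... | _ , _ , refl | _ , _ , ()

  record Pair {n} (E : Subset n) (u v : Fin n) : Set where
    constructor pair
    field
      u∈ : u ∈ E
      v∈ : v ∈ E
      u≢v : u ≢ v

  record Triple {n} (E : Subset n) (u v w : Fin n) : Set where
    constructor triple
    field
      u∈ : u ∈ E
      v∈ : v ∈ E
      w∈ : w ∈ E
      u≢v : u ≢ v
      u≢w : u ≢ w
      v≢w : v ≢ w

  pair? : ∀ {n} (E : Subset n) u v → Dec (Pair E u v)
  pair? E u v with u ∈? E | v ∈? E | u Fin.≟ v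
  ... | no h | _ | _ = no λ p → h (Pair.u∈ p)
  ... | yes _ | no h | _ = no λ p → h (Pair.v∈ p)
  ... | yes _ | yes _ | yes e = no λ p → Pair.u≢v p e
  ... | yes h | yes h′ | no e = yes (pair h h′ e)

  triple? : ∀ {n} (E : Subset n) u v w → Dec (Triple E u v w)
  triple? E u v w with pair? E u v | pair? E u w | pair? E v w
  ... | no h | _ | _ = no λ t → h (pair (Triple.u∈ t) (Triple.v∈ t) (Triple.u≢v t))
  ... | yes _ | no h | _ = no λ t → h (pair (Triple.u∈ t) (Triple.w∈ t) (Triple.u≢w t))
  ... | yes _ | yes _ | no h = no λ t → h (pair (Triple.v∈ t) (Triple.w∈ t) (Triple.v≢w t))
  ... | yes (pair a b c) | yes (pair _ d e) | yes (pair _ _ f) = yes (triple a b d c e f)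

  triple-swap₁₂ : ∀ {n} {E : Subset n} {u v w} → Triple E u v w → Triple E v u w
  triple-swap₁₂ (triple a b c p q r) = triple b a c (≢-sym p) r q

  triple-swap₂₃ : ∀ {n} {E : Subset n} {u v w} → Triple E u v w → Triple E u w v
  triple-swap₂₃ (triple a b c p q r) = triple a c b q p (≢-sym r)

  pair-only : ∀ {n} {E : Subset n} {u v} → ∣ E ∣ ≡ 2 → Pair E u v → ∀ {x} → x ∈ E → x ≡ u ⊎ x ≡ v
  pair-only {E = E} {u} {v} size (pair a b p) {x} x∈ with x Fin.≟ u | x Fin.≟ v
  ... | yes e | _ = inj₁ e
  ... | no _ | yes e = inj₂ e
  ... | no n | no m = ⊥-elim (ℕ.1+n≰n (subst (3 ℕ.≤_) size
    (unique-length≤∣∣ E ((n ∷ m ∷ []) ∷ (p ∷ []) ∷ [] ∷ []) (x∈ ∷ a ∷ b ∷ []))))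

  triple-only : ∀ {n} {E : Subset n} {u v w} → ∣ E ∣ ≡ 3 → Triple E u v w → ∀ {x} → x ∈ E → x ≡ u ⊎ x ≡ v ⊎ x ≡ w
  triple-only {E = E} {u} {v} {w} size (triple a b c p q r) {x} x∈ with x Fin.≟ u | x Fin.≟ v | x Fin.≟ w
  ... | yes e | _ | _ = inj₁ e
  ... | no _ | yes e | _ = inj₂ (inj₁ e)
  ... | no _ | no _ | yes e = inj₂ (inj₂ e)
  ... | no n | no m | no o = ⊥-elim (ℕ.1+n≰n (subst (4 ℕ.≤_) size
    (unique-length≤∣∣ E ((n ∷ m ∷ o ∷ []) ∷ (p ∷ q ∷ []) ∷ (r ∷ []) ∷ [] ∷ []) (x∈ ∷ a ∷ b ∷ c ∷ []))))

  pair-determines : ∀ {n} {E F : Subset n} {u v} → ∣ E ∣ ≡ 2 → ∣ F ∣ ≡ 2 → Pair E u v → Pair F u v → E ≡ F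
  pair-determines {n} {E} {F} e f p q = ⊆-antisym (sub e p q) (sub f q p)
    where
    sub : ∀ {E F : Subset n} {u v} → ∣ E ∣ ≡ 2 → Pair E u v → Pair F u v → E ⊆ F
    sub e p (pair a b _) x∈ with pair-only e p x∈
    ... | inj₁ refl = a
    ... | inj₂ refl = b

  triple-determines : ∀ {n} {E F : Subset n} {u v w} → ∣ E ∣ ≡ 3 → ∣ F ∣ ≡ 3 → Triple E u v w → Triple F u v w → E ≡ F
  triple-determines {n} {E} {F} e f p q = ⊆-antisym (sub e p q) (sub f q p)
    where
    sub : ∀ {E F : Subset n} {u v w} → ∣ E ∣ ≡ 3 → Triple E u v w → Triple F u v w → E ⊆ F
    sub e p (triple a b c _ _ _) x∈ with triple-only e p x∈
    ... | inj₁ refl = a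
    ... | inj₂ (inj₁ refl) = b
    ... | inj₂ (inj₂ refl) = c

  some-pair : ∀ {n} (E : Subset n) → ∣ E ∣ ≡ 2 → ∃ λ u → ∃ λ v → Pair E u v
  some-pair E size with elements E | trans (length-elements E) size | elements-unique E | elements-∈ E
  ... | u ∷ v ∷ [] | refl | (p ∷ []) ∷ _ | ∈E = u , v , pair (∈E (Any.here refl)) (∈E (Any.there (Any.here refl))) p

  some-triple : ∀ {n} (E : Subset n) → ∣ E ∣ ≡ 3 → ∃ λ u → ∃ λ v → ∃ λ w → Triple E u v w
  some-triple E size with elements E | trans (length-elements E) size | elements-unique E | elements-∈ E
  ... | u ∷ v ∷ w ∷ [] | refl | (p ∷ q ∷ []) ∷ (r ∷ []) ∷ _ | ∈E =
    u , v , w , triple (∈E (Any.here refl)) (∈E (Any.there (Any.here refl))) (∈E (Any.there (Any.there (Any.here refl)))) p q r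

  triangle : ∀ {n} → Fin n → Fin n → Fin n → Subset n
  triangle u v w = insert u (insert v ⁅ w ⁆)

  module _ {n} {u v w : Fin n} (u≢v : u ≢ v) (u≢w : u ≢ w) (v≢w : v ≢ w) where

    triangle-∈ : ∀ {x} → x ∈ triangle u v w → x ≡ u ⊎ x ≡ v ⊎ x ≡ w
    triangle-∈ x∈ with ∈-insert⁻ u _ x∈
    ... | inj₁ e = inj₁ e
    ... | inj₂ x∈′ with ∈-insert⁻ v _ x∈′
    ... | inj₁ e = inj₂ (inj₁ e)
    ... | inj₂ x∈″ = inj₂ (inj₂ (x∈⁅y⁆⇒x≡y w x∈″))

    triangle-size : ∣ triangle u v w ∣ ≡ 3
    triangle-size = trans (∣insert∣ u _ u∉) (cong suc (trans (∣insert∣ v _ v∉) (cong suc (∣⁅x⁆∣≡1 w))))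
      where
      v∉ : v ∉ ⁅ w ⁆
      v∉ q = v≢w (x∈⁅y⁆⇒x≡y w q)
      u∉ : u ∉ insert v ⁅ w ⁆
      u∉ q with ∈-insert⁻ v _ q
      ... | inj₁ e = u≢v e
      ... | inj₂ q′ = u≢w (x∈⁅y⁆⇒x≡y w q′)

    triangle-triple : Triple (triangle u v w) u v w
    triangle-triple = triple (∈-insert u _) (⊆-insert u _ (∈-insert v _)) (⊆-insert u _ (⊆-insert v _ (x∈⁅x⁆ w))) u≢v u≢w v≢w

  -- The configuration of a cancellative 3-graph

  𝟙-mono : ∀ {p q} {P : Set p} {Q : Set q} (d : Dec P) (e : Dec Q) → (P → Q) → 𝟙 d ≤ 𝟙 e
  𝟙-mono (no _) e h = bit≥0 (𝟙-bit e)
  𝟙-mono (yes x) e h = ≤-reflexive (sym (𝟙-yes e (h x)))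

  𝟙-cong : ∀ {p q} {P : Set p} {Q : Set q} (d : Dec P) (e : Dec Q) → (P → Q) → (Q → P) → 𝟙 d ≡ 𝟙 e
  𝟙-cong d e h h′ = ≤-antisym (𝟙-mono d e h) (𝟙-mono e d h′)

  ∑-𝟙-unique : ∀ {A : Set} {P : A → Set} {Q : Set} (P? : Decidable P) {xs} → Unique xs →
    (∀ {x y} → x List.∈ xs → y List.∈ xs → P x → P y → x ≡ y) → (d : Dec Q) → (∀ {x} → x List.∈ xs → P x → Q) →
    ∑ xs (λ x → 𝟙 (P? x)) ≤ 𝟙 d
  ∑-𝟙-unique P? {xs} u inj (yes _) h = ∑-unique-≤1 u (λ x → 𝟙-bit (P? x))
    λ {x} {y} x∈ y∈ e e′ → inj x∈ y∈ (𝟙-true (P? x) e) (𝟙-true (P? y) e′)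
  ∑-𝟙-unique P? {xs} u inj (no ¬q) h = subst (∑ xs (λ x → 𝟙 (P? x)) ≤_) (∑-zero xs)
    (∑-mono∈ xs λ x x∈ → ≤-reflexive (𝟙-no (P? x) λ p → ¬q (h x∈ p)))

  ∑-Fin-≥three : ∀ {n} {f : Fin n → ℤ} → (∀ x → 0ℤ ≤ f x) → ∀ {a b c} → a ≢ b → a ≢ c → b ≢ c →
    f a + f b + f c ≤ ∑ (allFin n) f
  ∑-Fin-≥three {n} {f} f≥0 {a} {b} {c} a≢b a≢c b≢c = subst (_≤ ∑ (allFin n) f) eq (∑-mono (allFin n) point)
    where
    eq : ∑ (allFin n) (λ i → 𝟙 (a Fin.≟ i) * f i + 𝟙 (b Fin.≟ i) * f i + 𝟙 (c Fin.≟ i) * f i) ≡ f a + f b + f c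
    eq = trans (∑-+ (allFin n) (λ i → 𝟙 (a Fin.≟ i) * f i + 𝟙 (b Fin.≟ i) * f i) (λ i → 𝟙 (c Fin.≟ i) * f i))
      (cong₂ _+_ (trans (∑-+ (allFin n) (λ i → 𝟙 (a Fin.≟ i) * f i) (λ i → 𝟙 (b Fin.≟ i) * f i))
        (cong₂ _+_ (∑-Fin-pick a f) (∑-Fin-pick b f))) (∑-Fin-pick c f))
    first : ∀ x → 1ℤ * x + 0ℤ * x + 0ℤ * x ≡ x
    first = solve-∀
    second : ∀ x → 0ℤ * x + 1ℤ * x + 0ℤ * x ≡ x
    second = solve-∀
    third : ∀ x → 0ℤ * x + 0ℤ * x + 1ℤ * x ≡ x
    third = solve-∀
    none : ∀ x → 0ℤ * x + 0ℤ * x + 0ℤ * x ≡ 0ℤ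
    none = solve-∀
    point : ∀ i → 𝟙 (a Fin.≟ i) * f i + 𝟙 (b Fin.≟ i) * f i + 𝟙 (c Fin.≟ i) * f i ≤ f i
    point i with a Fin.≟ i | b Fin.≟ i | c Fin.≟ i
    ... | yes p | yes q | _ = ⊥-elim (a≢b (trans p (sym q)))
    ... | yes p | no _ | yes q = ⊥-elim (a≢c (trans p (sym q)))
    ... | no _ | yes p | yes q = ⊥-elim (b≢c (trans p (sym q)))
    ... | yes _ | no _ | no _ = ≤-reflexive (first (f i))
    ... | no _ | yes _ | no _ = ≤-reflexive (second (f i))
    ... | no _ | no _ | yes _ = ≤-reflexive (third (f i))
    ... | no _ | no _ | no _ = subst (_≤ f i) (sym (none (f i))) (f≥0 i)

  module Link {n : ℕ} (H : ThreeGraph n) (cancellative : Cancellative H) where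

    size : ∀ {E} → E ∈ₗ edges H → ∣ E ∣ ≡ 3
    size = All.lookup (size3 H)

    edge? : ∀ u v w → Dec (Any (λ E → Triple E u v w) (edges H))
    edge? u v w = Any.any? (λ E → triple? E u v w) (edges H)

    adjacent? : ∀ u v → Dec (Any (λ E → Pair E u v) (edges H))
    adjacent? u v = Any.any? (λ E → pair? E u v) (edges H)

    -- The edges `uvw` and `u′vw` have symmetric difference `{u, u′}`, so an edge containing both
    -- `u` and `u′` would violate cancellativity. Since `u` is missing from `B` and `u′` from `A`,
    -- the three edges are distinct.
    independent : ∀ {u u′ v w} → Any (λ E → Triple E u v w) (edges H) → Any (λ E → Triple E u′ v w) (edges H) →
      ¬ Any (λ E → Pair E u u′) (edges H)
    independent {u} {u′} {v} {w} p q r with List.find p | List.find q | List.find r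
    ... | A , A∈ , α | B , B∈ , β | C , C∈ , pair u∈C u′∈C u≢u′ =
      cancellative (A , B , C , A∈ , B∈ , C∈ , A≢B , B≢C , A≢C , difference)
      where
      u′∉A : u′ ∉ A
      u′∉A u′∈ with triple-only (size A∈) α u′∈
      ... | inj₁ e = u≢u′ (sym e)
      ... | inj₂ (inj₁ e) = Triple.u≢v β e
      ... | inj₂ (inj₂ e) = Triple.u≢w β e
      u∉B : u ∉ B
      u∉B u∈ with triple-only (size B∈) β u∈
      ... | inj₁ e = u≢u′ e
      ... | inj₂ (inj₁ e) = Triple.u≢v α e
      ... | inj₂ (inj₂ e) = Triple.u≢w α e
      A≢B : A ≢ B
      A≢B refl = u∉B (Triple.u∈ α)
      B≢C : B ≢ C
      B≢C refl = u∉B u∈C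
      A≢C : A ≢ C
      A≢C refl = u′∉A u′∈C
      difference : ∀ x → ((x ∈ A × x ∉ B) ⊎ (x ∈ B × x ∉ A)) → x ∈ C
      difference x (inj₁ (x∈ , x∉)) with triple-only (size A∈) α x∈
      ... | inj₁ refl = u∈C
      ... | inj₂ (inj₁ refl) = ⊥-elim (x∉ (Triple.v∈ β))
      ... | inj₂ (inj₂ refl) = ⊥-elim (x∉ (Triple.w∈ β))
      difference x (inj₂ (x∈ , x∉)) with triple-only (size B∈) β x∈
      ... | inj₁ refl = u′∈C
      ... | inj₂ (inj₁ refl) = ⊥-elim (x∉ (Triple.v∈ α))
      ... | inj₂ (inj₂ refl) = ⊥-elim (x∉ (Triple.w∈ α))

    config : Config (Fin n)
    config = record
      { V = allFin n
      ; complete = ∈-allFin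
      ; τ = λ u v w → 𝟙 (edge? u v w)
      ; γ = λ u v → 𝟙 (adjacent? u v)
      ; τ-bit = λ u v w → 𝟙-bit (edge? u v w)
      ; γ-bit = λ u v → 𝟙-bit (adjacent? u v)
      ; τ-swap₁₂ = λ u v w → 𝟙-cong (edge? u v w) (edge? v u w) (Any.map triple-swap₁₂) (Any.map triple-swap₁₂)
      ; τ-swap₂₃ = λ u v w → 𝟙-cong (edge? u v w) (edge? u w v) (Any.map triple-swap₂₃) (Any.map triple-swap₂₃)
      ; γ-sym = λ u v → 𝟙-cong (adjacent? u v) (adjacent? v u) (Any.map pair-sym) (Any.map pair-sym)
      ; γ-irrefl = λ u → 𝟙-no (adjacent? u u) λ p → Pair.u≢v (proj₂ (proj₂ (List.find p))) refl
      ; τ≤γ = λ u v w → 𝟙-mono (edge? u v w) (adjacent? v w) (Any.map λ t → pair (Triple.v∈ t) (Triple.w∈ t) (Triple.v≢w t))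
      ; indep = λ {u} {u′} {v} {w} e e′ → 𝟙-no (adjacent? u u′) (independent (𝟙-true (edge? u v w) e) (𝟙-true (edge? u′ v w) e′))
      }
      where
      pair-sym : ∀ {E : Subset n} {u v} → Pair E u v → Pair E v u
      pair-sym (pair a b p) = pair b a (≢-sym p)

    open Config config using (V; τ; γ)
    open Counting config using (S; g; t) renaming (n to n′)

    n′≡ : n′ ≡ + n
    n′≡ = trans (∑-length (allFin n)) (cong (λ m → + m) (length-tabulate (λ i → i)))

    pairs-in : ∀ E → ∣ E ∣ ≡ 2 → + 2 ≤ S λ u → S λ v → 𝟙 (pair? E u v)
    pairs-in E e = from (some-pair E e)
      where
      row≥0 : ∀ u → 0ℤ ≤ S λ v → 𝟙 (pair? E u v)
      row≥0 u = ∑-≥0 V λ v → bit≥0 (𝟙-bit (pair? E u v))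
      at : ∀ u v → Pair E u v → 1ℤ ≤ S λ v → 𝟙 (pair? E u v)
      at u v h = subst (_≤ (S λ v → 𝟙 (pair? E u v))) (𝟙-yes (pair? E u v) h)
        (∑-≥term V (λ v → bit≥0 (𝟙-bit (pair? E u v))) (∈-allFin v))
      from : (∃ λ u → ∃ λ v → Pair E u v) → + 2 ≤ S λ u → S λ v → 𝟙 (pair? E u v)
      from (u , v , pair a b p) = ≤-trans (+-mono-≤ (at u v (pair a b p)) (at v u (pair b a (≢-sym p))))
          (∑-≥two V row≥0 (∈-allFin u) (∈-allFin v) p)

    -- The six orderings arise from three choices of the outermost variable and two orders of the
    -- remaining vertices.
    triples-in : ∀ E → ∣ E ∣ ≡ 3 → + 6 ≤ S λ u → S λ v → S λ w → 𝟙 (triple? E w u v)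
    triples-in E e = from (some-triple E e)
      where
      row≥0 : ∀ u v → 0ℤ ≤ S λ w → 𝟙 (triple? E w u v)
      row≥0 u v = ∑-≥0 V λ w → bit≥0 (𝟙-bit (triple? E w u v))
      at : ∀ u v w → Triple E w u v → 1ℤ ≤ S λ w → 𝟙 (triple? E w u v)
      at u v w h = subst (_≤ (S λ w → 𝟙 (triple? E w u v))) (𝟙-yes (triple? E w u v) h)
        (∑-≥term V (λ w → bit≥0 (𝟙-bit (triple? E w u v))) (∈-allFin w))
      plane : ∀ u v w → Triple E w u v → + 2 ≤ S λ v → S λ w → 𝟙 (triple? E w u v)
      plane u v w h = ≤-trans (+-mono-≤ (at u v w h) (at u w v (triple-swap₁₂ (triple-swap₂₃ (triple-swap₁₂ h)))))
        (∑-≥two V (row≥0 u) (∈-allFin v) (∈-allFin w) (≢-sym (Triple.u≢w h)))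
      from : (∃ λ u → ∃ λ v → ∃ λ w → Triple E u v w) → + 6 ≤ S λ u → S λ v → S λ w → 𝟙 (triple? E w u v)
      from (u , v , w , t) = ≤-trans
        (+-mono-≤ (+-mono-≤ (plane u v w (triple-swap₁₂ (triple-swap₂₃ t))) (plane v u w (triple-swap₁₂ (triple-swap₂₃ (triple-swap₁₂ t)))))
          (plane w u v (triple-swap₂₃ (triple-swap₁₂ t))))
        (∑-Fin-≥three (λ u → ∑-≥0 V λ v → row≥0 u v) (Triple.u≢v t) (Triple.u≢w t) (Triple.v≢w t))

    -- Double counting: three distinct vertices determine their edge, so no ordered triple is
    -- charged to two edges.
    edge-count : + 6 * + ∣ H ∣ₑ ≤ t
    edge-count = subst (_≤ t) (trans (∑-const (edges H) (+ 6)) (cong (+ 6 *_) (∑-length (edges H))))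
      (≤-trans (∑-mono∈ (edges H) λ E E∈ → triples-in E (size E∈))
        (≤-trans (≤-reflexive swap) (∑-mono V λ u → ∑-mono V λ v → ∑-mono V λ w →
          ∑-𝟙-unique (λ E → triple? E w u v) (unique H) (λ E∈ F∈ → triple-determines (size E∈) (size F∈)) (edge? w u v) List.lose)))
      where
      swap : ∑ (edges H) (λ E → S λ u → S λ v → S λ w → 𝟙 (triple? E w u v)) ≡
             S λ u → S λ v → S λ w → ∑ (edges H) (λ E → 𝟙 (triple? E w u v))
      swap = trans (∑-swap (edges H) V λ E u → S λ v → S λ w → 𝟙 (triple? E w u v)) (∑-cong V λ u →
        trans (∑-swap (edges H) V λ E v → S λ w → 𝟙 (triple? E w u v)) (∑-cong V λ v →
          ∑-swap (edges H) V λ E w → 𝟙 (triple? E w u v)))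

    shadow-count : + 2 * + length (shadow H) ≤ g
    shadow-count = subst (_≤ g) (trans (∑-const (shadow H) (+ 2)) (cong (+ 2 *_) (∑-length (shadow H))))
      (≤-trans (∑-mono∈ (shadow H) λ A A∈ → pairs-in A (proj₁ (in-shadow A∈)))
        (≤-trans (≤-reflexive swap) (∑-mono V λ u → ∑-mono V λ v →
          ∑-𝟙-unique (λ A → pair? A u v) (Unique.filter⁺ shadow? (allSubsets-unique n))
            (λ A∈ B∈ → pair-determines (proj₁ (in-shadow A∈)) (proj₁ (in-shadow B∈))) (adjacent? u v)
            λ A∈ p → Any.map (λ A⊆E → pair (A⊆E (Pair.u∈ p)) (A⊆E (Pair.v∈ p)) (Pair.u≢v p)) (proj₂ (in-shadow A∈)))))
      where
      shadow? : Decidable (λ A → ∣ A ∣ ≡ 2 × Any (A ⊆_) (edges H))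
      shadow? A = (∣ A ∣ ℕ.≟ 2) ×-dec Any.any? (A ⊆?_) (edges H)
      in-shadow : ∀ {A} → A List.∈ shadow H → ∣ A ∣ ≡ 2 × Any (A ⊆_) (edges H)
      in-shadow A∈ = proj₂ (∈-filter⁻ shadow? {xs = allSubsets n} A∈)
      swap : ∑ (shadow H) (λ A → S λ u → S λ v → 𝟙 (pair? A u v)) ≡ S λ u → S λ v → ∑ (shadow H) (λ A → 𝟙 (pair? A u v))
      swap = trans (∑-swap (shadow H) V λ A u → S λ v → 𝟙 (pair? A u v)) (∑-cong V λ u →
        ∑-swap (shadow H) V λ A v → 𝟙 (pair? A u v))

    -- The Steiner triple system and the edges that survive

    module Colour {k : ℕ} {Δ : ℤ} (Δ≥0 : 0ℤ ≤ Δ) (pattern-of : Pattern config k Δ) where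
      open Pattern pattern-of

      -- An edge is an unordered set and `Big` a relation on ordered triples, so a block is
      -- recognised by one ordering; the symmetry of `Big` extends this to all six.
      Block : Subset k → Set
      Block F = ∣ F ∣ ≡ 3 × ∃ λ i → ∃ λ j → ∃ λ l → Triple F i j l × Big i j l

      block? : Decidable Block
      block? F = (∣ F ∣ ℕ.≟ 3) ×-dec Fin.any? λ i → Fin.any? λ j → Fin.any? λ l → triple? F i j l ×-dec Big? i j l

      system : ThreeGraph k
      system = record
        { edges = filter block? (allSubsets k)
        ; unique = Unique.filter⁺ block? (allSubsets-unique k)
        ; size3 = All.tabulate λ F∈ → proj₁ (proj₂ (∈-filter⁻ block? {xs = allSubsets k} F∈)) }

      block-∈ : ∀ {F} → Block F → F ∈ₗ edges system
      block-∈ b = ∈-filter⁺ block? (allSubsets-complete _) b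

      block-of : ∀ {F} → F ∈ₗ edges system → Block F
      block-of F∈ = proj₂ (∈-filter⁻ block? {xs = allSubsets k} F∈)

      Big-irrefl₁₃ : ∀ {i j} → ¬ Big i j i
      Big-irrefl₁₃ h = Big-irrefl (Big-swap₂₃ h)

      Big-irrefl₂₃ : ∀ {i j} → ¬ Big i j j
      Big-irrefl₂₃ h = Big-irrefl₁₃ (Big-swap₁₂ h)

      Big⇒distinct : ∀ {i j l} → Big i j l → i ≢ j × i ≢ l × j ≢ l
      Big⇒distinct h = (λ { refl → Big-irrefl h }) , (λ { refl → Big-irrefl₁₃ h }) , λ { refl → Big-irrefl₂₃ h }

      Big⇒block : ∀ {i j l} → Big i j l → triangle i j l ∈ₗ edges system
      Big⇒block {i} {j} {l} h with Big⇒distinct h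
      ... | p , q , r = block-∈ (triangle-size p q r , i , j , l , triangle-triple p q r , h)

      -- `Big-unique` compares triples with the same first two entries. The witness ordering of a
      -- block is arbitrary, so the swaps bring `x` and `y` to the front, one case for each pair of
      -- positions.
      third : ∀ {F x y} → F ∈ₗ edges system → x ∈ F → y ∈ F → x ≢ y → ∃ λ l → Triple F x y l × Big x y l
      third {F} {x} {y} F∈ x∈ y∈ x≢y with block-of F∈
      ... | size₃ , i , j , l , t , h with triple-only size₃ t x∈ | triple-only size₃ t y∈
      ... | inj₁ refl | inj₁ refl = ⊥-elim (x≢y refl)
      ... | inj₁ refl | inj₂ (inj₁ refl) = l , t , h
      ... | inj₁ refl | inj₂ (inj₂ refl) = j , triple-swap₂₃ t , Big-swap₂₃ h
      ... | inj₂ (inj₁ refl) | inj₁ refl = l , triple-swap₁₂ t , Big-swap₁₂ h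
      ... | inj₂ (inj₁ refl) | inj₂ (inj₁ refl) = ⊥-elim (x≢y refl)
      ... | inj₂ (inj₁ refl) | inj₂ (inj₂ refl) = i , triple-swap₂₃ (triple-swap₁₂ t) , Big-swap₂₃ (Big-swap₁₂ h)
      ... | inj₂ (inj₂ refl) | inj₁ refl = j , triple-swap₁₂ (triple-swap₂₃ t) , Big-swap₁₂ (Big-swap₂₃ h)
      ... | inj₂ (inj₂ refl) | inj₂ (inj₁ refl) = i , triple-swap₁₂ (triple-swap₂₃ (triple-swap₁₂ t)) , Big-swap₁₂ (Big-swap₂₃ (Big-swap₁₂ h))
      ... | inj₂ (inj₂ refl) | inj₂ (inj₂ refl) = ⊥-elim (x≢y refl)

      system-IsSTS : IsSTS system
      system-IsSTS x y x≢y with Big-exists x≢y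
      ... | l , h with Big⇒distinct h
      ... | p , q , r = triangle x y l , (Big⇒block h , Triple.u∈ t₀ , Triple.v∈ t₀) , λ F F∈ x∈ y∈ → same F F∈ (third F∈ x∈ y∈ x≢y)
        where
        t₀ : Triple (triangle x y l) x y l
        t₀ = triangle-triple p q r
        same : ∀ F → F ∈ₗ edges system → (∃ λ l′ → Triple F x y l′ × Big x y l′) → F ≡ triangle x y l
        same F F∈ (l′ , t′ , h′) with Big-unique h h′
        ... | refl = triple-determines (proj₁ (block-of F∈)) (triangle-size p q r) t′ t₀

      Good : Subset n → Set
      Good E = ∃ λ u → ∃ λ v → ∃ λ w → Triple E u v w × Big (φ u) (φ v) (φ w)

      good? : Decidable Good
      good? E = Fin.any? λ u → Fin.any? λ v → Fin.any? λ w → triple? E u v w ×-dec Big? (φ u) (φ v) (φ w)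

      kept : ThreeGraph n
      kept = record
        { edges = filter good? (edges H)
        ; unique = Unique.filter⁺ good? (unique H)
        ; size3 = all-filter⁺ good? (size3 H) }

      kept-⊆ : SubGraph kept H
      kept-⊆ E E∈ = proj₁ (∈-filter⁻ good? {xs = edges H} E∈)

      -- The three colours of a kept edge are distinct by `Big⇒distinct`, so its image has three
      -- elements and is a block.
      kept-colorable : Colorable kept system
      kept-colorable = φ , image
        where
        image : ∀ E → E ∈ₗ edges kept → Σ (Subset k) λ F → F ∈ₗ edges system ×
          (∀ y → y ∈ F → Σ (Fin n) λ x → x ∈ E × φ x ≡ y) × (∀ x → x ∈ E → φ x ∈ F)
        image E E∈ with ∈-filter⁻ good? {xs = edges H} E∈
        ... | E∈H , u , v , w , t , h with Big⇒distinct h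
        ... | p , q , r = triangle (φ u) (φ v) (φ w) , Big⇒block h , onto , into
          where
          t′ : Triple (triangle (φ u) (φ v) (φ w)) (φ u) (φ v) (φ w)
          t′ = triangle-triple p q r
          onto : ∀ y → y ∈ triangle (φ u) (φ v) (φ w) → Σ (Fin n) λ x → x ∈ E × φ x ≡ y
          onto y y∈ with triangle-∈ p q r y∈
          ... | inj₁ refl = u , Triple.u∈ t , refl
          ... | inj₂ (inj₁ refl) = v , Triple.v∈ t , refl
          ... | inj₂ (inj₂ refl) = w , Triple.w∈ t , refl
          into : ∀ x → x ∈ E → φ x ∈ triangle (φ u) (φ v) (φ w)
          into x x∈ with triple-only (size E∈H) t x∈
          ... | inj₁ refl = Triple.u∈ t′
          ... | inj₂ (inj₁ refl) = Triple.v∈ t′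
          ... | inj₂ (inj₂ refl) = Triple.w∈ t′

      bad : Fin n → Fin n → Fin n → ℤ
      bad u v w = 1ℤ - 𝟙 (Big? (φ u) (φ v) (φ w))

      bad≥0 : ∀ u v w → 0ℤ ≤ bad u v w
      bad≥0 u v w = bit≥0 (bit-co (𝟙-bit (Big? (φ u) (φ v) (φ w))))

      -- A removed edge has no good ordering, so any one of its orderings contributes a unit to the
      -- right side, and no ordering belongs to two edges.
      removed : + ∣ H ∣ₑ - + ∣ kept ∣ₑ ≤ S λ u → S λ v → S λ w → τ u v w * bad u v w
      removed = subst (_≤ (S λ u → S λ v → S λ w → τ u v w * bad u v w)) difference
        (≤-trans (∑-mono∈ (edges H) bad-edge) (≤-trans (≤-reflexive swap)
          (∑-mono V λ u → ∑-mono V λ v → ∑-mono V λ w → point u v w)))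
        where
        weight : Subset n → Fin n → Fin n → Fin n → ℤ
        weight E u v w = bad u v w * 𝟙 (triple? E u v w)
        weight≥0 : ∀ E u v w → 0ℤ ≤ weight E u v w
        weight≥0 E u v w = bad≥0 u v w ⊗ bit≥0 (𝟙-bit (triple? E u v w))
        bad-edge : ∀ E → E ∈ₗ edges H → 1ℤ - 𝟙 (good? E) ≤ S λ u → S λ v → S λ w → weight E u v w
        bad-edge E E∈ = from (good? E) (some-triple E (size E∈))
          where
          from : (d : Dec (Good E)) → (∃ λ u → ∃ λ v → ∃ λ w → Triple E u v w) →
            1ℤ - 𝟙 d ≤ S λ u → S λ v → S λ w → weight E u v w
          from (yes _) _ = ∑-≥0 V λ u → ∑-≥0 V λ v → ∑-≥0 V λ w → weight≥0 E u v w
          from (no ¬good) (u , v , w , t) = ≤-trans (≤-reflexive (sym (cong₂ _*_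
                (cong (λ z → 1ℤ - z) (𝟙-no (Big? (φ u) (φ v) (φ w)) λ h → ¬good (u , v , w , t , h))) (𝟙-yes (triple? E u v w) t))))
              (≤-trans (∑-≥term V (weight≥0 E u v) (∈-allFin w))
              (≤-trans (∑-≥term V (λ v → ∑-≥0 V λ w → weight≥0 E u v w) (∈-allFin v))
                (∑-≥term V (λ u → ∑-≥0 V λ v → ∑-≥0 V λ w → weight≥0 E u v w) (∈-allFin u))))
        swap : ∑ (edges H) (λ E → S λ u → S λ v → S λ w → weight E u v w) ≡
               S λ u → S λ v → S λ w → ∑ (edges H) (λ E → weight E u v w)
        swap = trans (∑-swap (edges H) V λ E u → S λ v → S λ w → weight E u v w) (∑-cong V λ u →
          trans (∑-swap (edges H) V λ E v → S λ w → weight E u v w) (∑-cong V λ v →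
            ∑-swap (edges H) V λ E w → weight E u v w))
        point : ∀ u v w → ∑ (edges H) (λ E → weight E u v w) ≤ τ u v w * bad u v w
        point u v w = ≤-trans (≤-reflexive (∑-lin1 (edges H) (bad u v w) (λ E → 𝟙 (triple? E u v w)) λ E → refl))
          (≤-trans (scale-≤ (bad u v w) _ (τ u v w) (bad≥0 u v w)
            (∑-𝟙-unique (λ E → triple? E u v w) (unique H) (λ E∈ F∈ → triple-determines (size E∈) (size F∈)) (edge? u v w) List.lose)) (≤-reflexive (*-comm (bad u v w) (τ u v w))))
        difference : ∑ (edges H) (λ E → 1ℤ - 𝟙 (good? E)) ≡ + ∣ H ∣ₑ - + ∣ kept ∣ₑ
        difference = trans (∑-lin2 (edges H) 1ℤ (λ _ → 1ℤ) -1ℤ (λ E → 𝟙 (good? E)) λ E → alg (𝟙 (good? E)))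
          (trans (cong₂ (λ x y → 1ℤ * x + -1ℤ * y) (∑-length (edges H))
            (trans (∑-cong (edges H) λ E → sym (*-identityʳ (𝟙 (good? E))))
              (trans (sym (∑-filter good? (edges H) (λ _ → 1ℤ))) (∑-length (edges kept)))))
            (alg₁ (+ ∣ H ∣ₑ) (+ ∣ kept ∣ₑ)))
          where
          alg : ∀ x → 1ℤ - x ≡ 1ℤ * 1ℤ + -1ℤ * x
          alg = solve-∀
          alg₁ : ∀ x y → 1ℤ * x + -1ℤ * y ≡ x - y
          alg₁ = solve-∀

      removed-few : Δ * (+ ∣ H ∣ₑ - + ∣ kept ∣ₑ) ≤ + n * + n * + n
      removed-few = subst (λ m → Δ * (+ ∣ H ∣ₑ - + ∣ kept ∣ₑ) ≤ m * m * m) n′≡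
        (≤-trans (scale-≤ Δ _ _ Δ≥0 removed) fits)

module RationalBounds where
  open import Data.Nat using (ℕ; zero; suc; z≤n; s≤s)
  import Data.Nat as ℕ
  import Data.Nat.Properties as ℕ
  open import Data.Integer using (+_; +≤+)
  import Data.Integer as ℤ
  import Data.Integer.Properties as ℤ
  open import Data.Rational
  open import Data.Rational.Properties
  open import Data.Rational.Unnormalised using (ℚᵘ; mkℚᵘ; *≤*) renaming (_≃_ to _≃ᵘ_)
  import Data.Rational.Unnormalised.Properties as ℚᵘ
  open import Algebra.Properties.Group +-0-group using () renaming (⁻¹-involutive to neg-involutive)
  open import Data.Product using (Σ; _×_; _,_)
  open import Data.Sum using (inj₁; inj₂)
  open import Data.Empty using (⊥-elim)
  open import Relation.Binary.PropositionalEquality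
  open import Relation.Nullary using (yes; no)

  -- Rational estimates

  frac-ℚᵘ : ∀ a b → toℚᵘ (frac a (suc b)) ≃ᵘ mkℚᵘ (+ a) b
  frac-ℚᵘ a b = toℚᵘ-fromℚᵘ (mkℚᵘ (+ a) b)

  frac-pos : ∀ b → 1 ℕ.≤ b → 0ℚ < frac 1 b
  frac-pos (suc b) _ = toℚᵘ-cancel-< (ℚᵘ.<-respʳ-≃ (ℚᵘ.≃-sym (frac-ℚᵘ 1 b)) (Data.Rational.Unnormalised.*<* (ℤ.+<+ (s≤s z≤n))))

  x²≤y²⇒-x≤y : ∀ x y → 0ℚ ≤ y → x * x ≤ y * y → - x ≤ y
  x²≤y²⇒-x≤y x y 0≤y h with - x ≤? y
  ... | yes p = p
  ... | no ¬p = ⊥-elim (<-irrefl refl (<-≤-trans y²<x² h))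
    where
    y<-x : y < - x
    y<-x = ≰⇒> ¬p
    y²<x² : y * y < x * x
    y²<x² = subst (y * y <_) (trans (sym (neg-distribʳ-* (- x) x)) (trans (cong -_ (sym (neg-distribˡ-* x x))) (neg-involutive (x * x))))
      (≤-<-trans (*-monoˡ-≤-nonNeg y {{nonNegative 0≤y}} (<⇒≤ y<-x))
        (*-monoˡ-<-pos (- x) {{positive (≤-<-trans 0≤y y<-x)}} y<-x))

  sq≥0 : ∀ x → 0ℚ ≤ x * x
  sq≥0 x with ≤-total 0ℚ x
  ... | inj₁ 0≤x = subst (_≤ x * x) (*-zeroʳ x) (*-monoˡ-≤-nonNeg x {{nonNegative 0≤x}} 0≤x)
  ... | inj₂ x≤0 = subst (_≤ x * x) (*-zeroʳ x) (*-monoˡ-≤-nonPos x {{nonPositive x≤0}} x≤0)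

  sq≤sumˡ : ∀ x y {z} → x * x + y * y ≤ z → x * x ≤ z
  sq≤sumˡ x y h = ≤-trans (subst (_≤ x * x + y * y) (+-identityʳ (x * x)) (+-monoʳ-≤ (x * x) (sq≥0 y))) h

  sq≤sumʳ : ∀ x y {z} → x * x + y * y ≤ z → y * y ≤ z
  sq≤sumʳ x y h = ≤-trans (subst (_≤ x * x + y * y) (+-identityˡ (y * y)) (+-monoˡ-≤ (y * y) (sq≥0 x))) h

  sub-≤⇒≤-add : ∀ s p y → - (s - p) ≤ y → p ≤ s + y
  sub-≤⇒≤-add s p y h = subst (_≤ s + y) eq (+-monoʳ-≤ s h)
    where
    eq : s + - (s - p) ≡ p
    eq = trans (cong (λ z → s + z) (trans (neg-distrib-+ s (- p)) (cong (λ z → - s + z) (neg-involutive p))))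
      (trans (sym (+-assoc s (- s) p)) (trans (cong (_+ p) (+-inverseʳ s)) (+-identityˡ p)))

  -- Each square is at most `y * y`. The result is phrased as lower bounds on `s` and `s′`, because
  -- the counting argument works with the deficits of the two densities.
  within-disc : ∀ s p s′ p′ y → 0ℚ ≤ y → (s - p) * (s - p) + (s′ - p′) * (s′ - p′) ≤ y * y →
    p ≤ s + y × p′ ≤ s′ + y
  within-disc s p s′ p′ y 0≤y h =
    sub-≤⇒≤-add s p y (x²≤y²⇒-x≤y (s - p) y 0≤y (sq≤sumˡ (s - p) (s′ - p′) h)) ,
    sub-≤⇒≤-add s′ p′ y (x²≤y²⇒-x≤y (s′ - p′) y 0≤y (sq≤sumʳ (s - p) (s′ - p′) h))

  square-pos : ∀ y → 0ℚ < y → 0ℚ < y * y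
  square-pos y 0<y = subst (_< y * y) (*-zeroʳ y) (*-monoʳ-<-pos y {{positive 0<y}} 0<y)

  frac-≤⇒ : ∀ {p q a b e} → 1 ℕ.≤ q → 1 ℕ.≤ b → 1 ℕ.≤ e → frac p q ≤ frac a b + frac 1 e →
    + p ℤ.* (+ b ℤ.* + e) ℤ.≤ (+ a ℤ.* + e ℤ.+ + b) ℤ.* + q
  frac-≤⇒ {p} {suc q} {a} {suc b} {suc e} _ _ _ h = subst (λ z → + p ℤ.* (+ suc b ℤ.* + suc e) ℤ.≤ (+ a ℤ.* + suc e ℤ.+ z) ℤ.* + suc q)
    (ℤ.*-identityˡ (+ suc b))
    (ℚᵘ.drop-*≤* (ℚᵘ.≤-respˡ-≃ (frac-ℚᵘ p q) (ℚᵘ.≤-respʳ-≃ (ℚᵘ.≃-trans (toℚᵘ-homo-+ (frac a (suc b)) (frac 1 (suc e)))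
      (ℚᵘ.+-cong (frac-ℚᵘ a b) (frac-ℚᵘ 1 e))) (toℚᵘ-mono-≤ h))))

  -- A positive rational has numerator at least 1, so the reciprocal of its denominator is at most
  -- the rational itself.
  reciprocal-below : ∀ δ → 0ℚ < δ → Σ ℕ λ Δ → frac 1 (suc Δ) ≤ δ
  reciprocal-below (mkℚ (+ zero) d c) (*<* (ℤ.+<+ ()))
  reciprocal-below (mkℚ (ℤ.-[1+ m ]) d c) (*<* ())
  reciprocal-below δ@(mkℚ (+ suc m) d c) _ = d , toℚᵘ-cancel-≤ (ℚᵘ.≤-respˡ-≃ (ℚᵘ.≃-sym (frac-ℚᵘ 1 d))
    (*≤* (+≤+ (ℕ.*-monoˡ-≤ (suc d) (s≤s {0} {m} z≤n)))))

  frac-bound : ∀ {δ} m N Δ → frac 1 (suc Δ) ≤ δ → suc Δ ℕ.* m ℕ.≤ N → frac m 1 ≤ δ * frac N 1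
  frac-bound {δ} m N Δ hδ h = ≤-trans base (*-monoʳ-≤-nonNeg (frac N 1) {{nonNegative frac≥0}} hδ)
    where
    frac≥0 : 0ℚ ≤ frac N 1
    frac≥0 = toℚᵘ-cancel-≤ (ℚᵘ.≤-respʳ-≃ (ℚᵘ.≃-sym (frac-ℚᵘ N 0)) (*≤* (ℤ.≤-trans (+≤+ z≤n) (ℤ.≤-reflexive (sym (ℤ.*-identityʳ (+ N)))))))
    base : frac m 1 ≤ frac 1 (suc Δ) * frac N 1
    base = toℚᵘ-cancel-≤ (ℚᵘ.≤-respˡ-≃ (ℚᵘ.≃-sym (frac-ℚᵘ m 0)) (ℚᵘ.≤-respʳ-≃
      (ℚᵘ.≃-sym (ℚᵘ.≃-trans (toℚᵘ-homo-* (frac 1 (suc Δ)) (frac N 1)) (ℚᵘ.*-cong (frac-ℚᵘ 1 Δ) (frac-ℚᵘ N 0))))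
      (*≤* (subst₂ ℤ._≤_ (trans (cong +_ (ℕ.*-comm (suc Δ) m)) (trans (ℤ.pos-* m (suc Δ)) (cong (λ z → + m ℤ.* + z) (sym (ℕ.*-identityʳ (suc Δ))))))
        (sym (trans (ℤ.*-identityʳ (+ 1 ℤ.* + N)) (ℤ.*-identityˡ (+ N)))) (+≤+ h)))))

module FromDensities where
  open StableConfigurations
  open Hypergraphs
  open RationalBounds
  open import Data.Integer hiding (suc; ∣_∣)
  open import Data.Integer.Properties
  open import Data.Integer.Tactic.RingSolver
  open import Data.Nat using (ℕ; zero; suc; z≤n; s≤s)
  import Data.Nat as ℕ
  import Data.Nat.Properties as ℕ
  open import Data.Nat.Combinatorics using (_C_; nC1≡n; nCk+nC[k+1]≡[n+1]C[k+1])
  open import Data.List using (_∷_; []; length)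
  open import Data.List.Properties using (length-filter)
  import Data.Rational as ℚ
  import Data.Rational.Properties as ℚ
  open import Data.Product using (Σ; _×_; _,_; proj₁; proj₂)
  open import Data.Empty using (⊥-elim)
  open import Relation.Binary.PropositionalEquality

  -- Binomial coefficients and the density hypotheses

  2*C₂ : ∀ n → + 2 * + (n C 2) ≡ + n * (+ n - 1ℤ)
  2*C₂ zero = refl
  2*C₂ (suc n) = trans (cong (λ z → + 2 * + z) (sym (nCk+nC[k+1]≡[n+1]C[k+1] n 1)))
    (trans (cong (λ z → + 2 * (+ z + + (n C 2))) (nC1≡n n)) (trans (alg (+ n) (+ (n C 2))) (trans (cong (λ z → + 2 * + n + z) (2*C₂ n)) (alg′ (+ n)))))
    where
    alg : ∀ x y → + 2 * (x + y) ≡ + 2 * x + + 2 * y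
    alg = solve-∀
    alg′ : ∀ x → + 2 * x + x * (x - 1ℤ) ≡ (1ℤ + x) * (1ℤ + x - 1ℤ)
    alg′ = solve-∀

  -- Induction by Pascal's rule. In `ℤ` the product vanishes for `n` below 3, so no case is
  -- exceptional.
  6*C₃ : ∀ n → + 6 * + (n C 3) ≡ + n * (+ n - 1ℤ) * (+ n - + 2)
  6*C₃ zero = refl
  6*C₃ (suc n) = trans (cong (λ z → + 6 * + z) (sym (nCk+nC[k+1]≡[n+1]C[k+1] n 2)))
    (trans (alg (+ (n C 2)) (+ (n C 3))) (trans (cong₂ (λ x y → + 3 * x + y) (2*C₂ n) (6*C₃ n)) (alg′ (+ n))))
    where
    alg : ∀ x y → + 6 * (x + y) ≡ + 3 * (+ 2 * x) + + 6 * y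
    alg = solve-∀
    alg′ : ∀ x → + 3 * (x * (x - 1ℤ)) + x * (x - 1ℤ) * (x - + 2) ≡ (1ℤ + x) * (1ℤ + x - 1ℤ) * (1ℤ + x - + 2)
    alg′ = solve-∀

  factor-positive : ∀ c m {X} → + c * + m ≡ X → 1ℤ ≤ X → 1 ℕ.≤ m
  factor-positive c (suc m) e h = s≤s z≤n
  factor-positive c zero refl h = ⊥-elim (<⇒≱ (1≤⇒0< h) (≤-reflexive (*-zeroʳ (+ c))))

  C₂-positive : ∀ n → 3 ℕ.≤ n → 1 ℕ.≤ n C 2
  C₂-positive n@(suc (suc (suc m))) (s≤s (s≤s (s≤s h))) = factor-positive 2 (n C 2) (2*C₂ n)
    (1≤* {+ n} {+ suc (suc m)} 1≤+ 1≤+)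

  C₃-positive : ∀ n → 3 ℕ.≤ n → 1 ℕ.≤ n C 3
  C₃-positive n@(suc (suc (suc m))) (s≤s (s≤s (s≤s h))) = factor-positive 6 (n C 3) (6*C₃ n)
    (1≤* {+ n * + suc (suc m)} {+ suc m} (1≤* {+ n} {+ suc (suc m)} 1≤+ 1≤+) 1≤+)

  scaled : ∀ c p q C X a E → 0ℤ ≤ c → c * C ≡ X → p * (C * E) ≤ (a * E + C) * q → p * (X * E) ≤ (c * a * E + X) * q
  scaled c p q C X a E pc refl h = cert (pc ⊗ le⇒0≤ h) (solve (c ∷ p ∷ q ∷ C ∷ a ∷ E ∷ []))

  -- The tolerance `1 / E` contributes at most `k n²`, and replacing `n (n - 1)` by `n²` costs at
  -- most `(k - 1) n²` because `E ≤ n`. The factor `4 k²` in `E` covers both.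
  shadow-arith : ∀ k n N E A g → 1ℤ ≤ k → 1ℤ ≤ n → E ≡ + 4 * (k * k) * N → 0ℤ ≤ E → E ≤ n →
    (k - 1ℤ) * (n * (n - 1ℤ) * E) ≤ (A * E + n * (n - 1ℤ)) * k → A ≤ g →
    N * ((k - 1ℤ) * (n * n) - k * g) ≤ n * n
  shadow-arith k n N E A g k≥1 n≥1 E≡ E≥0 E≤n h hA = cancel (+ 4 * (k * k)) (1≤⇒0< (1≤* {+ 4} {k * k} 1≤+ (1≤* k≥1 k≥1)))
    (subst (_≤ + 4 * (k * k) * (n * n)) (trans (cong (_* ((k - 1ℤ) * (n * n) - k * g)) E≡) (*-assoc (+ 4 * (k * k)) N ((k - 1ℤ) * (n * n) - k * g)))
      (alg k n E A g k≥1 n≥1 E≥0 E≤n h hA))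
    where
    alg : ∀ k n E A g → 1ℤ ≤ k → 1ℤ ≤ n → 0ℤ ≤ E → E ≤ n →
      (k - 1ℤ) * (n * (n - 1ℤ) * E) ≤ (A * E + n * (n - 1ℤ)) * k → A ≤ g →
      E * ((k - 1ℤ) * (n * n) - k * g) ≤ + 4 * (k * k) * (n * n)
    alg k n E A g k≥1 n≥1 E≥0 E≤n h hA = cert (le⇒0≤ h ⊕ E≥0 ⊗ k≥0 ⊗ le⇒0≤ hA ⊕ le⇒0≤ k≥1 ⊗ n≥0 ⊗ le⇒0≤ E≤n
        ⊕ n≥0 ⊗ n≥0 ⊗ (0≤+ {2} ⊗ k≥0 ⊗ le⇒0≤ k≥1 ⊕ 0≤+ {2} ⊗ (k≥0 ⊗ k≥0) ⊕ 0≤+ {1}) ⊕ k≥0 ⊗ n≥0)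
      (solve (k ∷ n ∷ E ∷ A ∷ g ∷ []))
      where
      k≥0 = 1≤⇒0≤ k≥1
      n≥0 = 1≤⇒0≤ n≥1

  -- As for the shadow: the tolerance contributes at most `k² n³` and the replacement of
  -- `n (n - 1) (n - 2)` by `n³` at most `3 (k - 1) n³`. Together this is below `4 k² n³`, the
  -- source of the constant in `E`.
  edge-arith : ∀ k n N E A t → 1ℤ ≤ k → 1ℤ ≤ n → E ≡ + 4 * (k * k) * N → 0ℤ ≤ E → E ≤ n →
    (k - 1ℤ) * (n * (n - 1ℤ) * (n - + 2) * E) ≤ (A * E + n * (n - 1ℤ) * (n - + 2)) * (k * k) → A ≤ t →
    N * ((k - 1ℤ) * (n * n * n) - k * k * t) ≤ n * n * n
  edge-arith k n N E A t k≥1 n≥1 E≡ E≥0 E≤n h hA = cancel (+ 4 * (k * k)) (1≤⇒0< (1≤* {+ 4} {k * k} 1≤+ (1≤* k≥1 k≥1)))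
    (subst (_≤ + 4 * (k * k) * (n * n * n)) (trans (cong (_* ((k - 1ℤ) * (n * n * n) - k * k * t)) E≡) (*-assoc (+ 4 * (k * k)) N ((k - 1ℤ) * (n * n * n) - k * k * t)))
      (alg k n E A t k≥1 n≥1 E≥0 E≤n h hA))
    where
    alg : ∀ k n E A t → 1ℤ ≤ k → 1ℤ ≤ n → 0ℤ ≤ E → E ≤ n →
      (k - 1ℤ) * (n * (n - 1ℤ) * (n - + 2) * E) ≤ (A * E + n * (n - 1ℤ) * (n - + 2)) * (k * k) → A ≤ t →
      E * ((k - 1ℤ) * (n * n * n) - k * k * t) ≤ + 4 * (k * k) * (n * n * n)
    alg k n E A t k≥1 n≥1 E≥0 E≤n h hA = cert (le⇒0≤ h ⊕ E≥0 ⊗ (k≥0 ⊗ k≥0) ⊗ le⇒0≤ hA ⊕ 0≤+ {3} ⊗ le⇒0≤ k≥1 ⊗ (n≥0 ⊗ n≥0) ⊗ le⇒0≤ E≤n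
        ⊕ 0≤+ {2} ⊗ E≥0 ⊗ le⇒0≤ k≥1 ⊗ n≥0
        ⊕ n≥0 ⊗ n≥0 ⊗ n≥0 ⊗ (0≤+ {3} ⊗ k≥0 ⊗ le⇒0≤ k≥1 ⊕ 0≤+ {3}) ⊕ k≥0 ⊗ k≥0 ⊗ n≥0 ⊗ (0≤+ {3} ⊗ le⇒0≤ n≥1 ⊕ 0≤+ {1}))
      (solve (k ∷ n ∷ E ∷ A ∷ t ∷ []))
      where
      k≥0 = 1≤⇒0≤ k≥1
      n≥0 = 1≤⇒0≤ n≥1

  pos-∸1 : ∀ k → 1 ℕ.≤ k → + (k ℕ.∸ 1) ≡ + k - 1ℤ
  pos-∸1 (suc k) _ = refl

  pos-² : ∀ k → + (k ℕ.^ 2) ≡ + k * + k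
  pos-² k = trans (pos-* k (k ℕ.* 1)) (cong (λ z → + k * + z) (ℕ.*-identityʳ k))

  pos-³ : ∀ n → + (n ℕ.^ 3) ≡ + n * + n * + n
  pos-³ n = trans (pos-* n (n ℕ.^ 2)) (trans (cong (+ n *_) (pos-² n)) (sym (*-assoc (+ n) (+ n) (+ n))))

  pos-∸ : ∀ {a b} → b ℕ.≤ a → + (a ℕ.∸ b) ≡ + a - + b
  pos-∸ {a} {b} h = sym (trans ([+m]-[+n]≡m⊖n a b) (⊖-≥ h))

  -- From the two densities to the coloured subgraph

  module Densities (k : ℕ) (k≥3 : 3 ℕ.≤ k) (Δ N : ℕ) (N≥1 : 1 ℕ.≤ N) (stable : Stability k (+ suc Δ) N)
    (E : ℕ) (E≡ : E ≡ 4 ℕ.* (k ℕ.* k) ℕ.* N) (n : ℕ) (n≥3 : 3 ℕ.≤ n) (E≤n : E ℕ.≤ n)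
    (H : ThreeGraph n) (cancellative : Cancellative H)
    (shadow-dense : frac (k ℕ.∸ 1) k ℚ.≤ shadowDensity H ℚ.+ frac 1 E)
    (edge-dense : frac (k ℕ.∸ 1) (k ℕ.^ 2) ℚ.≤ density H ℚ.+ frac 1 E) where
    open Link H cancellative

    k≥1 : 1 ℕ.≤ k
    k≥1 = ℕ.≤-trans (s≤s z≤n) k≥3

    E≡ℤ : + E ≡ + 4 * (+ k * + k) * + N
    E≡ℤ = trans (cong +_ E≡) (trans (pos-* (4 ℕ.* (k ℕ.* k)) N) (cong (_* + N) (trans (pos-* 4 (k ℕ.* k)) (cong (+ 4 *_) (pos-* k k)))))

    E≥1 : 1 ℕ.≤ E
    E≥1 = subst (1 ℕ.≤_) (sym E≡) (ℕ.*-mono-≤ (ℕ.*-mono-≤ {1} {4} (s≤s z≤n) (ℕ.*-mono-≤ k≥1 k≥1)) N≥1)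

    shadow-hyp : + N * ((+ k - 1ℤ) * (+ n * + n) - + k * Counting.g config) ≤ + n * + n
    shadow-hyp = shadow-arith (+ k) (+ n) (+ N) (+ E) (+ 2 * + length (shadow H)) (Counting.g config) (+≤+ k≥1) (+≤+ (ℕ.≤-trans (s≤s z≤n) n≥3)) E≡ℤ 0≤+ (+≤+ E≤n)
      (scaled (+ 2) (+ k - 1ℤ) (+ k) (+ (n C 2)) (+ n * (+ n - 1ℤ)) (+ length (shadow H)) (+ E) 0≤+ (2*C₂ n)
        (subst (λ z → z * (+ (n C 2) * + E) ≤ (+ length (shadow H) * + E + + (n C 2)) * + k) (pos-∸1 k k≥1) (frac-≤⇒ k≥1 (C₂-positive n n≥3) E≥1 shadow-dense)))
      shadow-count

    edge-hyp : + N * ((+ k - 1ℤ) * (+ n * + n * + n) - + k * + k * Counting.t config) ≤ + n * + n * + n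
    edge-hyp = edge-arith (+ k) (+ n) (+ N) (+ E) (+ 6 * + ∣ H ∣ₑ) (Counting.t config) (+≤+ k≥1) (+≤+ (ℕ.≤-trans (s≤s z≤n) n≥3)) E≡ℤ 0≤+ (+≤+ E≤n)
      (scaled (+ 6) (+ k - 1ℤ) (+ k * + k) (+ (n C 3)) (+ n * (+ n - 1ℤ) * (+ n - + 2)) (+ ∣ H ∣ₑ) (+ E) 0≤+ (6*C₃ n)
        (subst₂ (λ z q → z * (+ (n C 3) * + E) ≤ (+ ∣ H ∣ₑ * + E + + (n C 3)) * q) (pos-∸1 k k≥1) (pos-² k)
          (frac-≤⇒ (subst (1 ℕ.≤_) (cong (k ℕ.*_) (sym (ℕ.*-identityʳ k))) (ℕ.*-mono-≤ k≥1 k≥1)) (C₃-positive n n≥3) E≥1 edge-dense)))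
      edge-count

    pattern-of : Pattern config k (+ suc Δ)
    pattern-of = stable config (subst (1ℤ ≤_) (sym n′≡) (+≤+ (ℕ.≤-trans (s≤s z≤n) n≥3)))
      (subst (λ m → + N * ((+ k - 1ℤ) * (m * m * m) - + k * + k * Counting.t config) ≤ m * m * m) (sym n′≡) edge-hyp)
      (subst (λ m → + N * ((+ k - 1ℤ) * (m * m) - + k * Counting.g config) ≤ m * m) (sym n′≡) shadow-hyp)

    open Colour {k} {+ suc Δ} 0≤+ pattern-of

    removed-nat : suc Δ ℕ.* (∣ H ∣ₑ ℕ.∸ ∣ kept ∣ₑ) ℕ.≤ n ℕ.^ 3
    removed-nat = drop‿+≤+ (subst₂ _≤_
      (sym (trans (pos-* (suc Δ) (∣ H ∣ₑ ℕ.∸ ∣ kept ∣ₑ)) (cong (+ suc Δ *_) (pos-∸ (length-filter good? (edges H))))))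
      (sym (pos-³ n)) removed-few)

    conclusion : Σ (ThreeGraph k) λ S → IsSTS S × Σ (ThreeGraph n) λ H′ → SubGraph H′ H ×
      (suc Δ ℕ.* (∣ H ∣ₑ ℕ.∸ ∣ H′ ∣ₑ) ℕ.≤ n ℕ.^ 3) × Colorable H′ S
    conclusion = system , system-IsSTS , kept , kept-⊆ , removed-nat , kept-colorable

  theorem : ∀ k → 3 ℕ.≤ k → ∀ δ → ℚ.0ℚ ℚ.< δ → Σ ℚ.ℚ λ ε → ℚ.0ℚ ℚ.< ε × Σ ℕ λ n₀ →
    ∀ n → n₀ ℕ.≤ n → (H : ThreeGraph n) → Cancellative H →
    (let x = shadowDensity H ℚ.- frac (k ℕ.∸ 1) k; y = density H ℚ.- frac (k ℕ.∸ 1) (k ℕ.^ 2)) →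
    x ℚ.* x ℚ.+ y ℚ.* y ℚ.≤ ε →
    Σ (ThreeGraph k) λ S → IsSTS S × Σ (ThreeGraph n) λ H′ → SubGraph H′ H ×
    (frac (∣ H ∣ₑ ℕ.∸ ∣ H′ ∣ₑ) 1 ℚ.≤ δ ℚ.* frac (n ℕ.^ 3) 1) × Colorable H′ S
  theorem k k≥3 δ δ>0 = with-Δ (reciprocal-below δ δ>0)
    where
    Conclusion : Set
    Conclusion = Σ ℚ.ℚ λ ε → ℚ.0ℚ ℚ.< ε × Σ ℕ λ n₀ →
      ∀ n → n₀ ℕ.≤ n → (H : ThreeGraph n) → Cancellative H →
      (let x = shadowDensity H ℚ.- frac (k ℕ.∸ 1) k; y = density H ℚ.- frac (k ℕ.∸ 1) (k ℕ.^ 2)) →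
      x ℚ.* x ℚ.+ y ℚ.* y ℚ.≤ ε →
      Σ (ThreeGraph k) λ S → IsSTS S × Σ (ThreeGraph n) λ H′ → SubGraph H′ H ×
      (frac (∣ H ∣ₑ ℕ.∸ ∣ H′ ∣ₑ) 1 ℚ.≤ δ ℚ.* frac (n ℕ.^ 3) 1) × Colorable H′ S
    with-E : ∀ Δ N E → 1 ℕ.≤ N → E ≡ 4 ℕ.* (k ℕ.* k) ℕ.* N → frac 1 (suc Δ) ℚ.≤ δ → Stability k (+ suc Δ) N →
      ∀ r → frac 1 E ≡ r → ℚ.0ℚ ℚ.< r → Conclusion
    -- The disc has radius `r = 1 / E`, hence `ε = r²`. The bound `3 + E` on `n` makes both binomial
    -- coefficients positive and gives `E ≤ n`.
    with-E Δ N E N≥1 E≡ Δ≤ stable r r≡ r>0 = r ℚ.* r , square-pos r r>0 , 3 ℕ.+ E , λ n n≥ H canc h →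
      let dense = within-disc (shadowDensity H) (frac (k ℕ.∸ 1) k) (density H) (frac (k ℕ.∸ 1) (k ℕ.^ 2)) r (ℚ.<⇒≤ r>0) h
          S , sts , H′ , sub , few , col = Densities.conclusion k k≥3 Δ N N≥1 stable E E≡ n
            (ℕ.≤-trans (ℕ.m≤m+n 3 E) n≥) (ℕ.≤-trans (ℕ.m≤n+m E 3) n≥) H canc
            (subst (λ z → frac (k ℕ.∸ 1) k ℚ.≤ shadowDensity H ℚ.+ z) (sym r≡) (proj₁ dense))
            (subst (λ z → frac (k ℕ.∸ 1) (k ℕ.^ 2) ℚ.≤ density H ℚ.+ z) (sym r≡) (proj₂ dense))
      in S , sts , H′ , sub , frac-bound (∣ H ∣ₑ ℕ.∸ ∣ H′ ∣ₑ) (n ℕ.^ 3) Δ Δ≤ few , col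
    with-N : ∀ Δ → frac 1 (suc Δ) ℚ.≤ δ → (Σ ℕ λ N → 1 ℕ.≤ N × Stability k (+ suc Δ) N) → Conclusion
    with-N Δ Δ≤ (N , N≥1 , stable) = with-E Δ N (4 ℕ.* (k ℕ.* k) ℕ.* N) N≥1 refl Δ≤ stable _ refl
      (frac-pos (4 ℕ.* (k ℕ.* k) ℕ.* N) (ℕ.*-mono-≤ (ℕ.*-mono-≤ {1} {4} (s≤s z≤n) (ℕ.*-mono-≤ k≥1 k≥1)) N≥1))
      where
      k≥1 : 1 ℕ.≤ k
      k≥1 = ℕ.≤-trans (s≤s z≤n) k≥3
    with-Δ : (Σ ℕ λ Δ → frac 1 (suc Δ) ℚ.≤ δ) → Conclusion
    with-Δ (Δ , Δ≤) = with-N Δ Δ≤ (stability k k≥3 (+ suc Δ) 1≤+)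

open import Data.Nat using (ℕ; _≤_; _%_; _^_; _∸_)
open import Data.Integer using (+_)
open import Data.Rational using (ℚ; 0ℚ; _-_; _*_; _+_; _/_) renaming (_≤_ to _≤ℚ_; _<_ to _<ℚ_)
open import Data.Product using (Σ; _×_)
open import Data.Sum using (_⊎_)
open import Relation.Binary.PropositionalEquality using (_≡_)

theorem1p6 : (k : ℕ) → 3 ≤ k → (k % 6 ≡ 1 ⊎ k % 6 ≡ 3) →
    (δ : ℚ) → 0ℚ <ℚ δ →
    Σ ℚ λ ε → 0ℚ <ℚ ε × Σ ℕ λ n₀ →
    (n : ℕ) → n₀ ≤ n → (H : ThreeGraph n) → Cancellative H →
    ((shadowDensity H - frac (k ∸ 1) k) * (shadowDensity H - frac (k ∸ 1) k)
    + (density H - frac (k ∸ 1) (k ^ 2)) * (density H - frac (k ∸ 1) (k ^ 2))) ≤ℚ ε →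
    Σ (ThreeGraph k) λ S → IsSTS S ×
    Σ (ThreeGraph n) λ H' → SubGraph H' H ×
    (frac (∣ H ∣ₑ ∸ ∣ H' ∣ₑ) 1 ≤ℚ δ * frac (n ^ 3) 1) × Colorable H' S
theorem1p6 k k≥3 _ δ δ>0 = FromDensities.theorem k k≥3 δ δ>0
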